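{- There exist absolute constants $C,k>0$ such that the following holds for every prime power $q$; write $\Lambda=C(\log q)^k$. Let $A,X\subseteq\mathbb{F}_q^*$ be nonempty. If there is a positive real number $K>0$ such that \[ \sum_{\xi\in X}E(A,\xi A)\ \ge\ \frac{|A|^3|X|}{K}, \] then there exist elements $\bar a\in A$ and $x_0\in X$ and subsets $A_1\subseteq A-\bar a$ and $X'\subseteq x_0^{ -1}X$ such that: \begin{enumerate} \item[(i)] $|A_1|\ge\Lambda^{ -1}K^{ -85}|A|$ and $|X'|\ge\Lambda^{ -1}K^{ -5}|X|$; \item[(ii)] $|A_1+X'A_1|\le\Lambda K^{226}|A_1|$; \item[(iii)] $|A_1+A_1|\le\Lambda K^{92}|A_1|$ and $|A_1-A_1|\le\Lambda K^{92}|A_1|$; \item[(iv)] $|A_1+x'A_1|\le\Lambda K^{126}|A_1|$ and $|A_1-x'A_1|\le\Lambda K^{126}|A_1|$ for all $x'\in X'$. \end{enumerate} Moreover, if $E(A,\xi A)\ge|A|^3/K$ for all $\xi\in X$, then the same holds with $|X'|\ge\Lambda^{ -1}K^{ -4}|X|$.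
   Context: $\mathbb{F}_q$ is the finite field with $q$ elements, $\mathbb{F}_q^*=\mathbb{F}_q\setminus\{0\}$. For $A\subseteq\mathbb{F}_q$ and $\xi\in\mathbb{F}_q^*$, $E(A,\xi A)=|\{(a_1,a_2,a_3,a_4)\in A^4: a_1-a_2=\xi(a_3-a_4)\}|$. Sums, differences, products and dilates of sets are elementwise, e.g. $X'A_1=\{xa:x\in X',a\in A_1\}$, $x_0^{ -1}X=\{x_0^{ -1}x:x\in X\}$, $A-\bar a=\{a-\bar a:a\in A\}$. -}

module Defs where

open import Data.Nat.Base as ℕ using (ℕ; zero; suc)
import Data.Nat.Properties as ℕ
import Data.Integer.Base as ℤ
import Data.Integer.Properties as ℤ
open import Data.Product.Base using (Σ; ∃; _×_; _,_; proj₁; proj₂)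
open import Data.Sum.Base using (inj₁; inj₂)
open import Data.Rational.Base as ℚ
  using (ℚ; 0ℚ; 1ℚ; ½; _+_; _*_; _-_; -_; _≤_; _<_; ∣_∣)
import Data.Rational.Properties as ℚ
import Data.Rational.Unnormalised.Base as ℚᵘ
import Data.Rational.Unnormalised.Properties as ℚᵘ
open import Data.Rational.Solver using (module +-*-Solver)
open +-*-Solver using (solve; _:+_; _:*_; :-_; con; _:=_)
open import Algebra.Bundles using (CommutativeRing)
open import Algebra.Properties.Semiring.Exp (CommutativeRing.semiring ℚ.+-*-commutativeRing)
  using (_^_; ^-assocʳ; ^-homo-*)
open import Level using (0ℓ)
open import Data.Nat.Primality using (Prime; prime⇒nonTrivial; prime⇒nonZero)
open import Data.Fin.Base using (Fin)
import Data.Fin.Properties as Fin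
open import Data.Fin.Subset using (Subset; _∈_; _⊆_; ⋃; ⁅_⁆) renaming (∣_∣ to card)
open import Data.Fin.Subset.Properties using (_∈?_)
open import Data.List.Base
  using (List; length; map; filter; allFin; cartesianProduct; cartesianProductWith)
open import Data.Nat.ListAction using (sum)
open import Function.Bundles using (Inverse)
open import Function.Properties.Inverse using (Inverse⇒Injection)
open import Relation.Nullary using (Dec; yes; no; ¬_; contradiction)
open import Relation.Nullary.Decidable using (via-injection)
open import Relation.Binary.PropositionalEquality as ≡
  using (_≡_; _≢_; refl; sym; trans; cong; cong₂; subst; subst₂)

module RationalFacts where

  open ℚ.≤-Reasoning

  *-monoˡ : ∀ {p q} r → 0ℚ ≤ r → p ≤ q → r * p ≤ r * q
  *-monoˡ r 0≤r = ℚ.*-monoˡ-≤-nonNeg r {{ℚ.nonNegative 0≤r}}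

  *-monoʳ : ∀ {p q} r → 0ℚ ≤ r → p ≤ q → p * r ≤ q * r
  *-monoʳ r 0≤r = ℚ.*-monoʳ-≤-nonNeg r {{ℚ.nonNegative 0≤r}}

  *-mono : ∀ {p q r s} → 0ℚ ≤ p → 0ℚ ≤ s → p ≤ q → r ≤ s → p * r ≤ q * s
  *-mono {p} {q} {r} {s} 0≤p 0≤s p≤q r≤s =
    ℚ.≤-trans (*-monoˡ p 0≤p r≤s) (*-monoʳ s 0≤s p≤q)

  *-nonNeg : ∀ {p q} → 0ℚ ≤ p → 0ℚ ≤ q → 0ℚ ≤ p * q
  *-nonNeg {p} {q} 0≤p 0≤q =
    ℚ.nonNegative⁻¹ (p * q)
      {{ℚ.nonNeg*nonNeg⇒nonNeg p {{ℚ.nonNegative 0≤p}} q {{ℚ.nonNegative 0≤q}}}}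

  *-pos : ∀ {p q} → 0ℚ < p → 0ℚ < q → 0ℚ < p * q
  *-pos {p} {q} 0<p 0<q =
    ℚ.positive⁻¹ (p * q) {{ℚ.pos*pos⇒pos p {{ℚ.positive 0<p}} q {{ℚ.positive 0<q}}}}

  +-nonNeg : ∀ {p q} → 0ℚ ≤ p → 0ℚ ≤ q → 0ℚ ≤ p + q
  +-nonNeg 0≤p 0≤q = ℚ.+-mono-≤ 0≤p 0≤q

  +-pos : ∀ {p q} → 0ℚ < p → 0ℚ ≤ q → 0ℚ < p + q
  +-pos 0<p 0≤q = ℚ.+-mono-<-≤ 0<p 0≤q

  p≤p+q : ∀ p {q} → 0ℚ ≤ q → p ≤ p + q
  p≤p+q p {q} 0≤q = subst (_≤ p + q) (ℚ.+-identityʳ p) (ℚ.+-monoʳ-≤ p 0≤q)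

  p≤q+p : ∀ p {q} → 0ℚ ≤ q → p ≤ q + p
  p≤q+p p {q} 0≤q = subst (p ≤_) (ℚ.+-comm p q) (p≤p+q p 0≤q)

  p≤q⇒0≤q-p : ∀ {p q} → p ≤ q → 0ℚ ≤ q - p
  p≤q⇒0≤q-p {p} {q} p≤q = subst (_≤ q - p) (ℚ.+-inverseʳ p) (ℚ.+-monoˡ-≤ (- p) p≤q)

  0≤q-p⇒p≤q : ∀ {p q} → 0ℚ ≤ q - p → p ≤ q
  0≤q-p⇒p≤q {p} {q} h =
    subst₂ _≤_ (ℚ.+-identityˡ p)
      (solve 2 (λ a b → (a :+ :- b) :+ b := a) refl q p) (ℚ.+-monoˡ-≤ p h)

  p<q⇒0<q-p : ∀ {p q} → p < q → 0ℚ < q - p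
  p<q⇒0<q-p {p} {q} p<q = subst (_< q - p) (ℚ.+-inverseʳ p) (ℚ.+-monoˡ-< (- p) p<q)

  p≤∣p∣ : ∀ p → p ≤ ∣ p ∣
  p≤∣p∣ p with ℚ.∣p∣≡p∨∣p∣≡-p p
  ... | inj₁ eq = ℚ.≤-reflexive (sym eq)
  ... | inj₂ eq with ℚ.≤-total 0ℚ p
  ...   | inj₁ 0≤p = ℚ.≤-reflexive (sym (ℚ.0≤p⇒∣p∣≡p 0≤p))
  ...   | inj₂ p≤0 = ℚ.≤-trans p≤0 (ℚ.0≤∣p∣ p)

  -p≤∣p∣ : ∀ p → - p ≤ ∣ p ∣
  -p≤∣p∣ p = subst (- p ≤_) (ℚ.∣-p∣≡∣p∣ p) (p≤∣p∣ (- p))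

  ∣∣≤ : ∀ {p q} → p ≤ q → - p ≤ q → ∣ p ∣ ≤ q
  ∣∣≤ {p} p≤q -p≤q with ℚ.∣p∣≡p∨∣p∣≡-p p
  ... | inj₁ eq = subst (_≤ _) (sym eq) p≤q
  ... | inj₂ eq = subst (_≤ _) (sym eq) -p≤q

  -‿involutive : ∀ p → - - p ≡ p
  -‿involutive = solve 1 (λ a → :- :- a := a) refl

  ∣∣≤⇒-≤ : ∀ {p q} → ∣ p ∣ ≤ q → - q ≤ p
  ∣∣≤⇒-≤ {p} {q} h =
    subst (- q ≤_) (-‿involutive p) (ℚ.neg-antimono-≤ (ℚ.≤-trans (-p≤∣p∣ p) h))

  ∣p-q∣≡∣q-p∣ : ∀ p q → ∣ p - q ∣ ≡ ∣ q - p ∣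
  ∣p-q∣≡∣q-p∣ p q = trans
    (cong ∣_∣ (solve 2 (λ a b → a :+ :- b := :- (b :+ :- a)) refl p q))
    (ℚ.∣-p∣≡∣p∣ (q - p))

  0<1 : 0ℚ < 1ℚ
  0<1 = ℚ.positive⁻¹ 1ℚ

  0≤1 : 0ℚ ≤ 1ℚ
  0≤1 = ℚ.<⇒≤ 0<1

  0<½ : 0ℚ < ½
  0<½ = ℚ.positive⁻¹ ½

  2ℚ : ℚ
  2ℚ = 1ℚ + 1ℚ

  0≤2 : 0ℚ ≤ 2ℚ
  0≤2 = ℚ.nonNegative⁻¹ 2ℚ

  half+half : ∀ p → ½ * p + ½ * p ≡ p
  half+half = solve 1 (λ a → con ½ :* a :+ con ½ :* a := a) refl

  half-pos : ∀ {p} → 0ℚ < p → 0ℚ < ½ * p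
  half-pos = *-pos 0<½

  ι : ℕ → ℚ
  ι n = ℤ.+ n ℚ./ 1

  ι-suc : ∀ n → ι (suc n) ≡ 1ℚ + ι n
  ι-suc n = ℚ.toℚᵘ-injective
    (ℚᵘ.≃-trans (ℚ.toℚᵘ-fromℚᵘ (ℚᵘ.mkℚᵘ (ℤ.+ suc n) 0))
    (ℚᵘ.≃-trans (ℚᵘ.*≡* (cong (λ x → (ℤ.+ 1 ℤ.+ x) ℤ.* ℤ.+ 1) (sym (ℤ.*-identityʳ (ℤ.+ n)))))
    (ℚᵘ.≃-trans (ℚᵘ.+-congʳ (ℚ.toℚᵘ 1ℚ) (ℚᵘ.≃-sym (ℚ.toℚᵘ-fromℚᵘ (ℚᵘ.mkℚᵘ (ℤ.+ n) 0))))
             (ℚᵘ.≃-sym (ℚ.toℚᵘ-homo-+ 1ℚ (ι n))))))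

  0≤ι : ∀ n → 0ℚ ≤ ι n
  0≤ι zero    = ℚ.≤-refl
  0≤ι (suc n) = subst (0ℚ ≤_) (sym (ι-suc n)) (+-nonNeg 0≤1 (0≤ι n))

  1≤ι-suc : ∀ n → 1ℚ ≤ ι (suc n)
  1≤ι-suc n = subst (1ℚ ≤_) (sym (ι-suc n)) (p≤p+q 1ℚ (0≤ι n))

  0<ι-suc : ∀ n → 0ℚ < ι (suc n)
  0<ι-suc n = ℚ.<-≤-trans 0<1 (1≤ι-suc n)

  ι-mono : ∀ {m n} → m ℕ.≤ n → ι m ≤ ι n
  ι-mono {n = n} ℕ.z≤n = 0≤ι n
  ι-mono (ℕ.s≤s {m} {n} m≤n) =
    subst₂ _≤_ (sym (ι-suc m)) (sym (ι-suc n)) (ℚ.+-monoʳ-≤ 1ℚ (ι-mono m≤n))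

  archimedean : ∀ p → ∃ λ n → p ≤ ι n
  archimedean p@(ℚ.mkℚ n d-1 _) = ℤ.∣ n ∣ , (begin
    p                                ≤⟨ p≤∣p∣ p ⟩
    ∣ p ∣                            ≤⟨ ℚ.toℚᵘ-cancel-≤ (ℚᵘ.≤-respʳ-≃
        (ℚᵘ.≃-sym (ℚ.toℚᵘ-fromℚᵘ (ℚᵘ.mkℚᵘ (ℤ.+ ℤ.∣ n ∣) 0)))
        (ℚᵘ.*≤* (ℤ.*-monoˡ-≤-nonNeg (ℤ.+ ℤ.∣ n ∣) (ℤ.+≤+ (ℕ.s≤s ℕ.z≤n))))) ⟩
    ι ℤ.∣ n ∣                        ∎)

  -- The reciprocal, with the value 0 at 0.
  recip : ℚ → ℚ
  recip p with p ℚ.≟ 0ℚ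
  ... | yes _  = 0ℚ
  ... | no p≢0 = (ℚ.1/ p) {{ℚ.≢-nonZero p≢0}}

  *-recip : ∀ {p} → 0ℚ < p → p * recip p ≡ 1ℚ
  *-recip {p} 0<p with p ℚ.≟ 0ℚ
  ... | yes refl = contradiction 0<p (ℚ.<-irrefl refl)
  ... | no p≢0   = ℚ.*-inverseʳ p {{ℚ.≢-nonZero p≢0}}

  recip-pos : ∀ {p} → 0ℚ < p → 0ℚ < recip p
  recip-pos {p} 0<p = ℚ.*-cancelˡ-<-nonNeg p {{ℚ.nonNegative (ℚ.<⇒≤ 0<p)}}
    (subst₂ _<_ (sym (ℚ.*-zeroʳ p)) (sym (*-recip 0<p)) 0<1)

  recip-antimono : ∀ {p q} → 0ℚ < p → p ≤ q → recip q ≤ recip p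
  recip-antimono {p} {q} 0<p p≤q = begin
    recip q                    ≡⟨ ℚ.*-identityʳ (recip q) ⟨
    recip q * 1ℚ               ≡⟨ cong (recip q *_) (*-recip 0<p) ⟨
    recip q * (p * recip p)    ≤⟨ *-monoˡ (recip q) (ℚ.<⇒≤ (recip-pos 0<q)) (*-monoʳ (recip p) (ℚ.<⇒≤ (recip-pos 0<p)) p≤q) ⟩
    recip q * (q * recip p)    ≡⟨ solve 3 (λ a b c → a :* (b :* c) := (b :* a) :* c) refl (recip q) q (recip p) ⟩
    (q * recip q) * recip p    ≡⟨ cong (_* recip p) (*-recip 0<q) ⟩
    1ℚ * recip p               ≡⟨ ℚ.*-identityˡ (recip p) ⟩
    recip p                    ∎
    where
    0<q : 0ℚ < q
    0<q = ℚ.<-≤-trans 0<p p≤q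

  recip≤1 : ∀ {p} → 1ℚ ≤ p → recip p ≤ 1ℚ
  recip≤1 1≤p = recip-antimono 0<1 1≤p

  -- p ≤ q r with r > 0 gives p / r ≤ q
  ≤*⇒*recip≤ : ∀ {p q r} → 0ℚ < r → p ≤ q * r → p * recip r ≤ q
  ≤*⇒*recip≤ {p} {q} {r} 0<r h = begin
    p * recip r          ≤⟨ *-monoʳ (recip r) (ℚ.<⇒≤ (recip-pos 0<r)) h ⟩
    (q * r) * recip r    ≡⟨ ℚ.*-assoc q r (recip r) ⟩
    q * (r * recip r)    ≡⟨ cong (q *_) (*-recip 0<r) ⟩
    q * 1ℚ               ≡⟨ ℚ.*-identityʳ q ⟩
    q                    ∎

  ^-nonNeg : ∀ {p} n → 0ℚ ≤ p → 0ℚ ≤ p ^ n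
  ^-nonNeg zero    0≤p = 0≤1
  ^-nonNeg (suc n) 0≤p = *-nonNeg 0≤p (^-nonNeg n 0≤p)

  ^-pos : ∀ {p} n → 0ℚ < p → 0ℚ < p ^ n
  ^-pos zero    0<p = 0<1
  ^-pos (suc n) 0<p = *-pos 0<p (^-pos n 0<p)

  ^-mono : ∀ {p q} n → 0ℚ ≤ p → p ≤ q → p ^ n ≤ q ^ n
  ^-mono zero    0≤p p≤q = ℚ.≤-refl
  ^-mono (suc n) 0≤p p≤q =
    *-mono 0≤p (^-nonNeg n (ℚ.≤-trans 0≤p p≤q)) p≤q (^-mono n 0≤p p≤q)

  1^n≡1 : ∀ n → 1ℚ ^ n ≡ 1ℚ
  1^n≡1 zero    = refl
  1^n≡1 (suc n) = trans (ℚ.*-identityˡ (1ℚ ^ n)) (1^n≡1 n)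

  ^≤1 : ∀ {p} n → 0ℚ ≤ p → p ≤ 1ℚ → p ^ n ≤ 1ℚ
  ^≤1 {p} n 0≤p p≤1 = subst (p ^ n ≤_) (1^n≡1 n) (^-mono n 0≤p p≤1)

  *-^ : ∀ p q n → (p * q) ^ n ≡ p ^ n * q ^ n
  *-^ p q zero    = refl
  *-^ p q (suc n) = trans (cong ((p * q) *_) (*-^ p q n))
    (solve 4 (λ a b c d → (a :* b) :* (c :* d) := (a :* c) :* (b :* d)) refl p q (p ^ n) (q ^ n))

  ∣^∣ : ∀ p n → ∣ p ^ n ∣ ≡ ∣ p ∣ ^ n
  ∣^∣ p zero    = refl
  ∣^∣ p (suc n) = trans (ℚ.∣p*q∣≡∣p∣*∣q∣ p (p ^ n)) (cong (∣ p ∣ *_) (∣^∣ p n))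

  0≤p² : ∀ p → 0ℚ ≤ p * p
  0≤p² p with ℚ.≤-total 0ℚ p
  ... | inj₁ 0≤p = *-nonNeg 0≤p 0≤p
  ... | inj₂ p≤0 = subst (0ℚ ≤_) (solve 1 (λ a → :- a :* :- a := a :* a) refl p)
                     (*-nonNeg (ℚ.neg-antimono-≤ p≤0) (ℚ.neg-antimono-≤ p≤0))

  bernoulli : ∀ p n → 0ℚ ≤ 1ℚ + p → 1ℚ + ι n * p ≤ (1ℚ + p) ^ n
  bernoulli p zero    0≤1+p = ℚ.≤-reflexive (trans (cong (1ℚ +_) (ℚ.*-zeroˡ p)) (ℚ.+-identityʳ 1ℚ))
  bernoulli p (suc n) 0≤1+p = begin
    1ℚ + ι (suc n) * p                         ≡⟨ cong (λ x → 1ℚ + x * p) (ι-suc n) ⟩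
    1ℚ + (1ℚ + ι n) * p                        ≤⟨ p≤p+q _ (*-nonNeg (0≤ι n) (0≤p² p)) ⟩
    1ℚ + (1ℚ + ι n) * p + ι n * (p * p)        ≡⟨ solve 2 (λ a b → (con 1ℚ :+ (con 1ℚ :+ b) :* a) :+ b :* (a :* a) := (con 1ℚ :+ a) :* (con 1ℚ :+ b :* a)) refl p (ι n) ⟩
    (1ℚ + p) * (1ℚ + ι n * p)                  ≤⟨ *-monoˡ (1ℚ + p) 0≤1+p (bernoulli p n 0≤1+p) ⟩
    (1ℚ + p) * (1ℚ + p) ^ n                    ∎

  -- If 0 ≤ p < 1 then pⁿ is eventually below any ε > 0.
  ^-small : ∀ {p ε} → 0ℚ ≤ p → p < 1ℚ → 0ℚ < ε → ∃ λ n → p ^ n ≤ ε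
  ^-small {p} {ε} 0≤p p<1 0<ε = n , (begin
      p ^ n                                  ≡⟨ ℚ.*-identityʳ (p ^ n) ⟨
      p ^ n * 1ℚ                             ≡⟨ cong (p ^ n *_) (*-recip 0<εσ) ⟨
      p ^ n * ((ε * σ) * recip (ε * σ))      ≤⟨ *-monoˡ (p ^ n) (^-nonNeg n 0≤p) (*-monoˡ (ε * σ) (ℚ.<⇒≤ 0<εσ) (proj₂ (archimedean (recip (ε * σ))))) ⟩
      p ^ n * ((ε * σ) * ι n)                ≡⟨ solve 4 (λ a b c d → a :* ((b :* c) :* d) := b :* (a :* (d :* c))) refl (p ^ n) ε σ (ι n) ⟩
      ε * (p ^ n * (ι n * σ))                ≤⟨ *-monoˡ ε (ℚ.<⇒≤ 0<ε) (*-monoˡ (p ^ n) (^-nonNeg n 0≤p) (p≤q+p (ι n * σ) 0≤1)) ⟩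
      ε * (p ^ n * (1ℚ + ι n * σ))           ≤⟨ *-monoˡ ε (ℚ.<⇒≤ 0<ε) (*-monoˡ (p ^ n) (^-nonNeg n 0≤p) (bernoulli σ n (+-nonNeg 0≤1 0≤σ))) ⟩
      ε * (p ^ n * (1ℚ + σ) ^ n)             ≡⟨ cong (ε *_) (*-^ p (1ℚ + σ) n) ⟨
      ε * (p * (1ℚ + σ)) ^ n                 ≤⟨ *-monoˡ ε (ℚ.<⇒≤ 0<ε) (^≤1 n (*-nonNeg 0≤p (+-nonNeg 0≤1 0≤σ)) p[1+σ]≤1) ⟩
      ε * 1ℚ                                 ≡⟨ ℚ.*-identityʳ ε ⟩
      ε                                      ∎)
    where
    σ : ℚ
    σ = 1ℚ - p
    0<σ : 0ℚ < σ
    0<σ = p<q⇒0<q-p p<1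
    0≤σ : 0ℚ ≤ σ
    0≤σ = ℚ.<⇒≤ 0<σ
    0<εσ : 0ℚ < ε * σ
    0<εσ = *-pos 0<ε 0<σ
    n : ℕ
    n = proj₁ (archimedean (recip (ε * σ)))
    p[1+σ]≤1 : p * (1ℚ + σ) ≤ 1ℚ
    p[1+σ]≤1 = 0≤q-p⇒p≤q (subst (0ℚ ≤_)
      (solve 1 (λ a → (con 1ℚ :+ :- a) :* (con 1ℚ :+ :- a) := con 1ℚ :+ :- (a :* (con 1ℚ :+ (con 1ℚ :+ :- a)))) refl p)
      (*-nonNeg 0≤σ 0≤σ))

Eventually : (ℕ → Set) → Set
Eventually P = ∃ λ N → ∀ n → N ℕ.≤ n → P n

record IsCauchy (s : ℕ → ℚ) : Set where
  field
    modulus : ∀ ε → 0ℚ < ε → ∃ λ N → ∀ m n → N ℕ.≤ m → N ℕ.≤ n → ∣ s m - s n ∣ ≤ ε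

open IsCauchy public

module CauchyFacts where

  open RationalFacts
  open ℚ.≤-Reasoning

  both : ∀ {P Q : ℕ → Set} → Eventually P → Eventually Q → Eventually (λ n → P n × Q n)
  both (M , p) (N , q) = M ℕ.⊔ N , λ n M⊔N≤n →
    p n (ℕ.m⊔n≤o⇒m≤o M N M⊔N≤n) , q n (ℕ.m⊔n≤o⇒n≤o M N M⊔N≤n)

  cauchy-const : ∀ p → IsCauchy (λ _ → p)
  cauchy-const p .modulus ε 0<ε = 0 , λ _ _ _ _ →
    subst (λ x → ∣ x ∣ ≤ ε) (sym (ℚ.+-inverseʳ p)) (ℚ.<⇒≤ 0<ε)

  cauchy-+ : ∀ {s t} → IsCauchy s → IsCauchy t → IsCauchy (λ n → s n + t n)
  cauchy-+ {s} {t} s-cauchy t-cauchy .modulus ε 0<ε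
    with modulus s-cauchy (½ * ε) (half-pos 0<ε) | modulus t-cauchy (½ * ε) (half-pos 0<ε)
  ... | M , p | N , q = M ℕ.⊔ N , λ m n h k → begin
    ∣ (s m + t m) - (s n + t n) ∣      ≡⟨ cong ∣_∣ (solve 4 (λ a b c d → (a :+ b) :+ :- (c :+ d) := (a :+ :- c) :+ (b :+ :- d)) refl (s m) (t m) (s n) (t n)) ⟩
    ∣ (s m - s n) + (t m - t n) ∣      ≤⟨ ℚ.∣p+q∣≤∣p∣+∣q∣ (s m - s n) (t m - t n) ⟩
    ∣ s m - s n ∣ + ∣ t m - t n ∣      ≤⟨ ℚ.+-mono-≤
                                            (p m n (ℕ.m⊔n≤o⇒m≤o M N h) (ℕ.m⊔n≤o⇒m≤o M N k))
                                            (q m n (ℕ.m⊔n≤o⇒n≤o M N h) (ℕ.m⊔n≤o⇒n≤o M N k)) ⟩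
    ½ * ε + ½ * ε                      ≡⟨ half+half ε ⟩
    ε                                  ∎

  cauchy-bounded : ∀ {s} → IsCauchy s → ∃ λ B → 0ℚ < B × Eventually (λ n → ∣ s n ∣ ≤ B)
  cauchy-bounded {s} s-cauchy with modulus s-cauchy 1ℚ 0<1
  ... | N , p = 1ℚ + ∣ s N ∣ , +-pos 0<1 (ℚ.0≤∣p∣ (s N)) , N , λ n N≤n → begin
    ∣ s n ∣                    ≡⟨ cong ∣_∣ (solve 2 (λ a b → a := (a :+ :- b) :+ b) refl (s n) (s N)) ⟩
    ∣ (s n - s N) + s N ∣      ≤⟨ ℚ.∣p+q∣≤∣p∣+∣q∣ (s n - s N) (s N) ⟩
    ∣ s n - s N ∣ + ∣ s N ∣    ≤⟨ ℚ.+-monoˡ-≤ ∣ s N ∣ (p n N N≤n ℕ.≤-refl) ⟩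
    1ℚ + ∣ s N ∣               ∎

  product-difference : ∀ a b c d → a * b - c * d ≡ a * (b - d) + d * (a - c)
  product-difference = solve 4 (λ a b c d →
    a :* b :+ :- (c :* d) := a :* (b :+ :- d) :+ d :* (a :+ :- c)) refl

  quotient : ∀ p q → 0ℚ < p → 0ℚ < q → ∃ λ r → 0ℚ < r × p * r ≡ q
  quotient p q 0<p 0<q = q * recip p , *-pos 0<q (recip-pos 0<p) ,
    trans (solve 3 (λ b e r → b :* (e :* r) := e :* (b :* r)) refl p q (recip p))
    (trans (cong (q *_) (*-recip 0<p)) (ℚ.*-identityʳ q))

  cauchy-* : ∀ {s t} → IsCauchy s → IsCauchy t → IsCauchy (λ n → s n * t n)
  cauchy-* {s} {t} s-cauchy t-cauchy .modulus ε 0<ε =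
    let A , 0<A , s-bounded = cauchy-bounded s-cauchy
        B , 0<B , t-bounded = cauchy-bounded t-cauchy
        α , 0<α , Aα≡½ε = quotient A (½ * ε) 0<A (half-pos 0<ε)
        β , 0<β , Bβ≡½ε = quotient B (½ * ε) 0<B (half-pos 0<ε)
        L , bounds = both s-bounded t-bounded
        M , p = modulus s-cauchy β 0<β
        N , q = modulus t-cauchy α 0<α
    in L ℕ.⊔ (M ℕ.⊔ N) , λ m n h k →
    let h′ = ℕ.m⊔n≤o⇒n≤o L (M ℕ.⊔ N) h
        k′ = ℕ.m⊔n≤o⇒n≤o L (M ℕ.⊔ N) k
    in begin
    ∣ s m * t m - s n * t n ∣                              ≡⟨ cong ∣_∣ (product-difference (s m) (t m) (s n) (t n)) ⟩
    ∣ s m * (t m - t n) + t n * (s m - s n) ∣              ≤⟨ ℚ.∣p+q∣≤∣p∣+∣q∣ (s m * (t m - t n)) (t n * (s m - s n)) ⟩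
    ∣ s m * (t m - t n) ∣ + ∣ t n * (s m - s n) ∣          ≡⟨ cong₂ _+_ (ℚ.∣p*q∣≡∣p∣*∣q∣ (s m) (t m - t n)) (ℚ.∣p*q∣≡∣p∣*∣q∣ (t n) (s m - s n)) ⟩
    ∣ s m ∣ * ∣ t m - t n ∣ + ∣ t n ∣ * ∣ s m - s n ∣      ≤⟨ ℚ.+-mono-≤
        (*-mono (ℚ.0≤∣p∣ (s m)) (ℚ.<⇒≤ 0<α)
          (proj₁ (bounds m (ℕ.m⊔n≤o⇒m≤o L (M ℕ.⊔ N) h)))
          (q m n (ℕ.m⊔n≤o⇒n≤o M N h′) (ℕ.m⊔n≤o⇒n≤o M N k′)))
        (*-mono (ℚ.0≤∣p∣ (t n)) (ℚ.<⇒≤ 0<β)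
          (proj₂ (bounds n (ℕ.m⊔n≤o⇒m≤o L (M ℕ.⊔ N) k)))
          (p m n (ℕ.m⊔n≤o⇒m≤o M N h′) (ℕ.m⊔n≤o⇒m≤o M N k′))) ⟩
    A * α + B * β                                          ≡⟨ cong₂ _+_ Aα≡½ε Bβ≡½ε ⟩
    ½ * ε + ½ * ε                                          ≡⟨ half+half ε ⟩
    ε                                                      ∎

  cauchy-^ : ∀ {s} k → IsCauchy s → IsCauchy (λ n → s n ^ k)
  cauchy-^ zero    s-cauchy = cauchy-const 1ℚ
  cauchy-^ (suc k) s-cauchy = cauchy-* s-cauchy (cauchy-^ k s-cauchy)

  cauchy-recip : ∀ {s} → IsCauchy s → ∀ δ → 0ℚ < δ → Eventually (λ n → δ ≤ s n) →
                 IsCauchy (λ n → recip (s n))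
  cauchy-recip {s} s-cauchy δ 0<δ (M , δ≤s) .modulus ε 0<ε
    with modulus s-cauchy (ε * (δ * δ)) (*-pos 0<ε (*-pos 0<δ 0<δ))
  ... | N , p = M ℕ.⊔ N , λ m n h k →
    let δ≤m = δ≤s m (ℕ.m⊔n≤o⇒m≤o M N h)
        δ≤n = δ≤s n (ℕ.m⊔n≤o⇒m≤o M N k)
        a = s m ; b = s n ; r = recip a ; r′ = recip b
        0<a = ℚ.<-≤-trans 0<δ δ≤m
        0<b = ℚ.<-≤-trans 0<δ δ≤n
        0≤r = ℚ.<⇒≤ (recip-pos 0<a)
        0≤r′ = ℚ.<⇒≤ (recip-pos 0<b)
    in begin
    ∣ r - r′ ∣                                   ≡⟨ cong ∣_∣ (cong₂ _-_ (sym (ℚ.*-identityʳ r)) (sym (ℚ.*-identityʳ r′))) ⟩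
    ∣ r * 1ℚ - r′ * 1ℚ ∣                         ≡⟨ cong ∣_∣ (cong₂ (λ x y → r * x - r′ * y) (sym (*-recip 0<b)) (sym (*-recip 0<a))) ⟩
    ∣ r * (b * r′) - r′ * (a * r) ∣              ≡⟨ cong ∣_∣ (solve 4 (λ a b r t → r :* (b :* t) :+ :- (t :* (a :* r)) := :- ((a :+ :- b) :* (r :* t))) refl a b r r′) ⟩
    ∣ - ((a - b) * (r * r′)) ∣                   ≡⟨ ℚ.∣-p∣≡∣p∣ ((a - b) * (r * r′)) ⟩
    ∣ (a - b) * (r * r′) ∣                       ≡⟨ ℚ.∣p*q∣≡∣p∣*∣q∣ (a - b) (r * r′) ⟩
    ∣ a - b ∣ * ∣ r * r′ ∣                       ≡⟨ cong (∣ a - b ∣ *_) (ℚ.0≤p⇒∣p∣≡p (*-nonNeg 0≤r 0≤r′)) ⟩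
    ∣ a - b ∣ * (r * r′)                         ≤⟨ *-mono (ℚ.0≤∣p∣ (a - b)) (*-nonNeg 0≤ρ 0≤ρ)
                                                      (p m n (ℕ.m⊔n≤o⇒n≤o M N h) (ℕ.m⊔n≤o⇒n≤o M N k))
                                                      (*-mono 0≤r 0≤ρ (recip-antimono 0<δ δ≤m) (recip-antimono 0<δ δ≤n)) ⟩
    (ε * (δ * δ)) * (ρ * ρ)                      ≡⟨ solve 3 (λ e d r → (e :* (d :* d)) :* (r :* r) := e :* ((d :* r) :* (d :* r))) refl ε δ ρ ⟩
    ε * ((δ * ρ) * (δ * ρ))                      ≡⟨ cong (λ x → ε * (x * x)) (*-recip 0<δ) ⟩
    ε * (1ℚ * 1ℚ)                                ≡⟨ ℚ.*-identityʳ ε ⟩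
    ε                                            ∎
    where
    ρ : ℚ
    ρ = recip δ
    0≤ρ : 0ℚ ≤ ρ
    0≤ρ = ℚ.<⇒≤ (recip-pos 0<δ)

  cauchy-approx : ∀ {s} →
    (∀ ε → 0ℚ < ε → ∃ λ t → IsCauchy t × Eventually (λ n → ∣ s n - t n ∣ ≤ ε)) → IsCauchy s
  cauchy-approx {s} approx .modulus ε 0<ε
    with approx (½ * (½ * ε)) (half-pos (half-pos 0<ε))
  ... | t , t-cauchy , M , p with modulus t-cauchy (½ * ε) (half-pos 0<ε)
  ...   | N , q = M ℕ.⊔ N , λ m n h k → begin
    ∣ s m - s n ∣                                          ≡⟨ cong ∣_∣ (solve 4 (λ a b c d → a :+ :- b := ((a :+ :- c) :+ (c :+ :- d)) :+ (d :+ :- b)) refl (s m) (s n) (t m) (t n)) ⟩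
    ∣ (s m - t m) + (t m - t n) + (t n - s n) ∣            ≤⟨ ℚ.≤-trans (ℚ.∣p+q∣≤∣p∣+∣q∣ (s m - t m + (t m - t n)) (t n - s n))
                                                                (ℚ.+-monoˡ-≤ ∣ t n - s n ∣ (ℚ.∣p+q∣≤∣p∣+∣q∣ (s m - t m) (t m - t n))) ⟩
    ∣ s m - t m ∣ + ∣ t m - t n ∣ + ∣ t n - s n ∣          ≡⟨ cong (∣ s m - t m ∣ + ∣ t m - t n ∣ +_) (∣p-q∣≡∣q-p∣ (t n) (s n)) ⟩
    ∣ s m - t m ∣ + ∣ t m - t n ∣ + ∣ s n - t n ∣          ≤⟨ ℚ.+-mono-≤ (ℚ.+-mono-≤ (p m (ℕ.m⊔n≤o⇒m≤o M N h))
                                                                (q m n (ℕ.m⊔n≤o⇒n≤o M N h) (ℕ.m⊔n≤o⇒n≤o M N k)))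
                                                                (p n (ℕ.m⊔n≤o⇒m≤o M N k)) ⟩
    ½ * (½ * ε) + ½ * ε + ½ * (½ * ε)                      ≡⟨ solve 1 (λ e → con ½ :* (con ½ :* e) :+ con ½ :* e :+ con ½ :* (con ½ :* e) := e) refl ε ⟩
    ε                                                      ∎

-- Cauchy reals.  Two reals are equal when each is ≤ℝ the other.
record ℝ : Set where
  field
    approx : ℕ → ℚ
    cauchy : IsCauchy approx

open ℝ public

infix 4 _≤ℝ_

_≤ℝ_ : ℝ → ℝ → Set
x ≤ℝ y = ∀ ε → 0ℚ < ε → Eventually (λ n → approx x n ≤ approx y n + ε)

Positive : ℝ → Set
Positive x = ∃ λ δ → 0ℚ < δ × Eventually (λ n → δ ≤ approx x n)

record ℝ⁺ : Set where
  field
    real     : ℝ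
    positive : Positive real

open ℝ⁺ public

fromℚ : ℚ → ℝ
fromℚ p = record { approx = λ _ → p ; cauchy = CauchyFacts.cauchy-const p }

fromℕ : ℕ → ℝ
fromℕ n = fromℚ (RationalFacts.ι n)

infixl 7 _*ℝ_ _*⁺_
infixr 8 _^⁺_
infix  9 _⁻¹

_*ℝ_ : ℝ → ℝ → ℝ
x *ℝ y = record
  { approx = λ n → approx x n * approx y n
  ; cauchy = CauchyFacts.cauchy-* (cauchy x) (cauchy y)
  }

module PositiveReal where

  open RationalFacts
  open CauchyFacts
  open ℚ.≤-Reasoning

  fromℚ-positive : ∀ {p} → 0ℚ < p → Positive (fromℚ p)
  fromℚ-positive {p} 0<p = p , 0<p , 0 , λ _ _ → ℚ.≤-refl

  *-positive : ∀ {x y} → Positive x → Positive y → Positive (x *ℝ y)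
  *-positive (δ , 0<δ , M , δ≤x) (γ , 0<γ , N , γ≤y) =
    δ * γ , *-pos 0<δ 0<γ , M ℕ.⊔ N , λ n h →
      let γ≤yn = γ≤y n (ℕ.m⊔n≤o⇒n≤o M N h) in
      *-mono (ℚ.<⇒≤ 0<δ) (ℚ.≤-trans (ℚ.<⇒≤ 0<γ) γ≤yn) (δ≤x n (ℕ.m⊔n≤o⇒m≤o M N h)) γ≤yn

  reciprocal : ℝ⁺ → ℝ
  reciprocal x =
    let δ , 0<δ , δ≤x = positive x in
    record
      { approx = λ n → recip (approx (real x) n)
      ; cauchy = cauchy-recip (cauchy (real x)) δ 0<δ δ≤x
      }

  reciprocal-positive : ∀ x → Positive (reciprocal x)
  reciprocal-positive x =
    let δ , 0<δ , δ≤x = positive x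
        B , 0<B , x≤B = cauchy-bounded (cauchy (real x))
        N , bounds = both δ≤x x≤B
    in recip B , recip-pos 0<B , N , λ n N≤n →
      recip-antimono (ℚ.<-≤-trans 0<δ (proj₁ (bounds n N≤n)))
        (ℚ.≤-trans (p≤∣p∣ (approx (real x) n)) (proj₂ (bounds n N≤n)))

_*⁺_ : ℝ⁺ → ℝ⁺ → ℝ⁺
x *⁺ y = record
  { real     = real x *ℝ real y
  ; positive = PositiveReal.*-positive {real x} {real y} (positive x) (positive y)
  }

_⁻¹ : ℝ⁺ → ℝ⁺
x ⁻¹ = record
  { real     = PositiveReal.reciprocal x
  ; positive = PositiveReal.reciprocal-positive x
  }

1⁺ : ℝ⁺
1⁺ = record { real = fromℕ 1 ; positive = PositiveReal.fromℚ-positive RationalFacts.0<1 }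

_^⁺_ : ℝ⁺ → ℕ → ℝ⁺
x ^⁺ zero  = 1⁺
x ^⁺ suc n = x *⁺ x ^⁺ n

module Exponential where

  open RationalFacts
  open CauchyFacts
  open ℚ.≤-Reasoning

  -- (1 + x / (m + 1)) ^ (m + 1), which tends to eˣ
  expApprox : ℕ → ℚ → ℚ
  expApprox m x = (1ℚ + x * recip (ι (suc m))) ^ suc m

  one-minus-square : ∀ t → (1ℚ + t) * (1ℚ - t) ≡ 1ℚ - t * t
  one-minus-square = solve 1 (λ t →
    (con 1ℚ :+ t) :* (con 1ℚ :+ :- t) := con 1ℚ :+ :- (t :* t)) refl

  1-p²≤1 : ∀ p → 1ℚ - p * p ≤ 1ℚ
  1-p²≤1 p = subst (1ℚ - p * p ≤_) (ℚ.+-identityʳ 1ℚ) (ℚ.+-monoʳ-≤ 1ℚ (ℚ.neg-antimono-≤ (0≤p² p)))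

  module _ (a b : ℕ) (y : ℚ)
    (-1≤y : 0ℚ ≤ 1ℚ + y) (y≤1 : 0ℚ ≤ 1ℚ - y)
    (-1≤by : 0ℚ ≤ 1ℚ + ι b * y) (by≤1 : 0ℚ ≤ 1ℚ - ι b * y) where

    private
      t u w E : ℚ
      t = ι b * y
      u = (1ℚ + y) ^ b
      w = (1ℚ - y) ^ b
      E = (1ℚ + y) ^ (b ℕ.* a)

      E≡ : E ≡ u ^ a
      E≡ = sym (^-assocʳ (1ℚ + y) b a)

      0≤u : 0ℚ ≤ u
      0≤u = ^-nonNeg b -1≤y

      0≤1-t² : 0ℚ ≤ 1ℚ - t * t
      0≤1-t² = subst (0ℚ ≤_) (one-minus-square t) (*-nonNeg -1≤by by≤1)

      1-t≤w : 1ℚ - t ≤ w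
      1-t≤w = subst (_≤ w) (cong (1ℚ +_) (sym (ℚ.neg-distribʳ-* (ι b) y))) (bernoulli (- y) b y≤1)

      u[1-t]≤1 : u * (1ℚ - t) ≤ 1ℚ
      u[1-t]≤1 = begin
        u * (1ℚ - t)                  ≤⟨ *-monoˡ u 0≤u 1-t≤w ⟩
        u * w                         ≡⟨ *-^ (1ℚ + y) (1ℚ - y) b ⟨
        ((1ℚ + y) * (1ℚ - y)) ^ b     ≤⟨ ^≤1 b (*-nonNeg -1≤y y≤1)
                                           (subst (_≤ 1ℚ) (sym (one-minus-square y)) (1-p²≤1 y)) ⟩
        1ℚ                            ∎

      u[1-t²]≤1+t : u * (1ℚ - t * t) ≤ 1ℚ + t
      u[1-t²]≤1+t = begin
        u * (1ℚ - t * t)              ≡⟨ solve 2 (λ u t → u :* (con 1ℚ :+ :- (t :* t)) := (u :* (con 1ℚ :+ :- t)) :* (con 1ℚ :+ t)) refl u t ⟩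
        u * (1ℚ - t) * (1ℚ + t)       ≤⟨ *-monoʳ (1ℚ + t) -1≤by u[1-t]≤1 ⟩
        1ℚ * (1ℚ + t)                 ≡⟨ ℚ.*-identityˡ (1ℚ + t) ⟩
        1ℚ + t                        ∎

    refine-lower : (1ℚ + ι b * y) ^ a ≤ (1ℚ + y) ^ (b ℕ.* a)
    refine-lower = subst ((1ℚ + t) ^ a ≤_) (sym E≡) (^-mono a -1≤by (bernoulli y b -1≤y))

    refine-upper : (1ℚ + y) ^ (b ℕ.* a) * (1ℚ - ι a * (ι b * y * (ι b * y))) ≤ (1ℚ + ι b * y) ^ a
    refine-upper = begin
      E * (1ℚ - ι a * (t * t))        ≡⟨ cong (λ x → E * (1ℚ + x)) (ℚ.neg-distribʳ-* (ι a) (t * t)) ⟩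
      E * (1ℚ + ι a * - (t * t))      ≤⟨ *-monoˡ E (^-nonNeg (b ℕ.* a) -1≤y) (bernoulli (- (t * t)) a 0≤1-t²) ⟩
      E * (1ℚ - t * t) ^ a            ≡⟨ cong (_* (1ℚ - t * t) ^ a) E≡ ⟩
      u ^ a * (1ℚ - t * t) ^ a        ≡⟨ *-^ u (1ℚ - t * t) a ⟨
      (u * (1ℚ - t * t)) ^ a          ≤⟨ ^-mono a (*-nonNeg 0≤u 0≤1-t²) u[1-t²]≤1+t ⟩
      (1ℚ + t) ^ a                    ∎

  -- joint m n has exponent (m + 1)(n + 1); it exceeds expApprox m x by a
  -- relative error of at most about x² / (m + 1).
  module _ (B : ℚ) (x : ℚ) (∣x∣≤B : ∣ x ∣ ≤ B) where

    joint : ℕ → ℕ → ℚ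
    joint m n = (1ℚ + x * recip (ι (suc m)) * recip (ι (suc n))) ^ (suc n ℕ.* suc m)

    joint-sym : ∀ m n → joint m n ≡ joint n m
    joint-sym m n = cong₂ _^_
      (cong (1ℚ +_) (solve 3 (λ x r s → (x :* r) :* s := (x :* s) :* r) refl x (recip (ι (suc m))) (recip (ι (suc n)))))
      (ℕ.*-comm (suc n) (suc m))

    ∣x/m∣≤1 : ∀ m → B ≤ ι (suc m) → ∣ x * recip (ι (suc m)) ∣ ≤ 1ℚ
    ∣x/m∣≤1 m B≤m = begin
      ∣ x * r ∣        ≡⟨ ℚ.∣p*q∣≡∣p∣*∣q∣ x r ⟩
      ∣ x ∣ * ∣ r ∣    ≡⟨ cong (∣ x ∣ *_) (ℚ.0≤p⇒∣p∣≡p (ℚ.<⇒≤ (recip-pos (0<ι-suc m)))) ⟩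
      ∣ x ∣ * r        ≤⟨ ≤*⇒*recip≤ (0<ι-suc m) (subst (∣ x ∣ ≤_) (sym (ℚ.*-identityˡ (ι (suc m)))) (ℚ.≤-trans ∣x∣≤B B≤m)) ⟩
      1ℚ               ∎
      where
      r : ℚ
      r = recip (ι (suc m))

    ∣x/m/n∣≤1 : ∀ m n → B ≤ ι (suc m) → ∣ x * recip (ι (suc m)) * recip (ι (suc n)) ∣ ≤ 1ℚ
    ∣x/m/n∣≤1 m n B≤m = begin
      ∣ x * recip (ι (suc m)) * s ∣        ≡⟨ ℚ.∣p*q∣≡∣p∣*∣q∣ (x * recip (ι (suc m))) s ⟩
      ∣ x * recip (ι (suc m)) ∣ * ∣ s ∣    ≡⟨ cong (∣ x * recip (ι (suc m)) ∣ *_) (ℚ.0≤p⇒∣p∣≡p (ℚ.<⇒≤ (recip-pos (0<ι-suc n)))) ⟩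
      ∣ x * recip (ι (suc m)) ∣ * s        ≤⟨ *-mono (ℚ.0≤∣p∣ (x * recip (ι (suc m)))) 0≤1 (∣x/m∣≤1 m B≤m) (recip≤1 (1≤ι-suc n)) ⟩
      1ℚ * 1ℚ                              ≡⟨ ℚ.*-identityˡ 1ℚ ⟩
      1ℚ                                   ∎
      where
      s : ℚ
      s = recip (ι (suc n))

    -1≤ : ∀ {p} → ∣ p ∣ ≤ 1ℚ → 0ℚ ≤ 1ℚ + p
    -1≤ {p} h = subst (0ℚ ≤_) (solve 1 (λ a → a :+ :- (:- con 1ℚ) := con 1ℚ :+ a) refl p) (p≤q⇒0≤q-p (∣∣≤⇒-≤ h))

    ≤1 : ∀ {p} → ∣ p ∣ ≤ 1ℚ → 0ℚ ≤ 1ℚ - p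
    ≤1 {p} h = p≤q⇒0≤q-p (ℚ.≤-trans (p≤∣p∣ p) h)

    cancel : ∀ n p → ι (suc n) * (p * recip (ι (suc n))) ≡ p
    cancel n p = trans (solve 3 (λ a p r → a :* (p :* r) := p :* (a :* r)) refl (ι (suc n)) p (recip (ι (suc n))))
      (trans (cong (p *_) (*-recip (0<ι-suc n))) (ℚ.*-identityʳ p))

    joint-nonNeg : ∀ m n → B ≤ ι (suc m) → 0ℚ ≤ joint m n
    joint-nonNeg m n B≤m = ^-nonNeg (suc n ℕ.* suc m) (-1≤ (∣x/m/n∣≤1 m n B≤m))

    exp≤joint : ∀ m n → B ≤ ι (suc m) → expApprox m x ≤ joint m n
    exp≤joint m n B≤m = subst (λ t → (1ℚ + t) ^ suc m ≤ joint m n) (cancel n (x * recip (ι (suc m))))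
      (refine-lower (suc m) (suc n) (x * recip (ι (suc m)) * recip (ι (suc n)))
        (-1≤ (∣x/m/n∣≤1 m n B≤m)) (≤1 (∣x/m/n∣≤1 m n B≤m))
        (-1≤ by≤1) (≤1 by≤1))
      where
      by≤1 : ∣ ι (suc n) * (x * recip (ι (suc m)) * recip (ι (suc n))) ∣ ≤ 1ℚ
      by≤1 = subst (λ t → ∣ t ∣ ≤ 1ℚ) (sym (cancel n (x * recip (ι (suc m))))) (∣x/m∣≤1 m B≤m)

    x²≤B² : x * x ≤ B * B
    x²≤B² = begin
      x * x            ≡⟨ ℚ.0≤p⇒∣p∣≡p (0≤p² x) ⟨
      ∣ x * x ∣        ≡⟨ ℚ.∣p*q∣≡∣p∣*∣q∣ x x ⟩
      ∣ x ∣ * ∣ x ∣    ≤⟨ *-mono (ℚ.0≤∣p∣ x) (ℚ.≤-trans (ℚ.0≤∣p∣ x) ∣x∣≤B) ∣x∣≤B ∣x∣≤B ⟩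
      B * B            ∎

    joint≤exp : ∀ m n → B ≤ ι (suc m) →
                joint m n * (1ℚ - B * B * recip (ι (suc m))) ≤ expApprox m x
    joint≤exp m n B≤m = begin
      J * (1ℚ - B * B * r)                        ≤⟨ *-monoˡ J (joint-nonNeg m n B≤m) (ℚ.+-monoʳ-≤ 1ℚ (ℚ.neg-antimono-≤ (*-monoʳ r (ℚ.<⇒≤ (recip-pos (0<ι-suc m))) x²≤B²))) ⟩
      J * (1ℚ - x * x * r)                        ≡⟨ cong (λ t → J * (1ℚ - t)) x²r≡ ⟩
      J * (1ℚ - ι (suc m) * (x * r * (x * r)))    ≡⟨ cong (λ t → J * (1ℚ - ι (suc m) * (t * t))) (cancel n (x * r)) ⟨
      J * (1ℚ - ι (suc m) * (t * t))              ≤⟨ refine-upper (suc m) (suc n) (x * r * recip (ι (suc n)))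
                                                       (-1≤ (∣x/m/n∣≤1 m n B≤m)) (≤1 (∣x/m/n∣≤1 m n B≤m)) (-1≤ by≤1) (≤1 by≤1) ⟩
      (1ℚ + t) ^ suc m                            ≡⟨ cong (λ t → (1ℚ + t) ^ suc m) (cancel n (x * r)) ⟩
      expApprox m x                               ∎
      where
      r J t : ℚ
      r = recip (ι (suc m))
      J = joint m n
      t = ι (suc n) * (x * r * recip (ι (suc n)))
      by≤1 : ∣ t ∣ ≤ 1ℚ
      by≤1 = subst (λ t → ∣ t ∣ ≤ 1ℚ) (sym (cancel n (x * r))) (∣x/m∣≤1 m B≤m)
      x²r≡ : x * x * r ≡ ι (suc m) * (x * r * (x * r))
      x²r≡ = trans (cong (λ y → y * x * r) (sym (cancel m x)))
        (solve 3 (λ a x r → ((a :* (x :* r)) :* x) :* r := a :* ((x :* r) :* (x :* r))) refl (ι (suc m)) x r)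

    module _ (c : ℕ) (2B²≤c : 2ℚ * (B * B) ≤ ι (suc c)) (2B≤c : 2ℚ * B ≤ ι (suc c)) where

      private
        0≤B : 0ℚ ≤ B
        0≤B = ℚ.≤-trans (ℚ.0≤∣p∣ x) ∣x∣≤B

        B≤ : ∀ {m} → c ℕ.≤ m → B ≤ ι (suc m)
        B≤ {m} c≤m = begin
          B                ≤⟨ p≤p+q B 0≤B ⟩
          B + B            ≡⟨ solve 1 (λ b → b :+ b := (con 1ℚ :+ con 1ℚ) :* b) refl B ⟩
          2ℚ * B           ≤⟨ 2B≤c ⟩
          ι (suc c)        ≤⟨ ι-mono (ℕ.s≤s c≤m) ⟩
          ι (suc m)        ∎

        halve : ∀ {p q} → 2ℚ * p ≤ q → p ≤ ½ * q
        halve {p} {q} h = subst (_≤ ½ * q)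
          (solve 1 (λ p → con ½ :* ((con 1ℚ :+ con 1ℚ) :* p) := p) refl p)
          (*-monoˡ ½ (ℚ.<⇒≤ 0<½) h)

        ½≤ : ∀ {m} → c ℕ.≤ m → ½ ≤ 1ℚ - B * B * recip (ι (suc m))
        ½≤ {m} c≤m = subst (_≤ 1ℚ - B * B * recip (ι (suc m))) (ℚ.+-comm 1ℚ (- ½))
          (ℚ.+-monoʳ-≤ 1ℚ (ℚ.neg-antimono-≤ (≤*⇒*recip≤ {B * B} {½} (0<ι-suc m)
            (halve {B * B} (ℚ.≤-trans 2B²≤c (ι-mono (ℕ.s≤s c≤m)))))))

        joint*½≤exp : ∀ {m} n → c ℕ.≤ m → joint m n * ½ ≤ expApprox m x
        joint*½≤exp {m} n c≤m = ℚ.≤-trans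
          (*-monoˡ (joint m n) (joint-nonNeg m n (B≤ c≤m)) (½≤ c≤m))
          (joint≤exp m n (B≤ c≤m))

        ∣x/c∣≤½ : ∣ x * recip (ι (suc c)) ∣ ≤ ½
        ∣x/c∣≤½ = begin
          ∣ x * recip (ι (suc c)) ∣            ≡⟨ ℚ.∣p*q∣≡∣p∣*∣q∣ x (recip (ι (suc c))) ⟩
          ∣ x ∣ * ∣ recip (ι (suc c)) ∣        ≡⟨ cong (∣ x ∣ *_) (ℚ.0≤p⇒∣p∣≡p (ℚ.<⇒≤ (recip-pos (0<ι-suc c)))) ⟩
          ∣ x ∣ * recip (ι (suc c))            ≤⟨ ≤*⇒*recip≤ (0<ι-suc c) (ℚ.≤-trans ∣x∣≤B (halve 2B≤c)) ⟩
          ½                                    ∎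

        ≤double : ∀ {p q} → p * ½ ≤ q → p ≤ 2ℚ * q
        ≤double {p} {q} h = subst (_≤ 2ℚ * q)
          (solve 1 (λ p → (con 1ℚ :+ con 1ℚ) :* (p :* con ½) := p) refl p)
          (*-monoˡ 2ℚ 0≤2 h)

      expBound : ℚ
      expBound = 2ℚ * (2ℚ * 2ℚ ^ suc c)

      joint≤bound : ∀ {m} n → c ℕ.≤ m → joint m n ≤ expBound
      joint≤bound {m} n c≤m = ≤double (begin
        joint m n * ½              ≤⟨ joint*½≤exp n c≤m ⟩
        expApprox m x              ≤⟨ exp≤joint m c (B≤ c≤m) ⟩
        joint m c                  ≡⟨ joint-sym m c ⟩
        joint c m                  ≤⟨ ≤double (joint*½≤exp m ℕ.≤-refl) ⟩
        2ℚ * expApprox c x         ≤⟨ *-monoˡ 2ℚ 0≤2 (^-mono (suc c) (-1≤ (∣x/m∣≤1 c (B≤ ℕ.≤-refl)))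
                                        (ℚ.+-monoʳ-≤ 1ℚ (ℚ.≤-trans (p≤∣p∣ (x * recip (ι (suc c)))) (∣x/m∣≤1 c (B≤ ℕ.≤-refl))))) ⟩
        2ℚ * 2ℚ ^ suc c            ∎)

      joint-exp≤ : ∀ {m} n → c ℕ.≤ m →
                   joint m n - expApprox m x ≤ expBound * (B * B) * recip (ι (suc m))
      joint-exp≤ {m} n c≤m = begin
        J - expApprox m x                  ≤⟨ ℚ.+-monoʳ-≤ J (ℚ.neg-antimono-≤ (joint≤exp m n (B≤ c≤m))) ⟩
        J - J * (1ℚ - B * B * r)           ≡⟨ solve 3 (λ j b r → j :+ :- (j :* (con 1ℚ :+ :- (b :* r))) := j :* (b :* r)) refl J (B * B) r ⟩
        J * (B * B * r)                    ≤⟨ *-monoʳ (B * B * r) (*-nonNeg (0≤p² B) (ℚ.<⇒≤ (recip-pos (0<ι-suc m)))) (joint≤bound n c≤m) ⟩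
        expBound * (B * B * r)             ≡⟨ ℚ.*-assoc expBound (B * B) r ⟨
        expBound * (B * B) * r             ∎
        where
        J r : ℚ
        J = joint m n
        r = recip (ι (suc m))

      ∣exp-exp∣≤ : ∀ {m n ε} → c ℕ.≤ m → m ℕ.≤ n →
                   expBound * (B * B) * recip (ι (suc m)) ≤ ε → ∣ expApprox n x - expApprox m x ∣ ≤ ε
      ∣exp-exp∣≤ {m} {n} {ε} c≤m m≤n h = ∣∣≤ (below (exp≤joint n m (B≤ c≤n)) gap-m)
        (subst (_≤ ε) (solve 2 (λ a b → b :+ :- a := :- (a :+ :- b)) refl (expApprox n x) (expApprox m x))
          (below (subst (expApprox m x ≤_) (joint-sym m n) (exp≤joint m n (B≤ c≤m))) gap-n))
        where
        c≤n : c ℕ.≤ n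
        c≤n = ℕ.≤-trans c≤m m≤n
        below : ∀ {p q J} → p ≤ J → J - q ≤ ε → p - q ≤ ε
        below {p} {q} p≤J J-q≤ε = ℚ.≤-trans (ℚ.+-monoˡ-≤ (- q) p≤J) J-q≤ε
        gap-m : joint n m - expApprox m x ≤ ε
        gap-m = subst (λ J → J - expApprox m x ≤ ε) (joint-sym m n) (ℚ.≤-trans (joint-exp≤ n c≤m) h)
        gap-n : joint n m - expApprox n x ≤ ε
        gap-n = ℚ.≤-trans (joint-exp≤ m c≤n) (ℚ.≤-trans
          (*-monoˡ (expBound * (B * B))
            (*-nonNeg (*-nonNeg 0≤2 (*-nonNeg 0≤2 (^-nonNeg (suc c) 0≤2))) (0≤p² B))
            (recip-antimono (0<ι-suc m) (ι-mono (ℕ.s≤s m≤n)))) h)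

      exp≥ : ∀ {m} → c ℕ.≤ m → ½ ^ suc c * ½ ≤ expApprox m x
      exp≥ {m} c≤m = begin
        ½ ^ suc c * ½              ≤⟨ *-monoʳ ½ (ℚ.<⇒≤ 0<½) (^-mono (suc c) (ℚ.<⇒≤ 0<½)
                                        (ℚ.+-monoʳ-≤ 1ℚ (∣∣≤⇒-≤ ∣x/c∣≤½))) ⟩
        expApprox c x * ½          ≤⟨ *-monoʳ ½ (ℚ.<⇒≤ 0<½) (exp≤joint c m (B≤ ℕ.≤-refl)) ⟩
        joint c m * ½              ≡⟨ cong (_* ½) (joint-sym c m) ⟩
        joint m c * ½              ≤⟨ joint*½≤exp c c≤m ⟩
        expApprox m x              ∎

  threshold : ∀ B → ∃ λ c → 2ℚ * (B * B) ≤ ι (suc c) × 2ℚ * B ≤ ι (suc c)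
  threshold B with archimedean (2ℚ * (B * B)) | archimedean (2ℚ * B)
  ... | k , 2B²≤k | l , 2B≤l = k ℕ.⊔ l ,
    ℚ.≤-trans 2B²≤k (ι-mono (ℕ.m≤n⇒m≤1+n (ℕ.m≤m⊔n k l))) ,
    ℚ.≤-trans 2B≤l (ι-mono (ℕ.m≤n⇒m≤1+n (ℕ.m≤n⊔m k l)))

  expApprox-cauchy : ∀ (x : ℝ) → IsCauchy (λ n → expApprox n (approx x n))
  expApprox-cauchy x = cauchy-approx λ ε 0<ε →
    let B , 0<B , N , x≤B = cauchy-bounded (cauchy x)
        c , 2B²≤c , 2B≤c = threshold B
        G = 2ℚ * (2ℚ * 2ℚ ^ suc c) * (B * B)
        k , large = archimedean (G * recip ε)
        m = c ℕ.⊔ k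
        small : G * recip (ι (suc m)) ≤ ε
        small = ≤*⇒*recip≤ (0<ι-suc m) (begin
          G                          ≡⟨ ℚ.*-identityˡ G ⟨
          1ℚ * G                     ≡⟨ cong (_* G) (*-recip 0<ε) ⟨
          ε * recip ε * G            ≡⟨ solve 3 (λ e r g → (e :* r) :* g := e :* (g :* r)) refl ε (recip ε) G ⟩
          ε * (G * recip ε)          ≤⟨ *-monoˡ ε (ℚ.<⇒≤ 0<ε) (ℚ.≤-trans large (ι-mono (ℕ.m≤n⇒m≤1+n (ℕ.m≤n⊔m c k)))) ⟩
          ε * ι (suc m)              ∎)
    in (λ n → expApprox m (approx x n))
     , cauchy-^ (suc m) (cauchy-+ (cauchy-const 1ℚ) (cauchy-* (cauchy x) (cauchy-const (recip (ι (suc m))))))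
     , N ℕ.⊔ m , λ n h →
         ∣exp-exp∣≤ B (approx x n) (x≤B n (ℕ.m⊔n≤o⇒m≤o N m h)) c 2B²≤c 2B≤c
           (ℕ.m≤m⊔n c k) (ℕ.m⊔n≤o⇒n≤o N m h) small

  expApprox-positive : ∀ (x : ℝ) → ∃ λ δ → 0ℚ < δ × Eventually (λ n → δ ≤ expApprox n (approx x n))
  expApprox-positive x =
    let B , 0<B , N , x≤B = cauchy-bounded (cauchy x)
        c , 2B²≤c , 2B≤c = threshold B
    in ½ ^ suc c * ½ , *-pos (^-pos (suc c) 0<½) 0<½ , N ℕ.⊔ c , λ n h →
         exp≥ B (approx x n) (x≤B n (ℕ.m⊔n≤o⇒m≤o N c h)) c 2B²≤c 2B≤c (ℕ.m⊔n≤o⇒n≤o N c h)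

exp : ℝ → ℝ⁺
exp x = record
  { real     = record
    { approx = λ n → Exponential.expApprox n (approx x n)
    ; cauchy = Exponential.expApprox-cauchy x
    }
  ; positive = Exponential.expApprox-positive x
  }

module Logarithm where

  open RationalFacts
  open CauchyFacts
  open ℚ.≤-Reasoning

  atanhTerm : ℕ → ℚ → ℚ
  atanhTerm i z = z ^ suc (2 ℕ.* i) * recip (ι (suc (2 ℕ.* i)))

  -- z + z³ / 3 + z⁵ / 5 + ⋯, with n terms
  atanhSum : ℕ → ℚ → ℚ
  atanhSum zero    z = 0ℚ
  atanhSum (suc n) z = atanhSum n z + atanhTerm n z

  -- log p = 2 atanh ((p - 1) / (p + 1)) for p > 0
  logArg : ℚ → ℚ
  logArg p = (p - 1ℚ) * recip (p + 1ℚ)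

  logApprox : ℕ → ℚ → ℚ
  logApprox n p = 2ℚ * atanhSum n (logArg p)

  module _ (ρ z : ℚ) (∣z∣≤ρ : ∣ z ∣ ≤ ρ) (ρ≤1 : ρ ≤ 1ℚ) where

    private
      0≤ρ : 0ℚ ≤ ρ
      0≤ρ = ℚ.≤-trans (ℚ.0≤∣p∣ z) ∣z∣≤ρ

    ∣atanhTerm∣≤ : ∀ i → ∣ atanhTerm i z ∣ ≤ ρ ^ i
    ∣atanhTerm∣≤ i = begin
      ∣ z ^ k * r ∣                ≡⟨ ℚ.∣p*q∣≡∣p∣*∣q∣ (z ^ k) r ⟩
      ∣ z ^ k ∣ * ∣ r ∣            ≡⟨ cong₂ _*_ (∣^∣ z k) (ℚ.0≤p⇒∣p∣≡p (ℚ.<⇒≤ (recip-pos (0<ι-suc (2 ℕ.* i))))) ⟩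
      ∣ z ∣ ^ k * r                ≤⟨ *-mono (^-nonNeg k (ℚ.0≤∣p∣ z)) 0≤1 (^-mono k (ℚ.0≤∣p∣ z) ∣z∣≤ρ) (recip≤1 (1≤ι-suc (2 ℕ.* i))) ⟩
      ρ ^ k * 1ℚ                   ≡⟨ ℚ.*-identityʳ (ρ ^ k) ⟩
      ρ * ρ ^ (i ℕ.+ (i ℕ.+ 0))    ≡⟨ cong (ρ *_) (^-homo-* ρ i (i ℕ.+ 0)) ⟩
      ρ * (ρ ^ i * ρ ^ (i ℕ.+ 0))  ≤⟨ *-mono 0≤ρ (*-nonNeg (^-nonNeg i 0≤ρ) 0≤1) ρ≤1
                                        (*-monoˡ (ρ ^ i) (^-nonNeg i 0≤ρ) (^≤1 (i ℕ.+ 0) 0≤ρ ρ≤1)) ⟩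
      1ℚ * (ρ ^ i * 1ℚ)            ≡⟨ solve 1 (λ a → con 1ℚ :* (a :* con 1ℚ) := a) refl (ρ ^ i) ⟩
      ρ ^ i                        ∎
      where
      k : ℕ
      k = suc (2 ℕ.* i)
      r : ℚ
      r = recip (ι k)

    atanhTail : ∀ N d →
      ∣ atanhSum (d ℕ.+ N) z - atanhSum N z ∣ * (1ℚ - ρ) ≤ ρ ^ N - ρ ^ (d ℕ.+ N)
    atanhTail N zero = begin
      ∣ atanhSum N z - atanhSum N z ∣ * (1ℚ - ρ)   ≡⟨ cong (λ p → ∣ p ∣ * (1ℚ - ρ)) (ℚ.+-inverseʳ (atanhSum N z)) ⟩
      0ℚ * (1ℚ - ρ)                                ≡⟨ ℚ.*-zeroˡ (1ℚ - ρ) ⟩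
      0ℚ                                           ≡⟨ ℚ.+-inverseʳ (ρ ^ N) ⟨
      ρ ^ N - ρ ^ N                                ∎
    atanhTail N (suc d) = begin
      ∣ S + a - T ∣ * σ                                ≡⟨ cong (λ p → ∣ p ∣ * σ) (solve 3 (λ s a t → (s :+ a) :+ :- t := (s :+ :- t) :+ a) refl S a T) ⟩
      ∣ (S - T) + a ∣ * σ                              ≤⟨ *-monoʳ σ 0≤σ (ℚ.∣p+q∣≤∣p∣+∣q∣ (S - T) a) ⟩
      (∣ S - T ∣ + ∣ a ∣) * σ                          ≡⟨ ℚ.*-distribʳ-+ σ ∣ S - T ∣ ∣ a ∣ ⟩
      ∣ S - T ∣ * σ + ∣ a ∣ * σ                        ≤⟨ ℚ.+-mono-≤ (atanhTail N d) (*-monoʳ σ 0≤σ (∣atanhTerm∣≤ (d ℕ.+ N))) ⟩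
      (ρ ^ N - ρ ^ (d ℕ.+ N)) + ρ ^ (d ℕ.+ N) * σ      ≡⟨ solve 3 (λ a b p → (a :+ :- b) :+ b :* (con 1ℚ :+ :- p) := a :+ :- (p :* b)) refl (ρ ^ N) (ρ ^ (d ℕ.+ N)) ρ ⟩
      ρ ^ N - ρ ^ (suc d ℕ.+ N)                        ∎
      where
      S T a σ : ℚ
      S = atanhSum (d ℕ.+ N) z
      T = atanhSum N z
      a = atanhTerm (d ℕ.+ N) z
      σ = 1ℚ - ρ
      0≤σ : 0ℚ ≤ σ
      0≤σ = p≤q⇒0≤q-p ρ≤1

    atanhSum-close : ∀ {N n ε} → ρ < 1ℚ → ρ ^ N ≤ ε * (1ℚ - ρ) → N ℕ.≤ n →
                     ∣ atanhSum n z - atanhSum N z ∣ ≤ ε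
    atanhSum-close {N} {n} {ε} ρ<1 h N≤n =
      ℚ.*-cancelʳ-≤-pos (1ℚ - ρ) {{ℚ.positive (p<q⇒0<q-p ρ<1)}}
        (subst (λ k → ∣ atanhSum k z - atanhSum N z ∣ * (1ℚ - ρ) ≤ ε * (1ℚ - ρ)) (ℕ.m∸n+n≡m N≤n) (begin
          ∣ atanhSum (d ℕ.+ N) z - atanhSum N z ∣ * (1ℚ - ρ)  ≤⟨ atanhTail N d ⟩
          ρ ^ N - ρ ^ (d ℕ.+ N)                               ≤⟨ ℚ.+-monoʳ-≤ (ρ ^ N) (ℚ.neg-antimono-≤ (^-nonNeg (d ℕ.+ N) 0≤ρ)) ⟩
          ρ ^ N + 0ℚ                                          ≡⟨ ℚ.+-identityʳ (ρ ^ N) ⟩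
          ρ ^ N                                               ≤⟨ h ⟩
          ε * (1ℚ - ρ)                                        ∎))
      where
      d : ℕ
      d = n ℕ.∸ N

  atanhSum-cauchy : ∀ n {z} → IsCauchy z → IsCauchy (λ m → atanhSum n (z m))
  atanhSum-cauchy zero    z-cauchy = cauchy-const 0ℚ
  atanhSum-cauchy (suc n) z-cauchy = cauchy-+ (atanhSum-cauchy n z-cauchy)
    (cauchy-* (cauchy-^ (suc (2 ℕ.* n)) z-cauchy) (cauchy-const (recip (ι (suc (2 ℕ.* n))))))

  atanhDiagonal-cauchy : ∀ {z ρ} → IsCauchy z → ρ < 1ℚ → Eventually (λ n → ∣ z n ∣ ≤ ρ) →
                         IsCauchy (λ n → atanhSum n (z n))
  atanhDiagonal-cauchy {z} {ρ} z-cauchy ρ<1 (M , z≤ρ) = cauchy-approx λ ε 0<ε →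
    let N , small = ^-small (ℚ.≤-trans (ℚ.0≤∣p∣ (z M)) (z≤ρ M ℕ.≤-refl)) ρ<1 (*-pos 0<ε (p<q⇒0<q-p ρ<1))
    in (λ n → atanhSum N (z n)) , atanhSum-cauchy N z-cauchy , M ℕ.⊔ N , λ n h →
      atanhSum-close ρ (z n) (z≤ρ n (ℕ.m⊔n≤o⇒m≤o M N h)) (ℚ.<⇒≤ ρ<1) ρ<1 small (ℕ.m⊔n≤o⇒n≤o M N h)

  ∣logArg∣≤ : ∀ p δ B → 0ℚ < δ → δ ≤ 1ℚ → δ ≤ p → p ≤ B →
              ∣ logArg p ∣ ≤ 1ℚ - δ * recip (B + 1ℚ)
  ∣logArg∣≤ p δ B 0<δ δ≤1 δ≤p p≤B = ∣∣≤
    (begin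
      (p - 1ℚ) * t               ≡⟨ solve 2 (λ p t → (p :+ :- con 1ℚ) :* t := (p :+ con 1ℚ) :* t :+ :- (t :+ t)) refl p t ⟩
      (p + 1ℚ) * t - (t + t)     ≡⟨ cong (_- (t + t)) (*-recip 0<p+1) ⟩
      1ℚ - (t + t)               ≤⟨ ℚ.+-monoʳ-≤ 1ℚ (ℚ.neg-antimono-≤ (ℚ.≤-trans δs≤t (p≤p+q t 0≤t))) ⟩
      1ℚ - δ * s                 ∎)
    (begin
      - ((p - 1ℚ) * t)                   ≡⟨ solve 2 (λ p t → :- ((p :+ :- con 1ℚ) :* t) := (p :+ con 1ℚ) :* t :+ :- (p :* t :+ p :* t)) refl p t ⟩
      (p + 1ℚ) * t - (p * t + p * t)     ≡⟨ cong (_- (p * t + p * t)) (*-recip 0<p+1) ⟩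
      1ℚ - (p * t + p * t)               ≤⟨ ℚ.+-monoʳ-≤ 1ℚ (ℚ.neg-antimono-≤ (ℚ.≤-trans δs≤pt (p≤p+q (p * t) (*-nonNeg 0≤p 0≤t)))) ⟩
      1ℚ - δ * s                         ∎)
    where
    t s : ℚ
    t = recip (p + 1ℚ)
    s = recip (B + 1ℚ)
    0≤p : 0ℚ ≤ p
    0≤p = ℚ.≤-trans (ℚ.<⇒≤ 0<δ) δ≤p
    0<p+1 : 0ℚ < p + 1ℚ
    0<p+1 = ℚ.<-≤-trans 0<1 (p≤q+p 1ℚ 0≤p)
    0≤t : 0ℚ ≤ t
    0≤t = ℚ.<⇒≤ (recip-pos 0<p+1)
    s≤t : s ≤ t
    s≤t = recip-antimono 0<p+1 (ℚ.+-monoˡ-≤ 1ℚ p≤B)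
    δs≤t : δ * s ≤ t
    δs≤t = subst (δ * s ≤_) (ℚ.*-identityˡ t) (*-mono (ℚ.<⇒≤ 0<δ) 0≤t δ≤1 s≤t)
    δs≤pt : δ * s ≤ p * t
    δs≤pt = *-mono (ℚ.<⇒≤ 0<δ) 0≤t δ≤p s≤t

  lower-to-1 : ∀ δ → 0ℚ < δ → ∃ λ η → 0ℚ < η × η ≤ δ × η ≤ 1ℚ
  lower-to-1 δ 0<δ with ℚ.≤-total δ 1ℚ
  ... | inj₁ δ≤1 = δ , 0<δ , ℚ.≤-refl , δ≤1
  ... | inj₂ 1≤δ = 1ℚ , 0<1 , 1≤δ , ℚ.≤-refl

  logApprox-cauchy : ∀ (x : ℝ⁺) → IsCauchy (λ n → logApprox n (approx (real x) n))
  logApprox-cauchy x =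
    let δ , 0<δ , M , δ≤x = positive x
        η , 0<η , η≤δ , η≤1 = lower-to-1 δ 0<δ
        B , 0<B , N , x≤B = cauchy-bounded (cauchy (real x))
        0<ηs : 0ℚ < η * recip (B + 1ℚ)
        0<ηs = *-pos 0<η (recip-pos (+-pos 0<B 0≤1))
        1≤x+1 : Eventually (λ n → η ≤ approx (real x) n + 1ℚ)
        1≤x+1 = M , λ n M≤n → ℚ.≤-trans (ℚ.≤-trans η≤δ (δ≤x n M≤n)) (p≤p+q (approx (real x) n) 0≤1)
        ρ<1 : 1ℚ - η * recip (B + 1ℚ) < 1ℚ
        ρ<1 = subst (1ℚ - η * recip (B + 1ℚ) <_) (ℚ.+-identityʳ 1ℚ) (ℚ.+-monoʳ-< 1ℚ (ℚ.neg-antimono-< 0<ηs))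
    in cauchy-* (cauchy-const 2ℚ) (atanhDiagonal-cauchy
         (cauchy-* (cauchy-+ (cauchy (real x)) (cauchy-const (- 1ℚ)))
           (cauchy-recip (cauchy-+ (cauchy (real x)) (cauchy-const 1ℚ)) η 0<η 1≤x+1))
         ρ<1
         (M ℕ.⊔ N , λ n h → ∣logArg∣≤ (approx (real x) n) η B 0<η η≤1
           (ℚ.≤-trans η≤δ (δ≤x n (ℕ.m⊔n≤o⇒m≤o M N h)))
           (ℚ.≤-trans (p≤∣p∣ (approx (real x) n)) (x≤B n (ℕ.m⊔n≤o⇒n≤o M N h)))))

  atanhSum≥ : ∀ z n → 0ℚ ≤ z → atanhSum 1 z ≤ atanhSum (suc n) z
  atanhSum≥ z zero    0≤z = ℚ.≤-refl
  atanhSum≥ z (suc n) 0≤z = ℚ.≤-trans (atanhSum≥ z n 0≤z)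
    (p≤p+q (atanhSum (suc n) z) (*-nonNeg (^-nonNeg (suc (2 ℕ.* suc n)) 0≤z)
      (ℚ.<⇒≤ (recip-pos (0<ι-suc (2 ℕ.* suc n))))))

  logApprox-positive : ∀ p → 1ℚ < p → ∃ λ δ → 0ℚ < δ × Eventually (λ n → δ ≤ logApprox n p)
  logApprox-positive p 1<p = logApprox 1 p , *-pos (ℚ.positive⁻¹ 2ℚ) 0<S , 1 , λ where
      (suc n) _ → *-monoˡ 2ℚ 0≤2 (atanhSum≥ z n (ℚ.<⇒≤ 0<z))
    where
    z : ℚ
    z = logArg p
    0<z : 0ℚ < z
    0<z = *-pos (p<q⇒0<q-p 1<p) (recip-pos (+-pos (ℚ.<-trans 0<1 1<p) 0≤1))
    0<S : 0ℚ < atanhSum 1 z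
    0<S = subst (0ℚ <_) (sym (ℚ.+-identityˡ (atanhTerm 0 z))) (*-pos (^-pos 1 0<z) (recip-pos (0<ι-suc 0)))

  1<ι : ∀ {n} → 1 ℕ.< n → 1ℚ < ι n
  1<ι {suc n} (ℕ.s≤s 1≤n) = subst (1ℚ <_) (sym (ι-suc n))
    (subst (_< 1ℚ + ι n) (ℚ.+-identityʳ 1ℚ) (ℚ.+-monoʳ-< 1ℚ (ℚ.<-≤-trans 0<1 (ι-mono 1≤n))))

log : ℝ⁺ → ℝ
log x = record
  { approx = λ n → Logarithm.logApprox n (approx (real x) n)
  ; cauchy = Logarithm.logApprox-cauchy x
  }

infixr 8 _^ℝ_

_^ℝ_ : ℝ⁺ → ℝ → ℝ⁺
x ^ℝ k = exp (k *ℝ log x)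

fromℕ⁺ : ∀ n → 1 ℕ.< n → ℝ⁺
fromℕ⁺ n 1<n = record
  { real     = fromℕ n
  ; positive = PositiveReal.fromℚ-positive (ℚ.<-trans RationalFacts.0<1 (Logarithm.1<ι 1<n))
  }

-- log n is positive when n > 1, so that it can be the base of _^ℝ_.
logℕ : ∀ n → 1 ℕ.< n → ℝ⁺
logℕ n 1<n = record
  { real     = log (fromℕ⁺ n 1<n)
  ; positive = Logarithm.logApprox-positive (RationalFacts.ι n) (Logarithm.1<ι 1<n)
  }

infix 5 _·_

_·_ : ℝ⁺ → ℕ → ℝ
r · n = real r *ℝ fromℕ n

IsPrimePower : ℕ → Set
IsPrimePower q = ∃ λ p → ∃ λ n → Prime p × 1 ℕ.≤ n × q ≡ p ℕ.^ n

primePower>1 : ∀ {q} → IsPrimePower q → 1 ℕ.< q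
primePower>1 (p , suc n , p-prime , _ , refl) =
  ℕ.≤-trans (ℕ.nonTrivial⇒n>1 p {{prime⇒nonTrivial p-prime}})
    (ℕ.m≤m*n p (p ℕ.^ n) {{ℕ.m^n≢0 p n {{prime⇒nonZero p-prime}}}})

record FiniteField (q : ℕ) : Set₁ where
  field
    commutativeRing : CommutativeRing 0ℓ 0ℓ
  open CommutativeRing commutativeRing public using (Carrier; setoid; _≈_; 0#; 1#)
    renaming (_+_ to _+ᶠ_; _*_ to _*ᶠ_; _-_ to _-ᶠ_)
  field
    1≉0         : ¬ 1# ≈ 0#
    inverse     : ∀ x → ¬ x ≈ 0# → ∃ λ y → x *ᶠ y ≈ 1#
    enumeration : Inverse setoid (≡.setoid (Fin q))

  index : Carrier → Fin q
  index = Inverse.to enumeration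

  element : Fin q → Carrier
  element = Inverse.from enumeration

  _≈?_ : ∀ x y → Dec (x ≈ y)
  _≈?_ = via-injection (Inverse⇒Injection enumeration) Fin._≟_

  -- The multiplicative inverse, with the value 0 at 0.
  _⁻¹ᶠ : Carrier → Carrier
  x ⁻¹ᶠ with x ≈? 0#
  ... | yes _  = 0#
  ... | no x≉0 = proj₁ (inverse x x≉0)

-- Subsets of the field are subsets of the index set of its enumeration.
module FieldSubsets {q : ℕ} (𝔽 : FiniteField q) where

  open FiniteField 𝔽

  infix  4 _∈ᶠ_
  infixl 6 _⊕_ _⊖_
  infixl 7 _⊛_ _•_

  _∈ᶠ_ : Carrier → Subset q → Set
  x ∈ᶠ A = index x ∈ A

  elements : Subset q → List Carrier
  elements A = map element (filter (_∈? A) (allFin q))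

  fromList : List Carrier → Subset q
  fromList xs = ⋃ (map (λ x → ⁅ index x ⁆) xs)

  _⊕_ _⊖_ _⊛_ : Subset q → Subset q → Subset q
  A ⊕ B = fromList (cartesianProductWith _+ᶠ_ (elements A) (elements B))
  A ⊖ B = fromList (cartesianProductWith _-ᶠ_ (elements A) (elements B))
  A ⊛ B = fromList (cartesianProductWith _*ᶠ_ (elements A) (elements B))

  _•_ : Carrier → Subset q → Subset q
  x • A = fromList (map (x *ᶠ_) (elements A))

  translate : Subset q → Carrier → Subset q
  translate A a = fromList (map (_-ᶠ a) (elements A))

  -- energy A ξ is E(A, ξA).
  energy : Subset q → Carrier → ℕ
  energy A ξ = length (filter
    (λ (a₁ , a₂ , a₃ , a₄) → (a₁ -ᶠ a₂) ≈? (ξ *ᶠ (a₃ -ᶠ a₄)))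
    (cartesianProduct as (cartesianProduct as (cartesianProduct as as))))
    where
    as : List Carrier
    as = elements A

  energySum : Subset q → Subset q → ℕ
  energySum X A = sum (map (energy A) (elements X))

  -- The exponent e is the power of K lost in the size of X′.
  StructuredSubsets : (Λ K : ℝ⁺) (e : ℕ) (A X : Subset q) → Set
  StructuredSubsets Λ K e A X =
    ∃ λ ā → ∃ λ x₀ → ∃ λ A₁ → ∃ λ X′ →
      ā ∈ᶠ A × x₀ ∈ᶠ X × A₁ ⊆ translate A ā × X′ ⊆ (x₀ ⁻¹ᶠ) • X ×
      ((Λ ⁻¹ *⁺ (K ^⁺ 85) ⁻¹) · card A ≤ℝ fromℕ (card A₁) ×
       (Λ ⁻¹ *⁺ (K ^⁺ e) ⁻¹) · card X ≤ℝ fromℕ (card X′)) ×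
      fromℕ (card (A₁ ⊕ X′ ⊛ A₁)) ≤ℝ (Λ *⁺ K ^⁺ 226) · card A₁ ×
      (fromℕ (card (A₁ ⊕ A₁)) ≤ℝ (Λ *⁺ K ^⁺ 92) · card A₁ ×
       fromℕ (card (A₁ ⊖ A₁)) ≤ℝ (Λ *⁺ K ^⁺ 92) · card A₁) ×
      (∀ x′ → x′ ∈ᶠ X′ →
        fromℕ (card (A₁ ⊕ x′ • A₁)) ≤ℝ (Λ *⁺ K ^⁺ 126) · card A₁ ×
        fromℕ (card (A₁ ⊖ x′ • A₁)) ≤ℝ (Λ *⁺ K ^⁺ 126) · card A₁)

{-# OPTIONS --safe #-}
module Submission where

-- For ξ ∈ X join (ξ , c) ∈ X × A to b ∈ A when c − ξ b is a popular element of
-- A − ξ A.  Dependent random choice in this graph gives a dense B ⊆ A with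
-- |B − B| ≪ K⁹ |A| that still carries many edges; counting paths between the
-- graphs of two elements of X then gives η ∈ X and Y ⊆ η⁻¹ X, of density ≫ K⁻²,
-- with |B − x B| ≤ L |B| for x ∈ Y, where L ≪ K²⁵.  By averaging there are
-- c, d ∈ B such that c + x b ∈ B for ≫ |Y| / L of the x ∈ Y, for each b in a
-- dense subset A₁ of B − d.
--
-- The bound on A₁ + Y A₁ uses that the field is commutative and that nonzero
-- elements are invertible.  Let u = y b with y ∈ Y and b ∈ A₁.  For many x ∈ Y,
-- x u = y (x b) lies in a translate of y B, so that, |B − y B| being small,
-- Cauchy–Schwarz gives many pairs x , x′ ∈ Y with (x − x′) u ∈ B − B.  For x ≠ x′
-- each element of B − B comes from only one u, and double counting bounds the
-- number of u.  The diagonal x = x′ is negligible unless |Y| < 4 L², in which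
-- case A₁ + Y A₁ is the union of few small sets A₁ + y A₁.  No logarithms are
-- lost: Λ only has to absorb a constant.

-- The obstacle in bounding B - B, and later η B - ξ B, is that a difference may come from a single
-- pair, so counting pairs says nothing about the number of differences. Hence each count attached
-- to a pair is bounded by a function of the difference alone, `ρ ⋆ ρ` or `representations`, whose
-- total over the field is known. A lower bound valid for every pair then bounds the number of
-- differences. This is why B must be good for all of its pairs and not just for most of them, which
-- dependent random choice provides. In the final count the elements detected are α + y b with α ∈
-- B, not y b alone: the multiples x α and x′ α are attached crosswise, so that adding A₁ costs
-- nothing further. The combinatorics takes place in the natural numbers. The trivial upper bound
-- for the energy keeps K away from 0, so K can be rounded up to an integer κ at most 7 K. The only
-- analysis left is a lower bound, uniform in q, for a power of log q, since log 2 < 1.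

module Reals where

  open import Defs
  open import Algebra.Bundles using (CommutativeRing)
  open import Data.Nat.Base as ℕ using (ℕ; zero; suc)
  import Data.Nat.Properties as ℕ
  open import Data.Product.Base using (∃; _×_; _,_; proj₁; proj₂)
  open import Data.Rational.Base as ℚ using (ℚ; 0ℚ; 1ℚ; ½; _+_; _*_; _-_; -_; _≤_; _<_; ∣_∣; _/_)
  import Data.Rational.Properties as ℚ
  open import Data.Rational.Solver using (module +-*-Solver)
  open import Algebra.Properties.Semiring.Exp (CommutativeRing.semiring ℚ.+-*-commutativeRing) using (_^_)
  import Data.Integer.Base as ℤ
  open import Data.Sum.Base using (inj₁; inj₂)
  open import Data.Empty using (⊥-elim)
  open import Relation.Binary.PropositionalEquality
  open import Relation.Nullary using (yes; no)
  open +-*-Solver using (solve; _:+_; _:*_; :-_; con; _:=_)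
  open RationalFacts
  open CauchyFacts using (both)
  open Logarithm
  open Exponential using (expApprox)
  open ℚ.≤-Reasoning

  -- Lower bounds for the approximants of exp and log

  ⅓ ¼ ⅙ : ℚ
  ⅓ = ℤ.+ 1 / 3
  ¼ = ℤ.+ 1 / 4
  ⅙ = ℤ.+ 1 / 6

  ½<1 : ½ < 1ℚ
  ½<1 = ℚ.+-monoʳ-< ½ 0<½

  ½≤1 : ½ ≤ 1ℚ
  ½≤1 = ℚ.<⇒≤ ½<1

  eventually-map : ∀ {P Q : ℕ → Set} → (∀ n → P n → Q n) → Eventually P → Eventually Q
  eventually-map f (N , p) = N , λ n N≤n → f n (p n N≤n)

  ι-+ : ∀ m n → ι (m ℕ.+ n) ≡ ι m + ι n
  ι-+ zero    n = sym (ℚ.+-identityˡ (ι n))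
  ι-+ (suc m) n = begin-equality
    ι (suc (m ℕ.+ n))    ≡⟨ ι-suc (m ℕ.+ n) ⟩
    1ℚ + ι (m ℕ.+ n)     ≡⟨ cong (1ℚ +_) (ι-+ m n) ⟩
    1ℚ + (ι m + ι n)     ≡⟨ ℚ.+-assoc 1ℚ (ι m) (ι n) ⟨
    1ℚ + ι m + ι n       ≡⟨ cong (_+ ι n) (ι-suc m) ⟨
    ι (suc m) + ι n      ∎

  ι-* : ∀ m n → ι (m ℕ.* n) ≡ ι m * ι n
  ι-* zero    n = sym (ℚ.*-zeroˡ (ι n))
  ι-* (suc m) n = begin-equality
    ι (n ℕ.+ m ℕ.* n)    ≡⟨ ι-+ n (m ℕ.* n) ⟩
    ι n + ι (m ℕ.* n)    ≡⟨ cong (ι n +_) (ι-* m n) ⟩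
    ι n + ι m * ι n      ≡⟨ solve 2 (λ m n → n :+ m :* n := (con 1ℚ :+ m) :* n) refl (ι m) (ι n) ⟩
    (1ℚ + ι m) * ι n     ≡⟨ cong (_* ι n) (ι-suc m) ⟨
    ι (suc m) * ι n      ∎

  ι-^ : ∀ m e → ι (m ℕ.^ e) ≡ ι m ^ e
  ι-^ m zero    = refl
  ι-^ m (suc e) = trans (ι-* m (m ℕ.^ e)) (cong (ι m *_) (ι-^ m e))

  -- Bernoulli's inequality bounds (1 + x/(m+1))^(m+1) below by 1 + x for every m at once, the base
  -- being nonnegative because x/(m+1) ≥ -½.
  ½≤exp : ∀ m {x} → - ½ ≤ x → ½ ≤ expApprox m x
  ½≤exp m {x} -½≤x = begin
    ½                                     ≤⟨ ℚ.+-monoʳ-≤ 1ℚ -½≤x ⟩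
    1ℚ + x                                ≡⟨ cong (1ℚ +_) cancel ⟨
    1ℚ + ι (suc m) * (x * r)              ≤⟨ bernoulli (x * r) (suc m) nonNeg ⟩
    expApprox m x                         ∎
    where
    r : ℚ
    r = recip (ι (suc m))
    0≤r : 0ℚ ≤ r
    0≤r = ℚ.<⇒≤ (recip-pos (0<ι-suc m))
    cancel : ι (suc m) * (x * r) ≡ x
    cancel = trans (solve 3 (λ a x r → a :* (x :* r) := x :* (a :* r)) refl (ι (suc m)) x r)
      (trans (cong (x *_) (*-recip (0<ι-suc m))) (ℚ.*-identityʳ x))
    nonNeg : 0ℚ ≤ 1ℚ + x * r
    nonNeg = begin
      0ℚ                    ≤⟨ p≤q⇒0≤q-p (*-mono (ℚ.<⇒≤ 0<½) 0≤1 ½≤1 (recip≤1 (1≤ι-suc m))) ⟩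
      1ℚ * 1ℚ - ½ * r       ≡⟨ solve 1 (λ r → con 1ℚ :* con 1ℚ :+ :- (con ½ :* r) := con 1ℚ :+ con (- ½) :* r) refl r ⟩
      1ℚ + - ½ * r          ≤⟨ ℚ.+-monoʳ-≤ 1ℚ (*-monoʳ r 0≤r -½≤x) ⟩
      1ℚ + x * r            ∎

  atanhSum-nonNeg : ∀ n {z} → 0ℚ ≤ z → 0ℚ ≤ atanhSum n z
  atanhSum-nonNeg zero    0≤z = ℚ.≤-refl
  atanhSum-nonNeg (suc n) 0≤z = +-nonNeg (atanhSum-nonNeg n 0≤z)
    (*-nonNeg (^-nonNeg (suc (2 ℕ.* n)) 0≤z) (ℚ.<⇒≤ (recip-pos (0<ι-suc (2 ℕ.* n)))))

  -- For w ≥ 1 the series has nonnegative terms. For w in [½, 1] its argument (w - 1)/(w + 1) lies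
  -- in [-⅓, 0], so the partial sums are dominated by the geometric series of ratio ⅓, whose sum is
  -- 3/2; the factor 2 in front gives 3.
  -3≤log : ∀ n {w} → ½ ≤ w → - (ι 3) ≤ logApprox n w
  -3≤log n {w} ½≤w with ℚ.≤-total 1ℚ w
  ... | inj₁ 1≤w = ℚ.≤-trans (ℚ.nonPositive⁻¹ (- (ι 3))) (*-nonNeg 0≤2 (atanhSum-nonNeg n
    (*-nonNeg (p≤q⇒0≤q-p 1≤w) (ℚ.<⇒≤ (recip-pos (ℚ.<-≤-trans 0<1 (p≤q+p 1ℚ (ℚ.≤-trans 0≤1 1≤w))))))))
  ... | inj₂ w≤1 = *-monoˡ 2ℚ 0≤2 (∣∣≤⇒-≤ {S} {ι 3 * ½} ∣S∣≤)
    where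
    S t z : ℚ
    S = atanhSum n z
    t = recip (w + 1ℚ)
    z = logArg w
    0<w+1 : 0ℚ < w + 1ℚ
    0<w+1 = ℚ.<-≤-trans 0<1 (p≤q+p 1ℚ (ℚ.≤-trans (ℚ.<⇒≤ 0<½) ½≤w))
    0≤t : 0ℚ ≤ t
    0≤t = ℚ.<⇒≤ (recip-pos 0<w+1)
    z≤ : z ≤ ⅓
    z≤ = begin
      (w - 1ℚ) * t      ≤⟨ *-monoʳ t 0≤t (ℚ.+-monoˡ-≤ (- 1ℚ) w≤1) ⟩
      0ℚ * t            ≡⟨ ℚ.*-zeroˡ t ⟩
      0ℚ                ≤⟨ ℚ.nonNegative⁻¹ ⅓ ⟩
      ⅓                 ∎
    -z≤ : - z ≤ ⅓
    -z≤ = begin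
      - ((w - 1ℚ) * t)        ≡⟨ solve 2 (λ w t → :- ((w :+ :- con 1ℚ) :* t) := (con 1ℚ :+ :- w) :* t) refl w t ⟩
      (1ℚ - w) * t            ≤⟨ *-monoʳ t 0≤t (0≤q-p⇒p≤q {1ℚ - w} {⅓ * (w + 1ℚ)} (subst (0ℚ ≤_)
        (solve 1 (λ w → con (ι 4 * ⅓) :* (w :+ :- con ½) := con ⅓ :* (w :+ con 1ℚ) :+ :- (con 1ℚ :+ :- w)) refl w)
        (*-nonNeg (ℚ.nonNegative⁻¹ (ι 4 * ⅓)) (p≤q⇒0≤q-p ½≤w)))) ⟩
      ⅓ * (w + 1ℚ) * t        ≡⟨ ℚ.*-assoc ⅓ (w + 1ℚ) t ⟩
      ⅓ * ((w + 1ℚ) * t)      ≡⟨ cong (⅓ *_) (*-recip 0<w+1) ⟩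
      ⅓ * 1ℚ                  ≡⟨ ℚ.*-identityʳ ⅓ ⟩
      ⅓                       ∎
    ⅓≤1 : ⅓ ≤ 1ℚ
    ⅓≤1 = p≤p+q ⅓ (ℚ.nonNegative⁻¹ (1ℚ - ⅓))
    ∣S∣≤ : ∣ S ∣ ≤ ι 3 * ½
    ∣S∣≤ = ℚ.*-cancelʳ-≤-pos (1ℚ - ⅓) (begin
      ∣ S ∣ * (1ℚ - ⅓)                             ≡⟨ cong (λ s → ∣ s ∣ * (1ℚ - ⅓)) (ℚ.+-identityʳ S) ⟨
      ∣ S - atanhSum 0 z ∣ * (1ℚ - ⅓)              ≡⟨ cong (λ m → ∣ atanhSum m z - atanhSum 0 z ∣ * (1ℚ - ⅓)) (ℕ.+-identityʳ n) ⟨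
      ∣ atanhSum (n ℕ.+ 0) z - atanhSum 0 z ∣ * (1ℚ - ⅓)
                                                   ≤⟨ atanhTail ⅓ z (∣∣≤ z≤ -z≤) ⅓≤1 0 n ⟩
      1ℚ - ⅓ ^ (n ℕ.+ 0)                           ≤⟨ ℚ.+-monoʳ-≤ 1ℚ (ℚ.neg-antimono-≤ (^-nonNeg (n ℕ.+ 0) (ℚ.nonNegative⁻¹ ⅓))) ⟩
      ι 3 * ½ * (1ℚ - ⅓)                           ∎)

  -- The first term 2 (w - 1)/(w + 1) of the nonnegative series is large enough. The empty sum at
  -- index 0 vanishes, hence `suc n`.
  ½≤log : ∀ n {w} → ι 2 ≤ w → ½ ≤ logApprox (suc n) w
  ½≤log n {w} 2≤w = begin
    ½                              ≤⟨ *-monoˡ 2ℚ 0≤2 ¼≤z ⟩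
    2ℚ * logArg w                  ≡⟨ cong (2ℚ *_) (solve 1 (λ z → z := con 0ℚ :+ (z :* con 1ℚ) :* con 1ℚ) refl (logArg w)) ⟩
    2ℚ * atanhSum 1 (logArg w)     ≤⟨ *-monoˡ 2ℚ 0≤2 (atanhSum≥ (logArg w) n (ℚ.≤-trans (ℚ.nonNegative⁻¹ ¼) ¼≤z)) ⟩
    logApprox (suc n) w            ∎
    where
    0<w+1 : 0ℚ < w + 1ℚ
    0<w+1 = ℚ.<-≤-trans 0<1 (p≤q+p 1ℚ (ℚ.≤-trans (0≤ι 2) 2≤w))
    ¼≤z : ¼ ≤ logArg w
    ¼≤z = begin
      ¼                                  ≡⟨ ℚ.*-identityʳ ¼ ⟨
      ¼ * 1ℚ                             ≡⟨ cong (¼ *_) (*-recip 0<w+1) ⟨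
      ¼ * ((w + 1ℚ) * recip (w + 1ℚ))    ≡⟨ ℚ.*-assoc ¼ (w + 1ℚ) _ ⟨
      ¼ * (w + 1ℚ) * recip (w + 1ℚ)      ≤⟨ *-monoʳ (recip (w + 1ℚ)) (ℚ.<⇒≤ (recip-pos 0<w+1)) (0≤q-p⇒p≤q {¼ * (w + 1ℚ)} {w - 1ℚ} (subst (0ℚ ≤_)
        (solve 1 (λ w → con (ι 3 * ¼) :* (w :+ :- con (ι 2)) :+ con ¼ := (w :+ :- con 1ℚ) :+ :- (con ¼ :* (w :+ con 1ℚ))) refl w)
        (+-nonNeg (*-nonNeg (ℚ.nonNegative⁻¹ (ι 3 * ¼)) (p≤q⇒0≤q-p 2≤w)) (ℚ.nonNegative⁻¹ ¼)))) ⟩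
      (w - 1ℚ) * recip (w + 1ℚ)          ∎

  -- The exponent of log q. It has to be positive, and ⅙ is the largest value with ⅙ · (-3) ≥ -½,
  -- the range in which `½≤exp` applies.
  ⅙⁺ : ℝ⁺
  ⅙⁺ = record { real = fromℚ ⅙ ; positive = PositiveReal.fromℚ-positive (ℚ.positive⁻¹ ⅙) }

  -- As log log q ≥ log log 2 ≥ − 3, the power (log q)^(1/6) is at least ½.
  ½≤logℕ^⅙ : ∀ q (1<q : 1 ℕ.< q) → Eventually (λ n → ½ ≤ approx (real (logℕ q 1<q ^ℝ real ⅙⁺)) n)
  ½≤logℕ^⅙ q 1<q = 1 , λ where
    (suc n) _ → ½≤exp (suc n) (*-monoˡ ⅙ (ℚ.nonNegative⁻¹ ⅙) (-3≤log (suc n) (½≤log n (ι-mono 1<q))))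

  approx-^⁺ : ∀ K e n → approx (real (K ^⁺ e)) n ≡ approx (real K) n ^ e
  approx-^⁺ K zero    n = refl
  approx-^⁺ K (suc e) n = cong (approx (real K) n *_) (approx-^⁺ K e n)

  ≤⇒≤ℝ : ∀ {x y} → Eventually (λ n → approx x n ≤ approx y n) → x ≤ℝ y
  ≤⇒≤ℝ {x} {y} h ε 0<ε = eventually-map (λ n le → ℚ.≤-trans le (p≤p+q (approx y n) (ℚ.<⇒≤ 0<ε))) h

  -- Rounding K to a natural number

  ι-cancel-≤ : ∀ {m n} → ι m ≤ ι n + ½ → m ℕ.≤ n
  ι-cancel-≤ {m} {n} h with m ℕ.≤? n
  ... | yes m≤n = m≤n
  ... | no  m≰n = ⊥-elim (ℚ.<-irrefl refl (ℚ.<-≤-trans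
    (subst (ι n + ½ <_) (ℚ.+-comm (ι n) 1ℚ) (ℚ.+-monoʳ-< (ι n) ½<1))
    (ℚ.≤-trans (ℚ.≤-reflexive (sym (ι-suc n))) (ℚ.≤-trans (ι-mono (ℕ.≰⇒> m≰n)) h))))

  ceiling : ∀ {p} → 0ℚ ≤ p → ∀ j → p ≤ ι j → ∃ λ i → p ≤ ι i × ι i ≤ 1ℚ + p
  ceiling {p} 0≤p zero    p≤0 = 0 , p≤0 , ℚ.≤-trans 0≤p (p≤q+p p 0≤1)
  ceiling {p} 0≤p (suc j) p≤j with ℚ.≤-total p (ι j)
  ... | inj₁ p≤j′ = ceiling 0≤p j p≤j′
  ... | inj₂ j≤p  = suc j , p≤j , subst (_≤ 1ℚ + p) (sym (ι-suc j)) (ℚ.+-monoʳ-≤ 1ℚ j≤p)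

  Rounding : ℝ⁺ → ℕ → Set
  Rounding K κ = Eventually (λ n → 0ℚ < approx (real K) n × approx (real K) n ≤ ι κ × ι κ ≤ ι 7 * approx (real K) n)

  -- Beyond some index all approximants a are within 1 of one of them, v, so the ceiling κ of v + 1
  -- is above them all. Conversely κ ≤ v + 2 ≤ a + 3, and 3 ≤ 6 a because a ≥ ½; this is the origin
  -- of the factor 7.
  rounding : ∀ K → Eventually (λ n → ½ ≤ approx (real K) n) → ∃ λ κ → 0 ℕ.< κ × Rounding K κ
  rounding K (N , ½≤K) =
    let M , close = modulus (cauchy (real K)) 1ℚ 0<1
        m = M ℕ.⊔ N
        v = approx (real K) m
        0≤v+1 = +-nonNeg (ℚ.≤-trans (ℚ.<⇒≤ 0<½) (½≤K m (ℕ.m≤n⊔m M N))) 0≤1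
        κ , v+1≤κ , κ≤v+2 = ceiling 0≤v+1 (proj₁ (archimedean (v + 1ℚ))) (proj₂ (archimedean (v + 1ℚ)))
    in κ , ℕ.n≢0⇒n>0 (λ κ≡0 → ℚ.<-irrefl refl (ℚ.<-≤-trans (ℚ.<-≤-trans 0<1 (p≤q+p 1ℚ (ℚ.≤-trans (ℚ.<⇒≤ 0<½) (½≤K m (ℕ.m≤n⊔m M N))))) (subst (λ k → v + 1ℚ ≤ ι k) κ≡0 v+1≤κ))) ,
       m , λ n m≤n →
         let a = approx (real K) n
             ½≤a = ½≤K n (ℕ.≤-trans (ℕ.m≤n⊔m M N) m≤n)
             |a-v|≤1 = close n m (ℕ.≤-trans (ℕ.m≤m⊔n M N) m≤n) (ℕ.m≤m⊔n M N)
             a-v≤1 = ℚ.≤-trans (p≤∣p∣ (a - v)) |a-v|≤1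
             v-a≤1 = ℚ.≤-trans (p≤∣p∣ (v - a)) (ℚ.≤-trans (ℚ.≤-reflexive (∣p-q∣≡∣q-p∣ v a)) |a-v|≤1)
         in ℚ.<-≤-trans 0<½ ½≤a ,
            ℚ.≤-trans (0≤q-p⇒p≤q (subst (0ℚ ≤_) (solve 2 (λ a v → con 1ℚ :+ :- (a :+ :- v) := (v :+ con 1ℚ) :+ :- a) refl a v) (p≤q⇒0≤q-p a-v≤1))) v+1≤κ ,
            ℚ.≤-trans κ≤v+2 (0≤q-p⇒p≤q (subst (0ℚ ≤_)
              (solve 2 (λ a v → (con 1ℚ :+ :- (v :+ :- a)) :+ con (ι 6) :* (a :+ :- con ½) := con (ι 7) :* a :+ :- (con 1ℚ :+ (v :+ con 1ℚ))) refl a v)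
              (+-nonNeg (p≤q⇒0≤q-p v-a≤1) (*-nonNeg (0≤ι 6) (p≤q⇒0≤q-p ½≤a)))))

  -- E ≥ N / K with E ≤ N forces K ≥ 1; half of this suffices.
  ½≤K : ∀ K {N E} → 0 ℕ.< N → E ℕ.≤ N → K ⁻¹ · N ≤ℝ fromℕ E → Eventually (λ n → ½ ≤ approx (real K) n)
  ½≤K K {N} {E} 0<N E≤N h = let δ , 0<δ , δ≤K = positive K in
    eventually-map (λ n (δ≤a , le) → bound (ℚ.<-≤-trans 0<δ δ≤a) le) (both δ≤K (h 1ℚ 0<1))
    where
    1≤N : 1ℚ ≤ ι N
    1≤N = ι-mono 0<N
    bound : ∀ {a} → 0ℚ < a → recip a * ι N ≤ ι E + 1ℚ → ½ ≤ a
    bound {a} 0<a le = ℚ.*-cancelʳ-≤-pos (ι N) {{ℚ.positive (ℚ.<-≤-trans 0<1 1≤N)}} (begin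
      ½ * ι N                          ≡⟨ cong (½ *_) (trans (cong (_* ι N) (*-recip 0<a)) (ℚ.*-identityˡ (ι N))) ⟨
      ½ * (a * recip a * ι N)          ≡⟨ cong (½ *_) (ℚ.*-assoc a (recip a) (ι N)) ⟩
      ½ * (a * (recip a * ι N))        ≤⟨ *-monoˡ ½ (ℚ.<⇒≤ 0<½) (*-monoˡ a (ℚ.<⇒≤ 0<a) (ℚ.≤-trans le (ℚ.+-mono-≤ (ι-mono E≤N) 1≤N))) ⟩
      ½ * (a * (ι N + ι N))            ≡⟨ solve 2 (λ a n → con ½ :* (a :* (n :+ n)) := a :* n) refl a (ι N) ⟩
      a * ι N                          ∎)

  -- Multiplication by a ≤ κ turns the error ε = 1/(2κ) allowed by `≤ℝ` into at most ½, which
  -- integrality of both sides removes.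
  ≤ℝ⇒≤ : ∀ K {κ N E} → 0 ℕ.< κ → Rounding K κ → K ⁻¹ · N ≤ℝ fromℕ E → N ℕ.≤ κ ℕ.* E
  ≤ℝ⇒≤ K {κ} {N} {E} 0<κ K≈κ h =
    let M , bounds = both K≈κ (h ε (half-pos (recip-pos 0<ικ)))
        (0<a , a≤κ , _) , le = bounds M ℕ.≤-refl
        a = approx (real K) M
    in ι-cancel-≤ (begin
      ι N                          ≡⟨ trans (cong (_* ι N) (*-recip 0<a)) (ℚ.*-identityˡ (ι N)) ⟨
      a * recip a * ι N            ≡⟨ ℚ.*-assoc a (recip a) (ι N) ⟩
      a * (recip a * ι N)          ≤⟨ *-monoˡ a (ℚ.<⇒≤ 0<a) le ⟩
      a * (ι E + ε)                ≤⟨ *-monoʳ (ι E + ε) (+-nonNeg (0≤ι E) (ℚ.<⇒≤ (half-pos (recip-pos 0<ικ)))) a≤κ ⟩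
      ι κ * (ι E + ε)              ≡⟨ solve 3 (λ k e r → k :* (e :+ con ½ :* r) := k :* e :+ con ½ :* (k :* r)) refl (ι κ) (ι E) (recip (ι κ)) ⟩
      ι κ * ι E + ½ * (ι κ * recip (ι κ))  ≡⟨ cong₂ (λ x y → x + ½ * y) (sym (ι-* κ E)) (*-recip 0<ικ) ⟩
      ι (κ ℕ.* E) + ½              ∎)
    where
    0<ικ : 0ℚ < ι κ
    0<ικ = ℚ.<-≤-trans 0<1 (ι-mono 0<κ)
    ε : ℚ
    ε = ½ * recip (ι κ)

  -- From bounds in κ to bounds in Λ and K

  module _ (Λ K : ℝ⁺) {κ C : ℕ} (K≈κ : Rounding K κ)
           (C≤Λ : Eventually (λ n → ι (C ℕ.* 7 ℕ.^ 226) ≤ approx (real Λ) n)) where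

    private
      -- Replacing κ by K costs 7^e. Since 226 is the largest exponent in the conclusion, a Λ of
      -- size at least 7^226 C pays for all of them.
      factor : ∀ {e} → e ℕ.≤ 226 → Eventually (λ n → 0ℚ < approx (real Λ) n × 0ℚ < approx (real (K ^⁺ e)) n ×
                                                 ι (C ℕ.* κ ℕ.^ e) ≤ approx (real Λ) n * approx (real (K ^⁺ e)) n)
      factor {e} e≤226 = let δ , 0<δ , δ≤Λ = positive Λ in
        eventually-map (λ n (δ≤l , (0<a , _ , κ≤7a) , C≤l) →
          let l = approx (real Λ) n
              a = approx (real K) n
          in ℚ.<-≤-trans 0<δ δ≤l , subst (0ℚ <_) (sym (approx-^⁺ K e n)) (^-pos e 0<a) , (begin
            ι (C ℕ.* κ ℕ.^ e)              ≡⟨ trans (ι-* C (κ ℕ.^ e)) (cong (ι C *_) (ι-^ κ e)) ⟩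
            ι C * ι κ ^ e                  ≤⟨ *-monoˡ (ι C) (0≤ι C) (^-mono e (0≤ι κ) κ≤7a) ⟩
            ι C * (ι 7 * a) ^ e            ≡⟨ cong (ι C *_) (*-^ (ι 7) a e) ⟩
            ι C * (ι 7 ^ e * a ^ e)        ≡⟨ ℚ.*-assoc (ι C) (ι 7 ^ e) (a ^ e) ⟨
            ι C * ι 7 ^ e * a ^ e          ≡⟨ cong (_* a ^ e) (trans (ι-* C (7 ℕ.^ e)) (cong (ι C *_) (ι-^ 7 e))) ⟨
            ι (C ℕ.* 7 ℕ.^ e) * a ^ e      ≤⟨ *-monoʳ (a ^ e) (^-nonNeg e (ℚ.<⇒≤ 0<a)) (ℚ.≤-trans (ι-mono (ℕ.*-monoʳ-≤ C (ℕ.^-monoʳ-≤ 7 e≤226))) C≤l) ⟩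
            l * a ^ e                      ≡⟨ cong (l *_) (approx-^⁺ K e n) ⟨
            l * approx (real (K ^⁺ e)) n   ∎))
          (both δ≤Λ (both K≈κ C≤Λ))

    upper : ∀ {e m N} → e ℕ.≤ 226 → m ℕ.≤ C ℕ.* κ ℕ.^ e ℕ.* N → fromℕ m ≤ℝ (Λ *⁺ K ^⁺ e) · N
    upper {e} {m} {N} e≤226 h = ≤⇒≤ℝ {fromℕ m} {(Λ *⁺ K ^⁺ e) · N} (eventually-map (λ n (_ , _ , le) → begin
      ι m                            ≤⟨ ι-mono h ⟩
      ι (C ℕ.* κ ℕ.^ e ℕ.* N)        ≡⟨ ι-* (C ℕ.* κ ℕ.^ e) N ⟩
      ι (C ℕ.* κ ℕ.^ e) * ι N        ≤⟨ *-monoʳ (ι N) (0≤ι N) le ⟩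
      approx (real Λ) n * approx (real (K ^⁺ e)) n * ι N ∎) (factor e≤226))

    lower : ∀ {e m N} → e ℕ.≤ 226 → N ℕ.≤ C ℕ.* κ ℕ.^ e ℕ.* m → (Λ ⁻¹ *⁺ (K ^⁺ e) ⁻¹) · N ≤ℝ fromℕ m
    lower {e} {m} {N} e≤226 h = ≤⇒≤ℝ {(Λ ⁻¹ *⁺ (K ^⁺ e) ⁻¹) · N} {fromℕ m} (eventually-map (λ n (0<l , 0<a , le) →
      let l = approx (real Λ) n
          a = approx (real (K ^⁺ e)) n
          0≤r = *-nonNeg (ℚ.<⇒≤ (recip-pos 0<l)) (ℚ.<⇒≤ (recip-pos 0<a))
      in begin
      recip l * recip a * ι N                      ≤⟨ *-monoˡ (recip l * recip a) 0≤r (ι-mono h) ⟩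
      recip l * recip a * ι (C ℕ.* κ ℕ.^ e ℕ.* m)  ≡⟨ cong (recip l * recip a *_) (ι-* (C ℕ.* κ ℕ.^ e) m) ⟩
      recip l * recip a * (ι (C ℕ.* κ ℕ.^ e) * ι m) ≤⟨ *-monoˡ (recip l * recip a) 0≤r (*-monoʳ (ι m) (0≤ι m) le) ⟩
      recip l * recip a * (l * a * ι m)            ≡⟨ solve 5 (λ r s l a m → (r :* s) :* ((l :* a) :* m) := (l :* r) :* ((a :* s) :* m)) refl (recip l) (recip a) l a (ι m) ⟩
      l * recip l * (a * recip a * ι m)            ≡⟨ cong₂ (λ x y → x * (y * ι m)) (*-recip 0<l) (*-recip 0<a) ⟩
      1ℚ * (1ℚ * ι m)                              ≡⟨ solve 1 (λ m → con 1ℚ :* (con 1ℚ :* m) := m) refl (ι m) ⟩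
      ι m                                          ∎) (factor e≤226))

  constant : ∀ m → 0 ℕ.< m → ℝ⁺
  constant m m>0 = record { real = fromℕ m ; positive = PositiveReal.fromℚ-positive (ℚ.<-≤-trans 0<1 (ι-mono m>0)) }

  -- The factor 2 in the constant makes up for (log q)^(1/6) being bounded below by ½ only.
  Λ-large : ∀ M (M>0 : 0 ℕ.< M ℕ.* 2) q (1<q : 1 ℕ.< q) →
            Eventually (λ n → ι M ≤ approx (real (constant (M ℕ.* 2) M>0 *⁺ logℕ q 1<q ^ℝ real ⅙⁺)) n)
  Λ-large M M>0 q 1<q = eventually-map (λ n → bound) (½≤logℕ^⅙ q 1<q)
    where
    bound : ∀ {p} → ½ ≤ p → ι M ≤ ι (M ℕ.* 2) * p
    bound {p} ½≤p = begin
      ι M                      ≡⟨ solve 1 (λ m → m := (m :* con (ι 2)) :* con ½) refl (ι M) ⟩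
      ι M * ι 2 * ½            ≡⟨ cong (_* ½) (ι-* M 2) ⟨
      ι (M ℕ.* 2) * ½          ≤⟨ *-monoˡ (ι (M ℕ.* 2)) (0≤ι (M ℕ.* 2)) ½≤p ⟩
      ι (M ℕ.* 2) * p          ∎

-- A ring solver with cancelling coefficients

module FieldSolver where

  open import Algebra.Bundles using (CommutativeRing; RawRing)
  open import Algebra.Solver.Ring.AlmostCommutativeRing using (_-Raw-AlmostCommutative⟶_; fromCommutativeRing; Induced-equivalence)
  open import Data.Maybe.Base using (just; nothing)
  open import Data.Nat.Base as ℕ using (ℕ)
  import Data.Nat.Properties as ℕ
  open import Data.Product.Base using (_×_; _,_)
  open import Level using (0ℓ)
  open import Relation.Binary.Definitions using (WeaklyDecidable)
  open import Relation.Binary.PropositionalEquality as ≡ using (_≡_)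
  open import Relation.Nullary using (yes; no)
  import Algebra.Solver.Ring

  -- A solver for commutative rings whose coefficients are formal differences
  -- (a , b) of natural numbers, so that terms cancel.
  module DifferenceSolver (R : CommutativeRing 0ℓ 0ℓ) where

    open CommutativeRing R
    open import Algebra.Properties.Ring ring
    open import Algebra.Properties.AbelianGroup +-abelianGroup using (⁻¹-∙-comm)
    open import Algebra.Properties.CommutativeSemigroup +-commutativeSemigroup using (interchange)
    open import Algebra.Properties.Semiring.Mult semiring using (×-homo-+; ×1-homo-*) renaming (_×_ to _·_)
    open import Relation.Binary.Reasoning.Setoid setoid

    private
      differences : RawRing 0ℓ 0ℓ
      differences = record
        { Carrier = ℕ × ℕ
        ; _≈_     = _≡_
        ; _+_     = λ (a , b) (c , d) → a ℕ.+ c , b ℕ.+ d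
        ; _*_     = λ (a , b) (c , d) → a ℕ.* c ℕ.+ b ℕ.* d , a ℕ.* d ℕ.+ b ℕ.* c
        ; -_      = λ (a , b) → b , a
        ; 0#      = 0 , 0
        ; 1#      = 1 , 0
        }

      ⟪_⟫ : ℕ → Carrier
      ⟪ n ⟫ = n · 1#

      ⟪+⟫ : ∀ m n → ⟪ m ℕ.+ n ⟫ ≈ ⟪ m ⟫ + ⟪ n ⟫
      ⟪+⟫ = ×-homo-+ 1#

      difference-+ : ∀ a b c d → (a + c) - (b + d) ≈ (a - b) + (c - d)
      difference-+ a b c d = begin
        (a + c) - (b + d)          ≈⟨ +-congˡ (⁻¹-∙-comm b d) ⟨
        (a + c) + (- b + - d)      ≈⟨ interchange a c (- b) (- d) ⟩
        (a - b) + (c - d)          ∎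

      difference-* : ∀ a b c d → (a * c + b * d) - (a * d + b * c) ≈ (a - b) * (c - d)
      difference-* a b c d = begin
        (a * c + b * d) - (a * d + b * c)            ≈⟨ difference-+ (a * c) (a * d) (b * d) (b * c) ⟩
        (a * c - a * d) + (b * d - b * c)            ≈⟨ +-cong (left a c d) (+-congʳ (-‿involutive (b * d))) ⟨
        a * (c - d) + (- - (b * d) - b * c)          ≈⟨ +-congˡ (+-comm _ _) ⟩
        a * (c - d) + (- (b * c) + - - (b * d))      ≈⟨ +-congˡ (trans (-‿distribˡ-* b (c - d)) (trans (left (- b) c d)
                                                          (+-cong (sym (-‿distribˡ-* b c)) (-‿cong (sym (-‿distribˡ-* b d)))))) ⟨
        a * (c - d) + - (b * (c - d))                ≈⟨ +-congˡ (-‿distribˡ-* b (c - d)) ⟩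
        a * (c - d) + - b * (c - d)                  ≈⟨ distribʳ (c - d) a (- b) ⟨
        (a - b) * (c - d)                            ∎
        where
        left : ∀ a c d → a * (c - d) ≈ a * c - a * d
        left a c d = trans (distribˡ a c (- d)) (+-congˡ (sym (-‿distribʳ-* a d)))

      difference-≈ : ∀ {a b c d} → a + d ≈ c + b → a - b ≈ c - d
      difference-≈ {a} {b} {c} {d} h = begin
        a - b                      ≈⟨ +-identityʳ (a - b) ⟨
        (a - b) + 0#               ≈⟨ +-congˡ (-‿inverseʳ d) ⟨
        (a - b) + (d - d)          ≈⟨ interchange a (- b) d (- d) ⟩
        (a + d) + (- b - d)        ≈⟨ +-congʳ h ⟩
        (c + b) + (- b - d)        ≈⟨ +-assoc c b _ ⟩
        c + (b + (- b - d))        ≈⟨ +-congˡ (+-assoc b (- b) (- d)) ⟨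
        c + ((b - b) - d)          ≈⟨ +-congˡ (+-congʳ (-‿inverseʳ b)) ⟩
        c + (0# - d)               ≈⟨ +-congˡ (+-identityˡ (- d)) ⟩
        c - d                      ∎

    private
      morphism : differences -Raw-AlmostCommutative⟶ fromCommutativeRing R
      morphism = record
        { ⟦_⟧    = λ (a , b) → ⟪ a ⟫ - ⟪ b ⟫
        ; +-homo = λ (a , b) (c , d) → trans (+-cong (⟪+⟫ a c) (-‿cong (⟪+⟫ b d))) (difference-+ _ _ _ _)
        ; *-homo = λ (a , b) (c , d) → trans
            (+-cong (trans (⟪+⟫ (a ℕ.* c) _) (+-cong (×1-homo-* a c) (×1-homo-* b d)))
              (-‿cong (trans (⟪+⟫ (a ℕ.* d) _) (+-cong (×1-homo-* a d) (×1-homo-* b c)))))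
            (difference-* _ _ _ _)
        ; -‿homo = λ (a , b) → trans (+-comm _ _) (trans (+-congˡ (sym (-‿involutive _))) (⁻¹-∙-comm _ _))
        ; 0-homo = -‿inverseʳ 0#
        ; 1-homo = trans (+-cong (+-identityʳ 1#) -0#≈0#) (+-identityʳ 1#)
        }

      -- The pairs are never reduced, so 1 - 1 is stored as (1 , 1). Comparing a + d with c + b, and
      -- not the pairs themselves, identifies it with 0 and lets the terms disappear.
      _≟_ : WeaklyDecidable (Induced-equivalence morphism)
      (a , b) ≟ (c , d) with a ℕ.+ d ℕ.≟ c ℕ.+ b
      ... | yes eq = just (difference-≈ (trans (sym (⟪+⟫ a d)) (trans (reflexive (≡.cong ⟪_⟫ eq)) (⟪+⟫ c b))))
      ... | no _   = nothing

    open Algebra.Solver.Ring differences (fromCommutativeRing R) morphism _≟_ public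
      using (solve; _:+_; _:*_; _:-_; :-_; _:=_)

open import Algebra.Bundles using (CommutativeRing; RawRing)
open import Algebra.Core using (Op₁; Op₂)
open import Algebra.Morphism.Structures using (IsRingMonomorphism)
import Algebra.Morphism.RingMonomorphism as RingMonomorphism
open import Algebra.Structures using (IsCommutativeRing)
open import Data.Bool.Base using (Bool; true; false; T; _∧_; not)
open import Data.Bool.Properties using (T-∧)
open import Data.Empty using (⊥-elim)
open import Data.Fin.Base using (Fin; zero; suc)
open import Data.Fin.Permutation using (permutation)
open import Data.Fin.Properties using (any?) renaming (_≟_ to _≟ᶠ_)
open import Data.Fin.Subset using (Subset; Nonempty; _∈_; _⊆_; ⋃; ⁅_⁆) renaming (∣_∣ to card)
open import Data.Fin.Subset.Properties using (_∈?_; x∈p∪q⁻; x∈p∪q⁺; x∈⁅x⁆; x∈⁅y⁆⇒x≡y; ∉⊥)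
open import Data.List.Base using (List; []; _∷_; length; allFin; tabulate; cartesianProduct; cartesianProductWith; map; _++_; filter; filterᵇ)
import Data.List.Membership.Propositional as List
open import Data.List.Membership.Propositional.Properties using (∈-map⁺; ∈-map⁻; ∈-filter⁺; ∈-filter⁻; ∈-allFin; ∈-cartesianProduct⁻; ∈-cartesianProductWith⁻)
open import Data.List.Relation.Unary.Any using (here; there)
open import Data.Nat.Base
open import Data.Nat.ListAction using (sum)
open import Data.Nat.Properties
open import Data.Nat.Tactic.RingSolver using (solve-∀)
open import Data.Product.Base using (∃; _×_; _,_; proj₁; proj₂)
open import Data.Sum.Base using (inj₁; inj₂)
open import Data.Vec.Base using ([]; _∷_; lookup) renaming (tabulate to tabulateᵛ)
open import Data.Vec.Properties using (lookup∘tabulate; lookup⇒[]=; []=⇒lookup)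
open import Function.Base using (_∘_; id)
open import Function.Bundles using (Equivalence; Inverse)
open import Level using (0ℓ)
open import Relation.Binary.PropositionalEquality using (_≡_; _≢_; refl; sym; trans; cong; cong₂; subst; subst₂)
import Relation.Binary.Reasoning.Setoid as SetoidReasoning
open import Relation.Nullary using (Dec; yes; no; does; ¬_; contradiction)
open import Relation.Nullary.Decidable using (T?; _×-dec_; toWitness; fromWitness; isYes)
open import Relation.Unary using (Decidable)
open import Algebra.Properties.Semiring.Sum +-*-semiring using (sum-permute) renaming (sum to sumᶠ)
open FieldSolver

open ≤-Reasoning

private
  variable
    I J : Set

-- Finite sums

∑ : List I → (I → ℕ) → ℕ
∑ []       f = 0
∑ (x ∷ xs) f = f x + ∑ xs f

infix 5 ∑
syntax ∑ xs (λ x → e) = ∑[ x ∈ xs ] e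

∑-mono : ∀ (xs : List I) {f g : I → ℕ} → (∀ {x} → x List.∈ xs → f x ≤ g x) → ∑ xs f ≤ ∑ xs g
∑-mono []       h = z≤n
∑-mono (x ∷ xs) h = +-mono-≤ (h (here refl)) (∑-mono xs (h ∘ there))

∑-mono′ : ∀ (xs : List I) {f g : I → ℕ} → (∀ x → f x ≤ g x) → ∑ xs f ≤ ∑ xs g
∑-mono′ xs h = ∑-mono xs (λ {x} _ → h x)

∑-cong : ∀ (xs : List I) {f g : I → ℕ} → (∀ x → f x ≡ g x) → ∑ xs f ≡ ∑ xs g
∑-cong []       h = refl
∑-cong (x ∷ xs) h = cong₂ _+_ (h x) (∑-cong xs h)

∑-const : ∀ (xs : List I) c → ∑[ _ ∈ xs ] c ≡ length xs * c
∑-const []       c = refl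
∑-const (x ∷ xs) c = cong (c +_) (∑-const xs c)

∑-+ : ∀ (xs : List I) (f g : I → ℕ) → (∑[ x ∈ xs ] (f x + g x)) ≡ ∑ xs f + ∑ xs g
∑-+ []       f g = refl
∑-+ (x ∷ xs) f g = trans (cong (f x + g x +_) (∑-+ xs f g)) (interchange (f x) (g x) _ _)
  where
  interchange : ∀ a b c d → a + b + (c + d) ≡ a + c + (b + d)
  interchange = solve-∀

∑-*ˡ : ∀ (xs : List I) c (f : I → ℕ) → (∑[ x ∈ xs ] c * f x) ≡ c * ∑ xs f
∑-*ˡ []       c f = sym (*-zeroʳ c)
∑-*ˡ (x ∷ xs) c f = trans (cong (c * f x +_) (∑-*ˡ xs c f)) (sym (*-distribˡ-+ c (f x) _))

∑-*ʳ : ∀ (xs : List I) c (f : I → ℕ) → (∑[ x ∈ xs ] f x * c) ≡ ∑ xs f * c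
∑-*ʳ xs c f = trans (∑-cong xs (λ x → *-comm (f x) c)) (trans (∑-*ˡ xs c f) (*-comm c _))

∑-zero : ∀ (xs : List I) → ∑[ _ ∈ xs ] 0 ≡ 0
∑-zero xs = trans (∑-const xs 0) (*-zeroʳ (length xs))

∑-comm : ∀ (xs : List I) (ys : List J) (f : I → J → ℕ) →
         (∑[ x ∈ xs ] ∑[ y ∈ ys ] f x y) ≡ (∑[ y ∈ ys ] ∑[ x ∈ xs ] f x y)
∑-comm []       ys f = sym (∑-zero ys)
∑-comm (x ∷ xs) ys f = trans (cong (∑ ys (f x) +_) (∑-comm xs ys f))
  (sym (∑-+ ys (f x) (λ y → ∑[ x ∈ xs ] f x y)))

∑-* : ∀ (xs : List I) (ys : List J) (f : I → ℕ) (g : J → ℕ) →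
      ∑ xs f * ∑ ys g ≡ (∑[ x ∈ xs ] ∑[ y ∈ ys ] f x * g y)
∑-* xs ys f g = trans (sym (∑-*ʳ xs (∑ ys g) f)) (∑-cong xs (λ x → sym (∑-*ˡ ys (f x) g)))

∑-++ : ∀ (xs ys : List I) f → ∑ (xs ++ ys) f ≡ ∑ xs f + ∑ ys f
∑-++ []       ys f = refl
∑-++ (x ∷ xs) ys f = trans (cong (f x +_) (∑-++ xs ys f)) (sym (+-assoc (f x) _ _))

∑-map : ∀ (h : J → I) xs f → ∑ (map h xs) f ≡ ∑ xs (f ∘ h)
∑-map h []       f = refl
∑-map h (x ∷ xs) f = cong (f (h x) +_) (∑-map h xs f)

∑-product : ∀ (xs : List I) (ys : List J) f →
            ∑ (cartesianProduct xs ys) f ≡ (∑[ x ∈ xs ] ∑[ y ∈ ys ] f (x , y))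
∑-product []       ys f = refl
∑-product (x ∷ xs) ys f = trans (∑-++ (map (x ,_) ys) (cartesianProduct xs ys) f)
  (cong₂ _+_ (∑-map (x ,_) ys f) (∑-product xs ys f))

length≡∑1 : ∀ (xs : List I) → length xs ≡ ∑[ _ ∈ xs ] 1
length≡∑1 xs = sym (trans (∑-const xs 1) (*-identityʳ (length xs)))

length-cartesianProduct : ∀ (xs : List I) (ys : List J) →
                          length (cartesianProduct xs ys) ≡ length xs * length ys
length-cartesianProduct xs ys = trans (length≡∑1 (cartesianProduct xs ys)) (trans
  (∑-product xs ys (λ _ → 1)) (trans (∑-cong xs λ _ → sym (length≡∑1 ys)) (∑-const xs (length ys))))

∑-average : ∀ (xs : List I) {f g : I → ℕ} → 0 < length xs → ∑ xs f ≤ ∑ xs g →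
            ∃ λ x → x List.∈ xs × f x ≤ g x
∑-average (x ∷ xs) {f} {g} _ h with f x ≤? g x
... | yes f≤g = x , here refl , f≤g
∑-average (x ∷ []) {f} {g} _ h | no f≰g =
  x , here refl , subst₂ _≤_ (+-identityʳ _) (+-identityʳ _) h
∑-average (x ∷ y ∷ xs) {f} {g} _ h | no f≰g =
  let z , z∈ , le = ∑-average (y ∷ xs) (s≤s z≤n)
        (+-cancelˡ-≤ (g x) _ _ (≤-trans (+-monoˡ-≤ _ (<⇒≤ (≰⇒> f≰g))) h))
  in z , there z∈ , le

-- With the larger number written as the smaller one plus d, the defect is d².
2ab≤a²+b² : ∀ a b → 2 * (a * b) ≤ a * a + b * b
2ab≤a²+b² a b with ≤-total a b
... | inj₁ a≤b = subst (λ b → 2 * (a * b) ≤ a * a + b * b) (m+[n∸m]≡n a≤b)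
  (m+n≡o⇒m≤o (square a (b ∸ a)))
  where
  square : ∀ a d → 2 * (a * (a + d)) + d * d ≡ a * a + (a + d) * (a + d)
  square = solve-∀
  m+n≡o⇒m≤o : ∀ {m n o} → m + n ≡ o → m ≤ o
  m+n≡o⇒m≤o {m} {n} refl = m≤m+n m n
... | inj₂ b≤a = subst (λ a → 2 * (a * b) ≤ a * a + b * b) (m+[n∸m]≡n b≤a)
  (m+n≡o⇒m≤o (square b (a ∸ b)))
  where
  square : ∀ b d → 2 * ((b + d) * b) + d * d ≡ (b + d) * (b + d) + b * b
  square = solve-∀
  m+n≡o⇒m≤o : ∀ {m n o} → m + n ≡ o → m ≤ o
  m+n≡o⇒m≤o {m} {n} refl = m≤m+n m n

-- Twice the square on the left is a sum over pairs (x , y). The previous inequality, applied to f x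
-- g y and f y g x, bounds each term by a sum of two products that are exchanged by swapping x and
-- y.
cauchySchwarz : ∀ (xs : List I) (f g : I → ℕ) →
  (∑[ x ∈ xs ] f x * g x) * (∑[ x ∈ xs ] f x * g x) ≤
  (∑[ x ∈ xs ] f x * f x) * (∑[ x ∈ xs ] g x * g x)
cauchySchwarz xs f g = *-cancelˡ-≤ 2 (begin
  2 * (S * S)
    ≡⟨ cong (2 *_) (∑-* xs xs _ _) ⟩
  2 * (∑[ x ∈ xs ] ∑[ y ∈ xs ] (f x * g x) * (f y * g y))
    ≡⟨ trans (∑-cong xs λ x → ∑-*ˡ xs 2 _) (∑-*ˡ xs 2 _) ⟨
  (∑[ x ∈ xs ] ∑[ y ∈ xs ] 2 * ((f x * g x) * (f y * g y)))
    ≤⟨ (∑-mono′ xs λ x → ∑-mono′ xs λ y → subst₂ _≤_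
          (rearrange (f x) (g x) (f y) (g y)) (rearrange′ (f x) (g x) (f y) (g y))
          (2ab≤a²+b² (f x * g y) (f y * g x))) ⟩
  (∑[ x ∈ xs ] ∑[ y ∈ xs ] ((f x * f x) * (g y * g y) + (g x * g x) * (f y * f y)))
    ≡⟨ trans (∑-cong xs λ x → ∑-+ xs _ _) (∑-+ xs _ _) ⟩
  (∑[ x ∈ xs ] ∑[ y ∈ xs ] (f x * f x) * (g y * g y)) + (∑[ x ∈ xs ] ∑[ y ∈ xs ] (g x * g x) * (f y * f y))
    ≡⟨ cong₂ _+_ (∑-* xs xs _ _) (∑-* xs xs _ _) ⟨
  F * G + G * F
    ≡⟨ double F G ⟩
  2 * (F * G) ∎)
  where
  S F G : ℕ
  S = ∑[ x ∈ xs ] f x * g x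
  F = ∑[ x ∈ xs ] f x * f x
  G = ∑[ x ∈ xs ] g x * g x
  rearrange : ∀ a b c d → 2 * ((a * d) * (c * b)) ≡ 2 * ((a * b) * (c * d))
  rearrange = solve-∀
  rearrange′ : ∀ a b c d → (a * d) * (a * d) + (c * b) * (c * b) ≡ (a * a) * (d * d) + (b * b) * (c * c)
  rearrange′ = solve-∀
  double : ∀ a b → a * b + b * a ≡ 2 * (a * b)
  double = solve-∀

∑²≤ : ∀ (xs : List I) (f : I → ℕ) → ∑ xs f * ∑ xs f ≤ length xs * (∑[ x ∈ xs ] f x * f x)
∑²≤ xs f = subst₂ _≤_ (cong₂ _*_ one one) (cong (_* (∑[ x ∈ xs ] f x * f x)) (sym (length≡∑1 xs)))
  (cauchySchwarz xs (λ _ → 1) f)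
  where
  one : (∑[ x ∈ xs ] 1 * f x) ≡ ∑ xs f
  one = ∑-cong xs (λ x → *-identityˡ (f x))

≰ᵇ⇒≥ : ∀ m n → (m ≤ᵇ n) ≡ false → n ≤ m
≰ᵇ⇒≥ m n eq = <⇒≤ (≰⇒> (λ le → subst T eq (≤⇒≤ᵇ le)))

-- Indicators and counting

⟦_⟧ : Bool → ℕ
⟦ true ⟧  = 1
⟦ false ⟧ = 0

⟦⟧≤1 : ∀ b → ⟦ b ⟧ ≤ 1
⟦⟧≤1 true  = ≤-refl
⟦⟧≤1 false = z≤n

⟦⟧*⟦⟧ : ∀ b → ⟦ b ⟧ * ⟦ b ⟧ ≡ ⟦ b ⟧
⟦⟧*⟦⟧ true  = refl
⟦⟧*⟦⟧ false = refl

⟦⟧*≤ : ∀ b n → ⟦ b ⟧ * n ≤ n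
⟦⟧*≤ true  n = ≤-reflexive (+-identityʳ n)
⟦⟧*≤ false n = z≤n

⟦∧⟧ : ∀ a b → ⟦ a ∧ b ⟧ ≡ ⟦ a ⟧ * ⟦ b ⟧
⟦∧⟧ true  b = sym (+-identityʳ ⟦ b ⟧)
⟦∧⟧ false b = refl

T⇒⟦⟧≡1 : ∀ {b} → T b → ⟦ b ⟧ ≡ 1
T⇒⟦⟧≡1 {true} _ = refl

⟦⟧*-≤ : ∀ b {m n} → (T b → m ≤ n) → ⟦ b ⟧ * m ≤ n
⟦⟧*-≤ true  {m} h = ≤-trans (≤-reflexive (+-identityʳ m)) (h _)
⟦⟧*-≤ false     h = z≤n

⟦⟧*-monoʳ : ∀ b {m n} → (T b → m ≤ n) → ⟦ b ⟧ * m ≤ ⟦ b ⟧ * n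
⟦⟧*-monoʳ true  h = *-monoʳ-≤ 1 (h _)
⟦⟧*-monoʳ false h = z≤n

⟦⟧-mono : ∀ {a b} → (T a → T b) → ⟦ a ⟧ ≤ ⟦ b ⟧
⟦⟧-mono {true} {true}  h = ≤-refl
⟦⟧-mono {true} {false} h with () ← h _
⟦⟧-mono {false}        h = z≤n

∑-filter : ∀ {P : I → Set} (P? : Decidable P) xs f → ∑ (filter P? xs) f ≡ (∑[ x ∈ xs ] ⟦ does (P? x) ⟧ * f x)
∑-filter P? []       f = refl
∑-filter P? (x ∷ xs) f with does (P? x)
... | true  = cong₂ _+_ (sym (+-identityʳ (f x))) (∑-filter P? xs f)
... | false = ∑-filter P? xs f

length-filter : ∀ {P : I → Set} (P? : Decidable P) xs → length (filter P? xs) ≡ (∑[ x ∈ xs ] ⟦ does (P? x) ⟧)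
length-filter P? xs = trans (length≡∑1 (filter P? xs))
  (trans (∑-filter P? xs (λ _ → 1)) (∑-cong xs λ x → *-identityʳ ⟦ does (P? x) ⟧))

∑-filterᵇ : ∀ (p : I → Bool) xs f → ∑ (filterᵇ p xs) f ≡ (∑[ x ∈ xs ] ⟦ p x ⟧ * f x)
∑-filterᵇ p = ∑-filter (T? ∘ p)

length-filterᵇ : ∀ (p : I → Bool) xs → length (filterᵇ p xs) ≡ (∑[ x ∈ xs ] ⟦ p x ⟧)
length-filterᵇ p = length-filter (T? ∘ p)

-- Double counting in the form used throughout: if every element of S has at least M
-- representations, then |S| M is at most the number of all representations.
count*≤∑ : ∀ (xs : List I) (S : I → Bool) {W : I → ℕ} {M} → (∀ x → T (S x) → M ≤ W x) →
           (∑[ x ∈ xs ] ⟦ S x ⟧) * M ≤ ∑ xs W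
count*≤∑ xs S {W} {M} h = subst (_≤ ∑ xs W) (∑-*ʳ xs M (⟦_⟧ ∘ S))
  (∑-mono′ xs λ x → ⟦⟧*-≤ (S x) (h x))

∑-allFin : ∀ {n} (f : Fin n → ℕ) → ∑ (allFin n) f ≡ sumᶠ f
∑-allFin f = ∑-tabulate id f
  where
  ∑-tabulate : ∀ {n} (g : Fin n → I) f → ∑ (tabulate g) f ≡ sumᶠ (f ∘ g)
  ∑-tabulate {n = zero}  g f = refl
  ∑-tabulate {n = suc n} g f = cong (f (g zero) +_) (∑-tabulate (g ∘ suc) f)

∑-delta : ∀ {n} (i : Fin n) → (∑[ j ∈ allFin n ] ⟦ does (i ≟ᶠ j) ⟧) ≡ 1
∑-delta i = trans (∑-allFin (λ j → ⟦ does (i ≟ᶠ j) ⟧)) (delta i)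
  where
  delta : ∀ {n} (i : Fin n) → sumᶠ (λ j → ⟦ does (i ≟ᶠ j) ⟧) ≡ 1
  delta {suc n} zero    = cong suc (trans (sym (∑-allFin {n} (λ _ → 0))) (∑-zero (allFin n)))
  delta {suc n} (suc i) = delta i

∑-reindex : ∀ {n} (π π⁻¹ : Fin n → Fin n) → (∀ x → π (π⁻¹ x) ≡ x) → (∀ x → π⁻¹ (π x) ≡ x) →
            ∀ (f : Fin n → ℕ) → ∑ (allFin n) (f ∘ π) ≡ ∑ (allFin n) f
∑-reindex π π⁻¹ ππ⁻¹ π⁻¹π f = trans (∑-allFin (f ∘ π)) (trans
  (sym (sum-permute f (permutation π π⁻¹ (λ x → ππ⁻¹ x) (λ x → π⁻¹π x)))) (sym (∑-allFin f)))

-- Dependent random choice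

T-∧⁻ : ∀ {a b} → T (a ∧ b) → T a × T b
T-∧⁻ = Equivalence.to T-∧

T-∧⁺ : ∀ {a b} → T a → T b → T (a ∧ b)
T-∧⁺ p q = Equivalence.from T-∧ (p , q)

square-cancel-≤ : ∀ m n → m * m ≤ n * n → m ≤ n
square-cancel-≤ m n h with m ≤? n
... | yes m≤n = m≤n
... | no  m≰n = ⊥-elim (<⇒≱ (*-mono-< (≰⇒> m≰n) (≰⇒> m≰n)) h)

private
  -- Markov's inequality at a single vertex: either its number β of bad partners is at most δ/4 and
  -- the vertex is kept, or δ ≤ 4 β. Summation bounds the removed vertices by the bad pairs.
  keep : ∀ x δ β → δ * ⟦ x ⟧ ≤ δ * ⟦ x ∧ (β * 4 ≤ᵇ δ) ⟧ + ⟦ x ⟧ * β * 4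
  keep false δ β = ≤-trans (≤-reflexive (*-zeroʳ δ)) z≤n
  keep true  δ β with β * 4 ≤ᵇ δ in eq
  ... | true  = m≤m+n _ _
  ... | false = begin
    δ * 1                    ≡⟨ *-identityʳ δ ⟩
    δ                        ≤⟨ ≰ᵇ⇒≥ _ _ eq ⟩
    β * 4                    ≡⟨ cong (_* 4) (+-identityʳ β) ⟨
    1 * β * 4                ≤⟨ m≤n+m _ (δ * 0) ⟩
    δ * 0 + 1 * β * 4        ∎

  cancel : ∀ m n → m * m ≤ m * n → m ≤ n
  cancel zero    n h = z≤n
  cancel (suc m) n h = *-cancelˡ-≤ (suc m) h

-- The graph `g` joins Ω to V and has density at least 1/k. The random choice is a vertex ω of Ω,
-- and B will be most of its neighbourhood: a pair with few common neighbours is unlikely to be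
-- adjacent to ω.
module DependentChoice {I J : Set} (Ω : List I) (V : List J) (g : I → J → Bool) (a : J → Bool)
  (g⊆a : ∀ {ω b} → T (g ω b) → T (a b)) (k : ℕ) where

  N n : ℕ
  N = length Ω
  n = ∑[ b ∈ V ] ⟦ a b ⟧

  degree : J → ℕ
  degree b = ∑[ ω ∈ Ω ] ⟦ g ω b ⟧

  codegree : J → J → ℕ
  codegree b b′ = ∑[ ω ∈ Ω ] ⟦ g ω b ⟧ * ⟦ g ω b′ ⟧

  opaque
    -- A pair is bad when its codegree is below N / t. With t = 128 k² at most 1/16 of the pairs in
    -- the chosen neighbourhood are bad, which leaves at least half of its vertices with at most a
    -- quarter of bad partners.
    t : ℕ
    t = k * k * 8 * 16

    t≡ : t ≡ k * k * 8 * 16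
    t≡ = refl

  private
    g≤a : ∀ ω b → ⟦ g ω b ⟧ ≤ ⟦ a b ⟧
    g≤a ω b = ⟦⟧-mono g⊆a

    popular : J → Bool
    popular b = N ≤ᵇ k * 2 * degree b

    h : I → J → Bool
    h ω b = g ω b ∧ popular b

    bad : J → J → Bool
    bad b b′ = not (N ≤ᵇ t * codegree b b′)

    d : I → ℕ
    d ω = ∑[ b ∈ V ] ⟦ h ω b ⟧

    badPairs : I → ℕ
    badPairs ω = ∑[ b ∈ V ] ∑[ b′ ∈ V ] ⟦ h ω b ⟧ * (⟦ h ω b′ ⟧ * ⟦ bad b b′ ⟧)

    degree≤ : ∀ b → degree b ≤ ⟦ a b ⟧ * N
    degree≤ b = begin
      degree b                 ≤⟨ (∑-mono′ Ω λ ω → g≤a ω b) ⟩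
      (∑[ _ ∈ Ω ] ⟦ a b ⟧)     ≡⟨ ∑-const Ω ⟦ a b ⟧ ⟩
      N * ⟦ a b ⟧              ≡⟨ *-comm N ⟦ a b ⟧ ⟩
      ⟦ a b ⟧ * N              ∎

    -- Only vertices of `a` have neighbours, and the unpopular ones among them contribute at most N
    -- each after multiplication by 2 k. Hence they carry at most half of the edges.
    degree-split : ∀ b → k * 2 * degree b ≤ ⟦ a b ⟧ * N + k * 2 * (⟦ popular b ⟧ * degree b)
    degree-split b with popular b in eq
    ... | true  = ≤-trans (≤-reflexive (cong (k * 2 *_) (sym (+-identityʳ _)))) (m≤n+m _ (⟦ a b ⟧ * N))
    ... | false with a b in eq′
    ...   | true  = ≤-trans (≰ᵇ⇒≥ _ _ eq) (≤-trans (≤-reflexive (sym (+-identityʳ N))) (m≤m+n _ _))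
    ...   | false = ≤-trans (≤-reflexive (trans (cong (k * 2 *_) (n≤0⇒n≡0 (subst (λ c → degree b ≤ ⟦ c ⟧ * N) eq′ (degree≤ b)))) (*-zeroʳ (k * 2)))) z≤n

    ∑d≡ : ∑ Ω d ≡ (∑[ b ∈ V ] ⟦ popular b ⟧ * degree b)
    ∑d≡ = begin-equality
      ∑ Ω d                                                  ≡⟨ ∑-comm Ω V _ ⟩
      (∑[ b ∈ V ] ∑[ ω ∈ Ω ] ⟦ h ω b ⟧)                      ≡⟨ (∑-cong V λ b → trans
        (∑-cong Ω λ ω → trans (⟦∧⟧ (g ω b) (popular b)) (*-comm ⟦ g ω b ⟧ _)) (∑-*ˡ Ω ⟦ popular b ⟧ _)) ⟩
      (∑[ b ∈ V ] ⟦ popular b ⟧ * degree b)                  ∎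

    double : ∀ x y → x * y + y * x ≡ y * x * 2
    double = solve-∀

  module _ (N>0 : 0 < N) (k>0 : 0 < k)
           (dense : N * n ≤ k * (∑[ ω ∈ Ω ] ∑[ b ∈ V ] ⟦ g ω b ⟧)) where

    private
      instance
        _ = >-nonZero N>0
        _ = >-nonZero k>0
        _ = m*n≢0 k k
        _ = m*n≢0 (k * k) 8

      ∑d≥ : N * n ≤ k * 2 * ∑ Ω d
      ∑d≥ = +-cancelˡ-≤ (n * N) _ _ (begin
        n * N + N * n                                         ≡⟨ double n N ⟩
        N * n * 2                                             ≤⟨ *-monoˡ-≤ 2 dense ⟩
        k * (∑[ ω ∈ Ω ] ∑[ b ∈ V ] ⟦ g ω b ⟧) * 2             ≡⟨ cong (λ x → k * x * 2) (∑-comm Ω V _) ⟩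
        k * ∑ V degree * 2                                    ≡⟨ e k (∑ V degree) ⟩
        k * 2 * ∑ V degree                                    ≡⟨ ∑-*ˡ V (k * 2) degree ⟨
        (∑[ b ∈ V ] k * 2 * degree b)                         ≤⟨ ∑-mono′ V degree-split ⟩
        (∑[ b ∈ V ] (⟦ a b ⟧ * N + k * 2 * (⟦ popular b ⟧ * degree b)))
          ≡⟨ trans (∑-+ V _ _) (cong₂ _+_ (∑-*ʳ V N _) (∑-*ˡ V (k * 2) _)) ⟩
        n * N + k * 2 * (∑[ b ∈ V ] ⟦ popular b ⟧ * degree b) ≡⟨ cong (λ x → n * N + k * 2 * x) ∑d≡ ⟨
        n * N + k * 2 * ∑ Ω d                                 ∎)
        where
        e : ∀ k s → k * s * 2 ≡ k * 2 * s
        e = solve-∀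

      ∑d²≥ : N * (n * n) ≤ k * k * 4 * (∑[ ω ∈ Ω ] d ω * d ω)
      ∑d²≥ = *-cancelˡ-≤ N (begin
        N * (N * (n * n))                  ≡⟨ e₁ N n ⟩
        (N * n) * (N * n)                  ≤⟨ *-mono-≤ ∑d≥ ∑d≥ ⟩
        (k * 2 * ∑ Ω d) * (k * 2 * ∑ Ω d)  ≡⟨ e₂ k (∑ Ω d) ⟩
        k * k * 4 * (∑ Ω d * ∑ Ω d)        ≤⟨ *-monoʳ-≤ (k * k * 4) (∑²≤ Ω d) ⟩
        k * k * 4 * (N * D)                ≡⟨ e₃ (k * k * 4) N D ⟩
        N * (k * k * 4 * D)                ∎)
        where
        D : ℕ
        D = ∑[ ω ∈ Ω ] d ω * d ω
        e₁ : ∀ N n → N * (N * (n * n)) ≡ (N * n) * (N * n)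
        e₁ = solve-∀
        e₂ : ∀ k s → (k * 2 * s) * (k * 2 * s) ≡ k * k * 4 * (s * s)
        e₂ = solve-∀
        e₃ : ∀ k N s → k * (N * s) ≡ N * (k * s)
        e₃ = solve-∀

      -- A pair is counted once for each ω adjacent to both vertices, so a bad one is counted fewer
      -- than N / t times. The factors for `a` leave at most n² pairs.
      bad-bound : ∀ b b′ → t * (∑[ ω ∈ Ω ] ⟦ h ω b ⟧ * (⟦ h ω b′ ⟧ * ⟦ bad b b′ ⟧)) ≤ ⟦ a b ⟧ * (⟦ a b′ ⟧ * N)
      bad-bound b b′ with N ≤ᵇ t * codegree b b′ in eq
      ... | true  = ≤-trans (≤-reflexive (trans (cong (t *_) (trans
        (∑-cong Ω λ ω → trans (cong (⟦ h ω b ⟧ *_) (*-zeroʳ ⟦ h ω b′ ⟧)) (*-zeroʳ ⟦ h ω b ⟧)) (∑-zero Ω))) (*-zeroʳ t))) z≤n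
      ... | false = begin
        t * (∑[ ω ∈ Ω ] ⟦ h ω b ⟧ * (⟦ h ω b′ ⟧ * 1))                                ≤⟨ *-monoʳ-≤ t (∑-mono′ Ω λ ω →
            *-mono-≤ (h≤ ω b) (≤-trans (≤-reflexive (*-identityʳ _)) (h≤ ω b′))) ⟩
        t * (∑[ ω ∈ Ω ] (⟦ a b ⟧ * ⟦ g ω b ⟧) * (⟦ a b′ ⟧ * ⟦ g ω b′ ⟧))              ≡⟨ cong (t *_) (trans
            (∑-cong Ω λ ω → e₁ ⟦ a b ⟧ ⟦ g ω b ⟧ ⟦ a b′ ⟧ ⟦ g ω b′ ⟧) (∑-*ˡ Ω (⟦ a b ⟧ * ⟦ a b′ ⟧) _)) ⟩
        t * ((⟦ a b ⟧ * ⟦ a b′ ⟧) * codegree b b′)                                   ≡⟨ e₂ t ⟦ a b ⟧ ⟦ a b′ ⟧ _ ⟩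
        ⟦ a b ⟧ * (⟦ a b′ ⟧ * (t * codegree b b′))                                   ≤⟨ *-monoʳ-≤ ⟦ a b ⟧ (*-monoʳ-≤ ⟦ a b′ ⟧ (≰ᵇ⇒≥ _ _ eq)) ⟩
        ⟦ a b ⟧ * (⟦ a b′ ⟧ * N)                                                     ∎
        where
        h≤ : ∀ ω b → ⟦ h ω b ⟧ ≤ ⟦ a b ⟧ * ⟦ g ω b ⟧
        h≤ ω b = subst (⟦ h ω b ⟧ ≤_) (⟦∧⟧ (a b) (g ω b)) (⟦⟧-mono λ p → T-∧⁺ (g⊆a (proj₁ (T-∧⁻ p))) (proj₁ (T-∧⁻ p)))
        e₁ : ∀ a b c d → (a * b) * (c * d) ≡ (a * c) * (b * d)
        e₁ = solve-∀
        e₂ : ∀ t a b c → t * ((a * b) * c) ≡ a * (b * (t * c))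
        e₂ = solve-∀

      ∑bad≤ : t * ∑ Ω badPairs ≤ N * (n * n)
      ∑bad≤ = begin
        t * ∑ Ω badPairs
          ≡⟨ cong (t *_) (trans (∑-comm Ω V _) (∑-cong V λ b → ∑-comm Ω V _)) ⟩
        t * (∑[ b ∈ V ] ∑[ b′ ∈ V ] ∑[ ω ∈ Ω ] ⟦ h ω b ⟧ * (⟦ h ω b′ ⟧ * ⟦ bad b b′ ⟧))
          ≡⟨ trans (∑-cong V λ b → ∑-*ˡ V t _) (∑-*ˡ V t _) ⟨
        (∑[ b ∈ V ] ∑[ b′ ∈ V ] t * (∑[ ω ∈ Ω ] ⟦ h ω b ⟧ * (⟦ h ω b′ ⟧ * ⟦ bad b b′ ⟧)))
          ≤⟨ (∑-mono′ V λ b → ∑-mono′ V λ b′ → bad-bound b b′) ⟩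
        (∑[ b ∈ V ] ∑[ b′ ∈ V ] ⟦ a b ⟧ * (⟦ a b′ ⟧ * N))
          ≡⟨ ∑-* V V _ _ ⟨
        n * (∑[ b′ ∈ V ] ⟦ a b′ ⟧ * N)
          ≡⟨ cong (n *_) (∑-*ʳ V N _) ⟩
        n * (n * N)
          ≡⟨ e n N ⟩
        N * (n * n) ∎
        where
        e : ∀ n N → n * (n * N) ≡ N * (n * n)
        e = solve-∀

      -- One averaged inequality combines both requirements. Its two summands on the left show, for
      -- the same ω, that the neighbourhood is large and that it contains few bad pairs.
      chosen : ∃ λ ω → t * badPairs ω + n * n ≤ k * k * 8 * (d ω * d ω)
      chosen = let ω , _ , le = ∑-average Ω N>0 total in ω , le
        where
        e₁ : ∀ x → x + x ≡ x * 2
        e₁ = solve-∀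
        e₂ : ∀ k s → k * 4 * s * 2 ≡ k * 8 * s
        e₂ = solve-∀
        total : (∑[ ω ∈ Ω ] (t * badPairs ω + n * n)) ≤ (∑[ ω ∈ Ω ] k * k * 8 * (d ω * d ω))
        total = begin
          (∑[ ω ∈ Ω ] (t * badPairs ω + n * n))             ≡⟨ trans (∑-+ Ω _ _) (cong₂ _+_ (∑-*ˡ Ω t _) (∑-const Ω (n * n))) ⟩
          t * ∑ Ω badPairs + N * (n * n)                    ≤⟨ +-monoˡ-≤ (N * (n * n)) ∑bad≤ ⟩
          N * (n * n) + N * (n * n)                         ≡⟨ e₁ (N * (n * n)) ⟩
          N * (n * n) * 2                                   ≤⟨ *-monoˡ-≤ 2 ∑d²≥ ⟩
          k * k * 4 * (∑[ ω ∈ Ω ] d ω * d ω) * 2            ≡⟨ e₂ (k * k) _ ⟩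
          k * k * 8 * (∑[ ω ∈ Ω ] d ω * d ω)                ≡⟨ ∑-*ˡ Ω (k * k * 8) _ ⟨
          (∑[ ω ∈ Ω ] k * k * 8 * (d ω * d ω))              ∎

    module _ (ω₀ : I) (ω₀-good : t * badPairs ω₀ + n * n ≤ k * k * 8 * (d ω₀ * d ω₀)) where
      private
        δ : ℕ
        δ = d ω₀

        n≤3kδ : n ≤ k * 3 * δ
        n≤3kδ = square-cancel-≤ n (k * 3 * δ) (begin
          n * n                          ≤⟨ m≤n+m (n * n) (t * badPairs ω₀) ⟩
          t * badPairs ω₀ + n * n        ≤⟨ ω₀-good ⟩
          -- The constant 8 is enlarged to the perfect square 9 in order to take roots.
          k * k * 8 * (δ * δ)            ≤⟨ *-monoˡ-≤ (δ * δ) (*-monoʳ-≤ (k * k) (n≤1+n 8)) ⟩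
          k * k * 9 * (δ * δ)            ≡⟨ e k δ ⟩
          (k * 3 * δ) * (k * 3 * δ)      ∎)
          where
          e : ∀ k d → k * k * 9 * (d * d) ≡ (k * 3 * d) * (k * 3 * d)
          e = solve-∀

        16bad≤δ² : badPairs ω₀ * 16 ≤ δ * δ
        16bad≤δ² = *-cancelˡ-≤ (k * k * 8) (begin
          k * k * 8 * (badPairs ω₀ * 16)      ≡⟨ e (k * k * 8) (badPairs ω₀) 16 ⟩
          k * k * 8 * 16 * badPairs ω₀        ≡⟨ cong (_* badPairs ω₀) t≡ ⟨
          t * badPairs ω₀                     ≤⟨ m≤m+n _ (n * n) ⟩
          t * badPairs ω₀ + n * n             ≤⟨ ω₀-good ⟩
          k * k * 8 * (δ * δ)                 ∎)
          where
          e : ∀ k s c → k * (s * c) ≡ k * c * s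
          e = solve-∀

        β : J → ℕ
        β b = ∑[ b′ ∈ V ] ⟦ h ω₀ b′ ⟧ * ⟦ bad b b′ ⟧

      B : J → Bool
      B b = h ω₀ b ∧ (β b * 4 ≤ᵇ δ)

      #B : ℕ
      #B = ∑[ b ∈ V ] ⟦ B b ⟧

      private
        δ≤2#B : δ ≤ #B * 2
        δ≤2#B = cancel δ (#B * 2) (*-cancelʳ-≤ (δ * δ) _ 2 (+-cancelˡ-≤ (δ * δ * 2) _ _ (begin
          δ * δ * 2 + δ * δ * 2                  ≡⟨ e₁ δ ⟩
          δ * δ * 4                              ≡⟨ cong (_* 4) (∑-*ˡ V δ _) ⟨
          (∑[ b ∈ V ] δ * ⟦ h ω₀ b ⟧) * 4        ≤⟨ *-monoˡ-≤ 4 (∑-mono′ V λ b → keep (h ω₀ b) δ (β b)) ⟩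
          (∑[ b ∈ V ] (δ * ⟦ B b ⟧ + ⟦ h ω₀ b ⟧ * β b * 4)) * 4
            ≡⟨ cong (_* 4) (trans (∑-+ V _ _) (cong₂ _+_ (∑-*ˡ V δ _) (trans (∑-*ʳ V 4 _)
                 (cong (_* 4) (∑-cong V λ b → sym (∑-*ˡ V ⟦ h ω₀ b ⟧ _)))))) ⟩
          (δ * #B + badPairs ω₀ * 4) * 4         ≡⟨ e₂ (δ * #B) (badPairs ω₀) ⟩
          badPairs ω₀ * 16 + δ * #B * 4          ≤⟨ +-monoˡ-≤ _ 16bad≤δ² ⟩
          δ * δ + δ * #B * 4                     ≤⟨ +-monoˡ-≤ _ (m≤m*n (δ * δ) 2) ⟩
          δ * δ * 2 + δ * #B * 4                 ≡⟨ cong (δ * δ * 2 +_) (e₃ δ #B) ⟩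
          δ * δ * 2 + δ * (#B * 2) * 2           ∎)))
          where
          e₁ : ∀ d → d * d * 2 + d * d * 2 ≡ d * d * 4
          e₁ = solve-∀
          e₂ : ∀ x y → (x + y * 4) * 4 ≡ y * 16 + x * 4
          e₂ = solve-∀
          e₃ : ∀ d y → d * y * 4 ≡ d * (y * 2) * 2
          e₃ = solve-∀

        good-split : ∀ x u v → ⟦ x ⟧ ≤ ⟦ x ⟧ * (⟦ not u ⟧ * ⟦ not v ⟧) + (⟦ x ⟧ * ⟦ u ⟧ + ⟦ x ⟧ * ⟦ v ⟧)
        good-split false u     v     = z≤n
        good-split true  true  v     = s≤s z≤n
        good-split true  false true  = ≤-refl
        good-split true  false false = ≤-refl

        good-bound : ∀ x b b′ → ⟦ x ⟧ * ⟦ not (bad b b′) ⟧ * N ≤ t * codegree b b′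
        good-bound x b b′ with N ≤ᵇ t * codegree b b′ in eq
        ... | true  = ≤-trans (*-monoˡ-≤ N (⟦⟧*≤ x 1)) (≤-trans (≤-reflexive (+-identityʳ N)) (≤ᵇ⇒≤ _ _ (subst T (sym eq) _)))
        ... | false = ≤-trans (≤-reflexive (cong (_* N) (*-zeroʳ ⟦ x ⟧))) z≤n

      B⊆a : ∀ {b} → T (B b) → T (a b)
      B⊆a {b} p = g⊆a (proj₁ (T-∧⁻ {g ω₀ b} (proj₁ (T-∧⁻ {h ω₀ b} p))))

      B-degree : ∀ {b} → T (B b) → N ≤ k * 2 * degree b
      B-degree {b} p = ≤ᵇ⇒≤ N (k * 2 * degree b) (proj₂ (T-∧⁻ {g ω₀ b} (proj₁ (T-∧⁻ {h ω₀ b} p))))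

      n≤6k#B : n ≤ k * 6 * #B
      n≤6k#B = begin
        n                  ≤⟨ n≤3kδ ⟩
        k * 3 * δ          ≤⟨ *-monoʳ-≤ (k * 3) δ≤2#B ⟩
        k * 3 * (#B * 2)   ≡⟨ e k #B ⟩
        k * 6 * #B         ∎
        where
        e : ∀ k b → k * 3 * (b * 2) ≡ k * 6 * b
        e = solve-∀

      -- Each of b and b′ has at most δ/4 bad partners in the chosen neighbourhood, so at least half
      -- of its vertices c are good for both. Every such c lies in the middle of (N / t)² or more
      -- paths of length four from b to b′.
      B-codegree : ∀ {b b′} → T (B b) → T (B b′) →
                   N * N * n ≤ k * 6 * (t * t) * (∑[ c ∈ V ] codegree b c * codegree b′ c)
      B-codegree {b} {b′} b∈B b′∈B = begin
        N * N * n                    ≤⟨ *-monoʳ-≤ (N * N) n≤3kδ ⟩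
        N * N * (k * 3 * δ)          ≤⟨ *-monoʳ-≤ (N * N) (*-monoʳ-≤ (k * 3) δ≤2G) ⟩
        N * N * (k * 3 * (G * 2))    ≡⟨ e₁ N k G ⟩
        k * 6 * (G * (N * N))        ≤⟨ *-monoʳ-≤ (k * 6) G≤ ⟩
        k * 6 * (t * t * S)          ≡⟨ *-assoc (k * 6) (t * t) S ⟨
        k * 6 * (t * t) * S          ∎
        where
        G S : ℕ
        G = ∑[ c ∈ V ] ⟦ h ω₀ c ⟧ * (⟦ not (bad b c) ⟧ * ⟦ not (bad b′ c) ⟧)
        S = ∑[ c ∈ V ] codegree b c * codegree b′ c
        e₁ : ∀ N k G → N * N * (k * 3 * (G * 2)) ≡ k * 6 * (G * (N * N))
        e₁ = solve-∀
        δ≤2G : δ ≤ G * 2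
        δ≤2G = *-cancelʳ-≤ δ _ 2 (+-cancelˡ-≤ (δ * 2) _ _ (begin
          δ * 2 + δ * 2              ≡⟨ e₂ δ ⟩
          δ * 4                      ≤⟨ *-monoˡ-≤ 4 (∑-mono′ V λ c → good-split (h ω₀ c) (bad b c) (bad b′ c)) ⟩
          (∑[ c ∈ V ] (⟦ h ω₀ c ⟧ * (⟦ not (bad b c) ⟧ * ⟦ not (bad b′ c) ⟧) + (⟦ h ω₀ c ⟧ * ⟦ bad b c ⟧ + ⟦ h ω₀ c ⟧ * ⟦ bad b′ c ⟧))) * 4
                                     ≡⟨ cong (_* 4) (trans (∑-+ V _ _) (cong (G +_) (∑-+ V _ _))) ⟩
          (G + (β b + β b′)) * 4     ≡⟨ e₃ G (β b) (β b′) ⟩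
          (β b * 4 + β b′ * 4) + G * 2 * 2 ≤⟨ +-monoˡ-≤ _ (+-mono-≤ (β≤ b∈B) (β≤ b′∈B)) ⟩
          (δ + δ) + G * 2 * 2        ≡⟨ cong (_+ G * 2 * 2) (e₄ δ) ⟩
          δ * 2 + G * 2 * 2          ∎))
          where
          β≤ : ∀ {b} → T (B b) → β b * 4 ≤ δ
          β≤ {b} p = ≤ᵇ⇒≤ (β b * 4) δ (proj₂ (T-∧⁻ {h ω₀ b} p))
          e₂ : ∀ d → d * 2 + d * 2 ≡ d * 4
          e₂ = solve-∀
          e₃ : ∀ g x y → (g + (x + y)) * 4 ≡ (x * 4 + y * 4) + g * 2 * 2
          e₃ = solve-∀
          e₄ : ∀ d → d + d ≡ d * 2
          e₄ = solve-∀
        G≤ : G * (N * N) ≤ t * t * S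
        G≤ = begin
          G * (N * N)                ≡⟨ ∑-*ʳ V (N * N) _ ⟨
          (∑[ c ∈ V ] ⟦ h ω₀ c ⟧ * (⟦ not (bad b c) ⟧ * ⟦ not (bad b′ c) ⟧) * (N * N))
            ≡⟨ (∑-cong V λ c → e₂ ⟦ h ω₀ c ⟧ ⟦ not (bad b c) ⟧ ⟦ not (bad b′ c) ⟧ N) ⟩
          (∑[ c ∈ V ] (⟦ h ω₀ c ⟧ * ⟦ not (bad b c) ⟧ * N) * (1 * ⟦ not (bad b′ c) ⟧ * N))
            ≤⟨ (∑-mono′ V λ c → *-mono-≤ (good-bound (h ω₀ c) b c) (good-bound true b′ c)) ⟩
          (∑[ c ∈ V ] (t * codegree b c) * (t * codegree b′ c))
            ≡⟨ trans (∑-cong V λ c → e₃ t (codegree b c) (codegree b′ c)) (∑-*ˡ V (t * t) _) ⟩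
          t * t * S                  ∎
          where
          e₂ : ∀ x u v N → x * (u * v) * (N * N) ≡ (x * u * N) * (1 * v * N)
          e₂ = solve-∀
          e₃ : ∀ t x y → (t * x) * (t * y) ≡ t * t * (x * y)
          e₃ = solve-∀

    -- The lower bound for degrees serves to count paths between elements of X, the one for
    -- codegrees to bound B - B.
    DenseSet : Set
    DenseSet = ∃ λ (B : J → Bool) →
      (∀ b → T (B b) → T (a b) × N ≤ k * 2 * degree b) ×
      n ≤ k * 6 * (∑[ b ∈ V ] ⟦ B b ⟧) ×
      (∀ b b′ → T (B b) → T (B b′) →
        N * N * n ≤ k * 6 * (t * t) * (∑[ c ∈ V ] codegree b c * codegree b′ c))

    dependentChoice : DenseSet
    dependentChoice = finish (proj₁ chosen) (proj₂ chosen)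
      where
      finish : ∀ ω → t * badPairs ω + n * n ≤ k * k * 8 * (d ω * d ω) → DenseSet
      finish ω good = B ω good , (λ b p → B⊆a ω good {b} p , B-degree ω good {b} p) , n≤6k#B ω good ,
        λ b b′ p p′ → B-codegree ω good {b} {b′} p p′

-- The field operations transported to the indices of the elements, so that
-- equality is propositional.
record IndexField (q : ℕ) : Set where
  infixl 7 _*ᶠ_
  infixl 6 _+ᶠ_ _-ᶠ_
  infix  8 ∼_
  field
    _+ᶠ_ _*ᶠ_         : Op₂ (Fin q)
    ∼_                : Op₁ (Fin q)
    0ᶠ 1ᶠ             : Fin q
    isCommutativeRing : IsCommutativeRing _≡_ _+ᶠ_ _*ᶠ_ ∼_ 0ᶠ 1ᶠ
    inverse           : ∀ x → x ≢ 0ᶠ → ∃ λ y → x *ᶠ y ≡ 1ᶠ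

  _-ᶠ_ : Op₂ (Fin q)
  x -ᶠ y = x +ᶠ ∼ y

  commutativeRing : CommutativeRing 0ℓ 0ℓ
  commutativeRing = record { isCommutativeRing = isCommutativeRing }

-- Counting in a finite field

module FieldCounting {q : ℕ} (𝔽 : IndexField q) where

  open IndexField 𝔽
  open DifferenceSolver commutativeRing
  open IsCommutativeRing isCommutativeRing public using () renaming (*-identityˡ to *ᶠ-identityˡ; zeroʳ to *ᶠ-zeroʳ)

  F : Set
  F = Fin q

  opaque
    U : List F
    U = allFin q

    U≡allFin : U ≡ allFin q
    U≡allFin = refl

    ∑-bijection : ∀ (π π⁻¹ : F → F) → (∀ x → π (π⁻¹ x) ≡ x) → (∀ x → π⁻¹ (π x) ≡ x) →
                  ∀ (f : F → ℕ) → ∑ U (f ∘ π) ≡ ∑ U f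
    ∑-bijection = ∑-reindex

    ∑-point : ∀ x → (∑[ y ∈ U ] ⟦ does (x ≟ᶠ y) ⟧) ≡ 1
    ∑-point = ∑-delta

  #_ : (F → Bool) → ℕ
  # S = ∑[ x ∈ U ] ⟦ S x ⟧

  infix 9 #_

  ∑-shift : ∀ t (f : F → ℕ) → (∑[ x ∈ U ] f (x +ᶠ t)) ≡ ∑ U f
  ∑-shift t = ∑-bijection (_+ᶠ t) (_-ᶠ t)
    (solve 2 (λ t x → (x :- t) :+ t := x) refl t)
    (solve 2 (λ t x → (x :+ t) :- t := x) refl t)

  ∑-reflect : ∀ t (f : F → ℕ) → (∑[ x ∈ U ] f (t -ᶠ x)) ≡ ∑ U f
  ∑-reflect t = ∑-bijection (t -ᶠ_) (t -ᶠ_)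
    (solve 2 (λ t x → t :- (t :- x) := x) refl t)
    (solve 2 (λ t x → t :- (t :- x) := x) refl t)

  ∑-dilate : ∀ {c} → c ≢ 0ᶠ → ∀ (f : F → ℕ) → (∑[ x ∈ U ] f (c *ᶠ x)) ≡ ∑ U f
  ∑-dilate {c} c≢0 = let c⁻¹ , cc⁻¹≡1 = inverse c c≢0 in ∑-bijection (c *ᶠ_) (c⁻¹ *ᶠ_)
    (λ x → trans (solve 3 (λ c d x → c :* (d :* x) := (c :* d) :* x) refl c c⁻¹ x)
      (trans (cong (_*ᶠ x) cc⁻¹≡1) (*ᶠ-identityˡ x)))
    (λ x → trans (solve 3 (λ c d x → d :* (c :* x) := (c :* d) :* x) refl c c⁻¹ x)
      (trans (cong (_*ᶠ x) cc⁻¹≡1) (*ᶠ-identityˡ x)))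

  -- Counts s = b′ - x b with b, b′ ∈ B; solving for b′ leaves one variable of summation.
  reps : (F → Bool) → F → F → ℕ
  reps B x s = ∑[ b ∈ U ] ⟦ B b ⟧ * ⟦ B (s +ᶠ x *ᶠ b) ⟧

  -- The number of solutions of b′ − x b = c − x d in B, with b′ eliminated.
  energy : (F → Bool) → F → ℕ
  energy B x = ∑[ c ∈ U ] ∑[ d ∈ U ] ⟦ B c ⟧ * (⟦ B d ⟧ * (∑[ b ∈ U ] ⟦ B b ⟧ * ⟦ B (c +ᶠ x *ᶠ (b -ᶠ d)) ⟧))

  ∑reps : ∀ B x → ∑ U (reps B x) ≡ # B * # B
  ∑reps B x = begin-equality
    (∑[ s ∈ U ] ∑[ b ∈ U ] ⟦ B b ⟧ * ⟦ B (s +ᶠ x *ᶠ b) ⟧)   ≡⟨ ∑-comm U U _ ⟩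
    (∑[ b ∈ U ] ∑[ s ∈ U ] ⟦ B b ⟧ * ⟦ B (s +ᶠ x *ᶠ b) ⟧)   ≡⟨ (∑-cong U λ b → trans (∑-*ˡ U ⟦ B b ⟧ _)
                                                                  (cong (⟦ B b ⟧ *_) (∑-shift (x *ᶠ b) (⟦_⟧ ∘ B)))) ⟩
    (∑[ b ∈ U ] ⟦ B b ⟧ * # B)                              ≡⟨ ∑-*ʳ U (# B) _ ⟩
    # B * # B                                               ∎

  reps≤# : ∀ B x s → reps B x s ≤ # B
  reps≤# B x s = ∑-mono′ U λ b → ≤-trans (*-monoʳ-≤ ⟦ B b ⟧ (⟦⟧≤1 _)) (≤-reflexive (*-identityʳ _))

  -- The square counts two representations s = c - x d = b′ - x b. Shifting s by x d replaces it by
  -- c as variable of summation.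
  ∑reps² : ∀ B x → (∑[ s ∈ U ] reps B x s * reps B x s) ≡ energy B x
  ∑reps² B x = begin-equality
    (∑[ s ∈ U ] reps B x s * reps B x s)
      ≡⟨ (∑-cong U λ s → ∑-* U U _ _) ⟩
    (∑[ s ∈ U ] ∑[ d ∈ U ] ∑[ b ∈ U ] (⟦ B d ⟧ * ⟦ B (s +ᶠ x *ᶠ d) ⟧) * (⟦ B b ⟧ * ⟦ B (s +ᶠ x *ᶠ b) ⟧))
      ≡⟨ ∑-comm U U _ ⟩
    (∑[ d ∈ U ] ∑[ s ∈ U ] ∑[ b ∈ U ] (⟦ B d ⟧ * ⟦ B (s +ᶠ x *ᶠ d) ⟧) * (⟦ B b ⟧ * ⟦ B (s +ᶠ x *ᶠ b) ⟧))
      ≡⟨ (∑-cong U λ d → trans (sym (∑-shift (∼ (x *ᶠ d)) _)) (∑-cong U λ c → move d c)) ⟩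
    (∑[ d ∈ U ] ∑[ c ∈ U ] ⟦ B c ⟧ * (⟦ B d ⟧ * (∑[ b ∈ U ] ⟦ B b ⟧ * ⟦ B (c +ᶠ x *ᶠ (b -ᶠ d)) ⟧)))
      ≡⟨ ∑-comm U U _ ⟩
    energy B x ∎
    where
    rearrange : ∀ m n o → (m * n) * o ≡ n * (m * o)
    rearrange = solve-∀
    move : ∀ d c → (∑[ b ∈ U ] (⟦ B d ⟧ * ⟦ B ((c -ᶠ x *ᶠ d) +ᶠ x *ᶠ d) ⟧) * (⟦ B b ⟧ * ⟦ B ((c -ᶠ x *ᶠ d) +ᶠ x *ᶠ b) ⟧))
                 ≡ ⟦ B c ⟧ * (⟦ B d ⟧ * (∑[ b ∈ U ] ⟦ B b ⟧ * ⟦ B (c +ᶠ x *ᶠ (b -ᶠ d)) ⟧))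
    move d c = trans (∑-*ˡ U (⟦ B d ⟧ * ⟦ B ((c -ᶠ x *ᶠ d) +ᶠ x *ᶠ d) ⟧) _) (trans (rearrange ⟦ B d ⟧ _ _)
      (cong₂ (λ y z → ⟦ B y ⟧ * (⟦ B d ⟧ * z)) (solve 2 (λ c z → (c :- z) :+ z := c) refl c (x *ᶠ d))
        (∑-cong U λ b → cong (λ y → ⟦ B b ⟧ * ⟦ B y ⟧)
          (solve 4 (λ b c d x → (c :- x :* d) :+ x :* b := c :+ x :* (b :- d)) refl b c d x))))

  opaque
    image : (F → F → F) → (F → Bool) → (F → Bool) → F → Bool
    image f S S′ y = isYes (any? λ b → any? λ c → T? (S b) ×-dec (T? (S′ c) ×-dec (f b c ≟ᶠ y)))

    image⁻ : ∀ {f S S′ y} → T (image f S S′ y) → ∃ λ b → ∃ λ c → T (S b) × T (S′ c) × f b c ≡ y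
    image⁻ = toWitness

    image⁺ : ∀ {f S S′ b c} → T (S b) → T (S′ c) → T (image f S S′ (f b c))
    image⁺ {b = b} {c} p p′ = fromWitness (b , c , p , p′ , refl)

  diff : F → (F → Bool) → F → Bool
  diff x B = image (λ b c → b -ᶠ x *ᶠ c) B B

  reps-support : ∀ B x s → reps B x s ≡ ⟦ diff x B s ⟧ * reps B x s
  reps-support B x s with diff x B s in eq
  ... | true  = sym (+-identityʳ _)
  ... | false = n≤0⇒n≡0 (≤-trans (∑-mono′ U none) (≤-reflexive (∑-zero U)))
    where
    none : ∀ b → ⟦ B b ⟧ * ⟦ B (s +ᶠ x *ᶠ b) ⟧ ≤ 0
    none b with B b in eqb | B (s +ᶠ x *ᶠ b) in eqc
    ... | false | _     = z≤n
    ... | true  | false = z≤n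
    ... | true  | true  = ⊥-elim (subst T (trans (cong (diff x B) (solve 2 (λ s z → (s :+ z) :- z := s) refl s (x *ᶠ b))) eq)
            (image⁺ {λ b c → b -ᶠ x *ᶠ c} {B} {B} (subst T (sym eqc) _) (subst T (sym eqb) _)))

  -- Cauchy-Schwarz for `reps`: its sum is |B|², its support lies in B - x B, and its second moment
  -- is the energy.
  #⁴≤ : ∀ B x → # B * # B * (# B * # B) ≤ # (diff x B) * energy B x
  #⁴≤ B x = begin
    # B * # B * (# B * # B)          ≡⟨ cong (λ s → s * s) (trans (sym (∑reps B x)) (∑-cong U (reps-support B x))) ⟩
    S * S                            ≤⟨ cauchySchwarz U (⟦_⟧ ∘ diff x B) (reps B x) ⟩
    (∑[ s ∈ U ] ⟦ diff x B s ⟧ * ⟦ diff x B s ⟧) * (∑[ s ∈ U ] reps B x s * reps B x s)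
                                     ≡⟨ cong₂ _*_ (∑-cong U λ s → ⟦⟧*⟦⟧ (diff x B s)) (∑reps² B x) ⟩
    # (diff x B) * energy B x        ∎
    where
    S : ℕ
    S = ∑[ s ∈ U ] ⟦ diff x B s ⟧ * reps B x s

∈-filterᵇ⁻ : ∀ {I : Set} (p : I → Bool) xs {x} → x List.∈ filterᵇ p xs → T (p x)
∈-filterᵇ⁻ p xs x∈ = proj₂ (∈-filter⁻ (T? ∘ p) {xs = xs} x∈)

-- Popular differences and common dilates

module PopularDifferences {q : ℕ} (𝔽 : IndexField q) (a : Fin q → Bool) (K : ℕ) where

  open IndexField 𝔽
  open FieldCounting 𝔽

  n k : ℕ
  n = # a
  k = K * 2

  popular : F → F → Bool
  popular ξ s = n ≤ᵇ k * reps a ξ s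

  module _ (n>0 : 0 < n) where

    private
      instance
        _ = >-nonZero n>0

    -- There are n² representations in all, and each popular element uses up at least n / k of them.
    #popular≤ : ∀ ξ → # (popular ξ) ≤ k * n
    #popular≤ ξ = *-cancelʳ-≤ _ _ n (begin
      # (popular ξ) * n               ≤⟨ count*≤∑ U (popular ξ) (λ s → ≤ᵇ⇒≤ n _) ⟩
      (∑[ s ∈ U ] k * reps a ξ s)     ≡⟨ trans (∑-*ˡ U k _) (cong (k *_) (∑reps a ξ)) ⟩
      k * (n * n)                     ≡⟨ *-assoc k n n ⟨
      k * n * n                       ∎)

    -- As k = 2 K, the unpopular elements carry at most half of the least possible energy n³ / K. On
    -- the popular ones a factor `reps` ≤ n is taken out of the second moment, which leaves a number
    -- of pairs.
    popularPairs : ∀ ξ → n * n * n ≤ K * energy a ξ → n * n ≤ k * (∑[ s ∈ U ] ⟦ popular ξ s ⟧ * reps a ξ s)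
    popularPairs ξ energetic = *-cancelˡ-≤ n (+-cancelˡ-≤ (n * (n * n)) _ _ (begin
      n * (n * n) + n * (n * n)       ≡⟨ e₁ n ⟩
      n * n * n * 2                   ≤⟨ *-monoˡ-≤ 2 energetic ⟩
      K * energy a ξ * 2              ≡⟨ e₂ K (energy a ξ) ⟩
      k * energy a ξ                  ≡⟨ cong (k *_) (∑reps² a ξ) ⟨
      k * (∑[ s ∈ U ] reps a ξ s * reps a ξ s)
                                      ≡⟨ ∑-*ˡ U k _ ⟨
      (∑[ s ∈ U ] k * (reps a ξ s * reps a ξ s))
                                      ≤⟨ ∑-mono′ U split ⟩
      (∑[ s ∈ U ] (n * reps a ξ s + n * (k * (⟦ popular ξ s ⟧ * reps a ξ s))))
                                      ≡⟨ trans (∑-+ U _ _) (cong₂ _+_ (trans (∑-*ˡ U n _) (cong (n *_) (∑reps a ξ)))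
                                           (trans (∑-*ˡ U n _) (cong (n *_) (∑-*ˡ U k _)))) ⟩
      n * (n * n) + n * (k * (∑[ s ∈ U ] ⟦ popular ξ s ⟧ * reps a ξ s)) ∎))
      where
      e₁ : ∀ n → n * (n * n) + n * (n * n) ≡ n * n * n * 2
      e₁ = solve-∀
      e₂ : ∀ K e → K * e * 2 ≡ K * 2 * e
      e₂ = solve-∀
      e₃ : ∀ k r → k * (r * r) ≡ k * r * r
      e₃ = solve-∀
      e₄ : ∀ k n r → k * (r * n) ≡ n * (k * (1 * r))
      e₄ = solve-∀
      split : ∀ s → k * (reps a ξ s * reps a ξ s) ≤ n * reps a ξ s + n * (k * (⟦ popular ξ s ⟧ * reps a ξ s))
      split s with n ≤ᵇ k * reps a ξ s in eq
      ... | true  = ≤-trans (*-monoʳ-≤ k (*-monoʳ-≤ (reps a ξ s) (reps≤# a ξ s)))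
                      (≤-trans (≤-reflexive (e₄ k n (reps a ξ s))) (m≤n+m _ _))
      ... | false = ≤-trans (≤-reflexive (e₃ k (reps a ξ s)))
                      (≤-trans (*-monoˡ-≤ (reps a ξ s) (≰ᵇ⇒≥ n (k * reps a ξ s) eq)) (m≤m+n (n * reps a ξ s) _))

module DenseDifferences {q : ℕ} (𝔽 : IndexField q) (a X : Fin q → Bool) (K : ℕ) where

  open IndexField 𝔽
  open DifferenceSolver commutativeRing
  open FieldCounting 𝔽
  open PopularDifferences 𝔽 a K

  x : ℕ
  x = # X

  xs as : List F
  xs = filterᵇ X U
  as = filterᵇ a U

  length-xs : length xs ≡ x
  length-xs = length-filterᵇ X U

  length-as : length as ≡ n
  length-as = length-filterᵇ a U

  Ω : List (F × F)
  Ω = cartesianProduct xs as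

  edge : F × F → F → Bool
  edge (ξ , c) b = a b ∧ popular ξ (c -ᶠ ξ *ᶠ b)

  edge⊆a : ∀ {ω b} → T (edge ω b) → T (a b)
  edge⊆a {b = b} p = proj₁ (T-∧⁻ {a b} p)

  edge≤popular : ∀ ξ c b → ⟦ edge (ξ , c) b ⟧ ≤ ⟦ popular ξ (c -ᶠ ξ *ᶠ b) ⟧
  edge≤popular ξ c b = ⟦⟧-mono (λ p → proj₂ (T-∧⁻ {a b} p))

  open DependentChoice Ω U edge a (λ {ω} {b} → edge⊆a {ω} {b}) k using (N; degree; codegree; t; DenseSet; dependentChoice)

  N≡ : N ≡ x * n
  N≡ = trans (length-cartesianProduct xs as) (cong₂ _*_ length-xs length-as)

  ∑-as≤ : ∀ f → ∑ as f ≤ ∑ U f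
  ∑-as≤ f = ≤-trans (≤-reflexive (∑-filterᵇ a U f)) (∑-mono′ U λ c → ⟦⟧*≤ (a c) (f c))

  edges : ∀ ξ → (∑[ c ∈ as ] ∑[ b ∈ U ] ⟦ edge (ξ , c) b ⟧) ≡ (∑[ s ∈ U ] ⟦ popular ξ s ⟧ * reps a ξ s)
  edges ξ = begin-equality
    (∑[ c ∈ as ] ∑[ b ∈ U ] ⟦ edge (ξ , c) b ⟧)
      ≡⟨ ∑-filterᵇ a U _ ⟩
    (∑[ c ∈ U ] ⟦ a c ⟧ * (∑[ b ∈ U ] ⟦ edge (ξ , c) b ⟧))
      ≡⟨ (∑-cong U λ c → trans (sym (∑-*ˡ U ⟦ a c ⟧ _)) (∑-cong U λ b → cong (⟦ a c ⟧ *_) (⟦∧⟧ (a b) _))) ⟩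
    (∑[ c ∈ U ] ∑[ b ∈ U ] ⟦ a c ⟧ * (⟦ a b ⟧ * ⟦ popular ξ (c -ᶠ ξ *ᶠ b) ⟧))
      ≡⟨ ∑-comm U U _ ⟩
    (∑[ b ∈ U ] ∑[ c ∈ U ] ⟦ a c ⟧ * (⟦ a b ⟧ * ⟦ popular ξ (c -ᶠ ξ *ᶠ b) ⟧))
      ≡⟨ (∑-cong U λ b → trans (sym (∑-shift (ξ *ᶠ b) _)) (∑-cong U λ s → trans
           (cong (λ y → ⟦ a (s +ᶠ ξ *ᶠ b) ⟧ * (⟦ a b ⟧ * ⟦ popular ξ y ⟧)) (solve 2 (λ s y → (s :+ y) :- y := s) refl s (ξ *ᶠ b)))
           (e ⟦ a (s +ᶠ ξ *ᶠ b) ⟧ ⟦ a b ⟧ ⟦ popular ξ s ⟧))) ⟩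
    (∑[ b ∈ U ] ∑[ s ∈ U ] ⟦ popular ξ s ⟧ * (⟦ a b ⟧ * ⟦ a (s +ᶠ ξ *ᶠ b) ⟧))
      ≡⟨ trans (∑-comm U U _) (∑-cong U λ s → ∑-*ˡ U ⟦ popular ξ s ⟧ _) ⟩
    (∑[ s ∈ U ] ⟦ popular ξ s ⟧ * reps a ξ s) ∎
    where
    e : ∀ x y z → x * (y * z) ≡ z * (y * x)
    e = solve-∀

  correlation : F → F → ℕ
  correlation ξ t = ∑[ s ∈ U ] ⟦ popular ξ s ⟧ * ⟦ popular ξ (s +ᶠ t) ⟧

  -- A common neighbour (ξ , c) of b and b′ makes both c - ξ b and c - ξ b′ popular, and these
  -- differ by ξ (b - b′). So `ρ` bounds codegrees by a function of the difference alone.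
  ρ : F → ℕ
  ρ d = ∑[ ξ ∈ xs ] correlation ξ (ξ *ᶠ d)

  codegree≤ρ : ∀ b b′ → codegree b b′ ≤ ρ (b -ᶠ b′)
  codegree≤ρ b b′ = begin
    codegree b b′                                                        ≡⟨ ∑-product xs as _ ⟩
    (∑[ ξ ∈ xs ] ∑[ c ∈ as ] ⟦ edge (ξ , c) b ⟧ * ⟦ edge (ξ , c) b′ ⟧)   ≤⟨ (∑-mono′ xs λ ξ → fibre ξ) ⟩
    ρ (b -ᶠ b′)                                                          ∎
    where
    fibre : ∀ ξ → (∑[ c ∈ as ] ⟦ edge (ξ , c) b ⟧ * ⟦ edge (ξ , c) b′ ⟧) ≤ correlation ξ (ξ *ᶠ (b -ᶠ b′))
    fibre ξ = begin
      (∑[ c ∈ as ] ⟦ edge (ξ , c) b ⟧ * ⟦ edge (ξ , c) b′ ⟧)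
        ≤⟨ (∑-mono′ as λ c → *-mono-≤ (edge≤popular ξ c b) (edge≤popular ξ c b′)) ⟩
      (∑[ c ∈ as ] ⟦ popular ξ (c -ᶠ ξ *ᶠ b) ⟧ * ⟦ popular ξ (c -ᶠ ξ *ᶠ b′) ⟧)
        ≤⟨ ∑-as≤ _ ⟩
      (∑[ c ∈ U ] ⟦ popular ξ (c -ᶠ ξ *ᶠ b) ⟧ * ⟦ popular ξ (c -ᶠ ξ *ᶠ b′) ⟧)
        ≡⟨ ∑-shift (ξ *ᶠ b) _ ⟨
      (∑[ s ∈ U ] ⟦ popular ξ ((s +ᶠ ξ *ᶠ b) -ᶠ ξ *ᶠ b) ⟧ * ⟦ popular ξ ((s +ᶠ ξ *ᶠ b) -ᶠ ξ *ᶠ b′) ⟧)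
        ≡⟨ (∑-cong U λ s → cong₂ (λ y z → ⟦ popular ξ y ⟧ * ⟦ popular ξ z ⟧)
             (solve 2 (λ s y → (s :+ y) :- y := s) refl s (ξ *ᶠ b))
             (solve 4 (λ s ξ b b′ → (s :+ ξ :* b) :- ξ :* b′ := s :+ ξ :* (b :- b′)) refl s ξ b b′)) ⟩
      correlation ξ (ξ *ᶠ (b -ᶠ b′)) ∎

  codegree-comm : ∀ b b′ → codegree b b′ ≡ codegree b′ b
  codegree-comm b b′ = ∑-cong Ω λ ω → *-comm ⟦ edge ω b ⟧ _

  _⋆_ : (F → ℕ) → (F → ℕ) → F → ℕ
  (f ⋆ h) d = ∑[ e ∈ U ] f e * h (d -ᶠ e)

  ∑-⋆ : ∀ f h → ∑ U (f ⋆ h) ≡ ∑ U f * ∑ U h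
  ∑-⋆ f h = trans (∑-comm U U _) (trans
    (∑-cong U λ e → trans (∑-*ˡ U (f e) _) (cong (f e *_) (∑-shift (∼ e) h)))
    (∑-*ʳ U (∑ U h) f))

  -- The bounds depend on b - c and c - b′ only, so the sum over c becomes a convolution at their
  -- sum b - b′.
  ∑codegree² : ∀ b b′ → (∑[ c ∈ U ] codegree b c * codegree b′ c) ≤ (ρ ⋆ ρ) (b -ᶠ b′)
  ∑codegree² b b′ = begin
    (∑[ c ∈ U ] codegree b c * codegree b′ c)
      ≤⟨ (∑-mono′ U λ c → *-mono-≤ (codegree≤ρ b c) (≤-trans (≤-reflexive (codegree-comm b′ c)) (codegree≤ρ c b′))) ⟩
    (∑[ c ∈ U ] ρ (b -ᶠ c) * ρ (c -ᶠ b′))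
      ≡⟨ ∑-reflect b _ ⟨
    (∑[ e ∈ U ] ρ (b -ᶠ (b -ᶠ e)) * ρ ((b -ᶠ e) -ᶠ b′))
      ≡⟨ (∑-cong U λ e → cong₂ (λ y z → ρ y * ρ z)
           (solve 2 (λ b e → b :- (b :- e) := e) refl b e)
           (solve 3 (λ b b′ e → (b :- e) :- b′ := (b :- b′) :- e) refl b b′ e)) ⟩
    (ρ ⋆ ρ) (b -ᶠ b′) ∎

  opaque
    -- The ninth power of k: one from the size of the chosen neighbourhood, four from t² with t =
    -- 128 k², and four from the square of the total of `ρ`.
    D₀ : ℕ
    D₀ = k * 6 * (t * t) * (k * k * (k * k))

    D₀≡ : D₀ ≡ k * 6 * (t * t) * (k * k * (k * k))
    D₀≡ = refl

  module _ (n>0 : 0 < n) (x>0 : 0 < x) (k>0 : 0 < k)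
           (X≢0 : ∀ {ξ} → T (X ξ) → ξ ≢ 0ᶠ)
           (energetic : ∀ {ξ} → T (X ξ) → n * n * n ≤ K * energy a ξ) where

    private
      instance
        _ = >-nonZero n>0
        _ = >-nonZero x>0
        _ = m*n≢0 x n
        _ = m*n≢0 (x * n) (x * n)
        _ = m*n≢0 (x * n * (x * n)) n

    N>0 : 0 < N
    N>0 = subst (0 <_) (sym N≡) (>-nonZero⁻¹ (x * n))

    dense : N * n ≤ k * (∑[ ω ∈ Ω ] ∑[ b ∈ U ] ⟦ edge ω b ⟧)
    dense = begin
      N * n                                        ≡⟨ trans (cong (_* n) N≡) (*-assoc x n n) ⟩
      x * (n * n)                                  ≡⟨ trans (∑-const xs (n * n)) (cong (_* (n * n)) length-xs) ⟨
      (∑[ _ ∈ xs ] n * n)                          ≤⟨ ∑-mono xs (λ {ξ} ξ∈ → popularPairs n>0 ξ (energetic (∈-filterᵇ⁻ X U ξ∈))) ⟩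
      (∑[ ξ ∈ xs ] k * (∑[ s ∈ U ] ⟦ popular ξ s ⟧ * reps a ξ s))
                                                   ≡⟨ trans (∑-*ˡ xs k _) (cong (k *_) (∑-cong xs λ ξ → sym (edges ξ))) ⟩
      k * (∑[ ξ ∈ xs ] ∑[ c ∈ as ] ∑[ b ∈ U ] ⟦ edge (ξ , c) b ⟧)
                                                   ≡⟨ cong (k *_) (∑-product xs as _) ⟨
      k * (∑[ ω ∈ Ω ] ∑[ b ∈ U ] ⟦ edge ω b ⟧)     ∎

    -- Since ξ ≠ 0, the product ξ d runs over the whole field with d, and ξ contributes the square
    -- of the number of its popular elements.
    ∑ρ≤ : ∑ U ρ ≤ x * (k * n * (k * n))
    ∑ρ≤ = begin
      ∑ U ρ                                                        ≡⟨ ∑-comm U xs _ ⟩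
      (∑[ ξ ∈ xs ] ∑[ d ∈ U ] correlation ξ (ξ *ᶠ d))              ≤⟨ ∑-mono xs (λ {ξ} ξ∈ → total ξ (X≢0 (∈-filterᵇ⁻ X U ξ∈))) ⟩
      (∑[ _ ∈ xs ] k * n * (k * n))                                ≡⟨ trans (∑-const xs _) (cong (_* (k * n * (k * n))) length-xs) ⟩
      x * (k * n * (k * n))                                        ∎
      where
      total : ∀ ξ → ξ ≢ 0ᶠ → (∑[ d ∈ U ] correlation ξ (ξ *ᶠ d)) ≤ k * n * (k * n)
      total ξ ξ≢0 = begin
        (∑[ d ∈ U ] correlation ξ (ξ *ᶠ d))      ≡⟨ ∑-dilate ξ≢0 (correlation ξ) ⟩
        ∑ U (correlation ξ)                      ≡⟨ trans (∑-comm U U _) (∑-cong U λ s → trans (∑-*ˡ U ⟦ popular ξ s ⟧ _)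
                                                      (cong (⟦ popular ξ s ⟧ *_) (trans (∑-cong U λ t → cong (⟦_⟧ ∘ popular ξ)
                                                        (solve 2 (λ s t → s :+ t := t :+ s) refl s t)) (∑-shift s (⟦_⟧ ∘ popular ξ))))) ⟩
        (∑[ s ∈ U ] ⟦ popular ξ s ⟧ * # (popular ξ))
                                                 ≡⟨ ∑-*ʳ U _ _ ⟩
        # (popular ξ) * # (popular ξ)            ≤⟨ *-mono-≤ (#popular≤ n>0 ξ) (#popular≤ n>0 ξ) ⟩
        k * n * (k * n)                          ∎

    denseSet : DenseSet N>0 k>0 dense
    denseSet = dependentChoice N>0 k>0 dense

    module _ (B : F → Bool)
      (B-codegree : ∀ b b′ → T (B b) → T (B b′) →
        N * N * n ≤ k * 6 * (t * t) * (∑[ c ∈ U ] codegree b c * codegree b′ c)) where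

      -- Every element of B - B has weight at least N² n / (6 k t²) under `ρ ⋆ ρ`, whose total is
      -- the square of that of `ρ`. With N = x n all powers of x cancel.
      #differences≤ : # (diff 1ᶠ B) ≤ D₀ * n
      #differences≤ = *-cancelʳ-≤ _ _ (x * n * (x * n) * n) (begin
        # (diff 1ᶠ B) * (x * n * (x * n) * n)      ≡⟨ cong (λ N → # (diff 1ᶠ B) * (N * N * n)) N≡ ⟨
        # (diff 1ᶠ B) * (N * N * n)                ≤⟨ count*≤∑ U (diff 1ᶠ B) many ⟩
        (∑[ d ∈ U ] c * (ρ ⋆ ρ) d)                 ≡⟨ trans (∑-*ˡ U c _) (cong (c *_) (∑-⋆ ρ ρ)) ⟩
        c * (∑ U ρ * ∑ U ρ)                        ≤⟨ *-monoʳ-≤ c (*-mono-≤ ∑ρ≤ ∑ρ≤) ⟩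
        c * (x * (k * n * (k * n)) * (x * (k * n * (k * n))))
                                                   ≡⟨ e c x k n ⟩
        c * (k * k * (k * k)) * n * (x * n * (x * n) * n)
                                                   ≡⟨ cong (λ d → d * n * (x * n * (x * n) * n)) D₀≡ ⟨
        D₀ * n * (x * n * (x * n) * n)             ∎)
        where
        c : ℕ
        c = k * 6 * (t * t)
        e : ∀ c x k n → c * (x * (k * n * (k * n)) * (x * (k * n * (k * n)))) ≡
                        c * (k * k * (k * k)) * n * (x * n * (x * n) * n)
        e = solve-∀
        many : ∀ d → T (diff 1ᶠ B d) → N * N * n ≤ c * (ρ ⋆ ρ) d
        many d d∈ with image⁻ {λ b c → b -ᶠ 1ᶠ *ᶠ c} {B} {B} d∈
        ... | b , b′ , b∈ , b′∈ , refl = ≤-trans (B-codegree b b′ b∈ b′∈) (*-monoʳ-≤ c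
          (≤-trans (∑codegree² b b′) (≤-reflexive (cong (λ z → (ρ ⋆ ρ) (b -ᶠ z)) (sym (*ᶠ-identityˡ b′))))))

module CommonDilates {q : ℕ} (𝔽 : IndexField q) (a X : Fin q → Bool) (K : ℕ) where

  open IndexField 𝔽
  open DifferenceSolver commutativeRing
  open FieldCounting 𝔽
  open PopularDifferences 𝔽 a K
  open DenseDifferences 𝔽 a X K
  open DependentChoice Ω U edge a (λ {ω} {b} → edge⊆a {ω} {b}) k using (N; degree; DenseSet)

  opaque
    -- The factor 8 k² is the threshold of `connected`, (D₀ k)² comes from two elements of B - B and
    -- two popular elements, and (6 k)³ from replacing n³ by |B|³. As D₀ has degree 9, the degree in
    -- k is 2 + 20 + 3 = 25.
    L : ℕ
    L = k * k * 8 * (D₀ * k * (D₀ * k)) * (k * 6 * (k * 6) * (k * 6))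

    L≡ : L ≡ k * k * 8 * (D₀ * k * (D₀ * k)) * (k * 6 * (k * 6) * (k * 6))
    L≡ = refl

  module _ (B : F → Bool) where

    β : ℕ
    β = # B

    neighbours : F → F → ℕ
    neighbours ξ c = ∑[ b ∈ U ] ⟦ B b ⟧ * ⟦ edge (ξ , c) b ⟧

    paths : F → F → ℕ
    paths ξ η = ∑[ c ∈ as ] neighbours ξ c * neighbours η c

    neighbours≤ : ∀ ξ c → neighbours ξ c ≤ β
    neighbours≤ ξ c = ∑-mono′ U λ b → ≤-trans (*-monoʳ-≤ ⟦ B b ⟧ (⟦⟧≤1 _)) (≤-reflexive (*-identityʳ _))

    paths≤ : ∀ ξ η → paths ξ η ≤ n * (β * β)
    paths≤ ξ η = begin
      paths ξ η                  ≤⟨ (∑-mono′ as λ c → *-mono-≤ (neighbours≤ ξ c) (neighbours≤ η c)) ⟩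
      (∑[ _ ∈ as ] β * β)        ≡⟨ trans (∑-const as (β * β)) (cong (_* (β * β)) length-as) ⟩
      n * (β * β)                ∎

    total : F → ℕ
    total c = ∑[ ξ ∈ xs ] neighbours ξ c

    ∑total : ∑ as total ≡ (∑[ b ∈ U ] ⟦ B b ⟧ * degree b)
    ∑total = begin-equality
      ∑ as total                                                          ≡⟨ ∑-comm as xs _ ⟩
      (∑[ ξ ∈ xs ] ∑[ c ∈ as ] neighbours ξ c)                            ≡⟨ ∑-product xs as (λ (ξ , c) → neighbours ξ c) ⟨
      (∑[ ω ∈ Ω ] ∑[ b ∈ U ] ⟦ B b ⟧ * ⟦ edge ω b ⟧)                      ≡⟨ ∑-comm Ω U _ ⟩
      (∑[ b ∈ U ] ∑[ ω ∈ Ω ] ⟦ B b ⟧ * ⟦ edge ω b ⟧)                      ≡⟨ (∑-cong U λ b → ∑-*ˡ Ω ⟦ B b ⟧ _) ⟩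
      (∑[ b ∈ U ] ⟦ B b ⟧ * degree b)                                     ∎

    ∑total² : (∑[ c ∈ as ] total c * total c) ≡ (∑[ η ∈ xs ] ∑[ ξ ∈ xs ] paths ξ η)
    ∑total² = begin-equality
      (∑[ c ∈ as ] total c * total c)
        ≡⟨ (∑-cong as λ c → trans (∑-* xs xs _ _) (∑-comm xs xs _)) ⟩
      (∑[ c ∈ as ] ∑[ η ∈ xs ] ∑[ ξ ∈ xs ] neighbours ξ c * neighbours η c)
        ≡⟨ trans (∑-comm as xs _) (∑-cong xs λ η → ∑-comm as xs _) ⟩
      (∑[ η ∈ xs ] ∑[ ξ ∈ xs ] paths ξ η) ∎

    module _ (n>0 : 0 < n) (x>0 : 0 < x)
             (B-degree : ∀ b → T (B b) → N ≤ k * 2 * degree b)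
             (n≤6kβ : n ≤ k * 6 * β) where

      private
        instance
          _ = >-nonZero n>0
          _ = >-nonZero x>0

      β>0 : 0 < β
      β>0 = n≢0⇒n>0 (λ β≡0 → <⇒≱ n>0 (≤-trans n≤6kβ (≤-reflexive (trans (cong (k * 6 *_) β≡0) (*-zeroʳ (k * 6))))))

      ∑total≥ : β * (x * n) ≤ k * 2 * ∑ as total
      ∑total≥ = begin
        β * (x * n)                                    ≡⟨ cong (β *_) N≡ ⟨
        β * N                                          ≤⟨ count*≤∑ U B (λ b p → ≤-trans (B-degree b p)
                                                            (≤-reflexive (cong (k * 2 *_) (trans (sym (*-identityˡ (degree b))) (cong (_* degree b) (sym (T⇒⟦⟧≡1 p))))))) ⟩
        (∑[ b ∈ U ] k * 2 * (⟦ B b ⟧ * degree b))      ≡⟨ trans (∑-*ˡ U (k * 2) _) (cong (k * 2 *_) (sym ∑total)) ⟩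
        k * 2 * ∑ as total                             ∎

      -- Large degrees in B make the total number of edges large, and Cauchy-Schwarz over the middle
      -- vertex c ∈ A turns pairs of edges into paths. Both sides are written as sums over η so that
      -- an η can be chosen by averaging.
      ∑paths≥ : (∑[ _ ∈ xs ] β * β * x * n) ≤ (∑[ η ∈ xs ] k * k * 4 * (∑[ ξ ∈ xs ] paths ξ η))
      ∑paths≥ = *-cancelˡ-≤ n (begin
        n * (∑[ _ ∈ xs ] β * β * x * n)                ≡⟨ cong (n *_) (trans (∑-const xs _) (cong (_* (β * β * x * n)) length-xs)) ⟩
        n * (x * (β * β * x * n))                      ≡⟨ e₁ n x β ⟩
        β * (x * n) * (β * (x * n))                    ≤⟨ *-mono-≤ ∑total≥ ∑total≥ ⟩
        k * 2 * ∑ as total * (k * 2 * ∑ as total)      ≡⟨ e₂ k (∑ as total) ⟩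
        k * k * 4 * (∑ as total * ∑ as total)          ≤⟨ *-monoʳ-≤ (k * k * 4) (∑²≤ as total) ⟩
        k * k * 4 * (length as * (∑[ c ∈ as ] total c * total c))
                                                       ≡⟨ cong₂ (λ l s → k * k * 4 * (l * s)) length-as ∑total² ⟩
        k * k * 4 * (n * (∑[ η ∈ xs ] ∑[ ξ ∈ xs ] paths ξ η))
                                                       ≡⟨ e₃ (k * k * 4) n _ ⟩
        n * (k * k * 4 * (∑[ η ∈ xs ] ∑[ ξ ∈ xs ] paths ξ η))
                                                       ≡⟨ cong (n *_) (∑-*ˡ xs (k * k * 4) _) ⟨
        n * (∑[ η ∈ xs ] k * k * 4 * (∑[ ξ ∈ xs ] paths ξ η)) ∎)
        where
        e₁ : ∀ n x β → n * (x * (β * β * x * n)) ≡ β * (x * n) * (β * (x * n))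
        e₁ = solve-∀
        e₂ : ∀ k s → k * 2 * s * (k * 2 * s) ≡ k * k * 4 * (s * s)
        e₂ = solve-∀
        e₃ : ∀ k n s → k * (n * s) ≡ n * (k * s)
        e₃ = solve-∀

      centre : ∃ λ η → η List.∈ xs × β * β * x * n ≤ k * k * 4 * (∑[ ξ ∈ xs ] paths ξ η)
      centre = ∑-average xs (subst (0 <_) (sym length-xs) x>0) ∑paths≥

    connected : F → F → Bool
    connected η ξ = β * β * n ≤ᵇ k * k * 8 * paths ξ η

    -- The ξ that are not connected to η account for at most half of the paths at η, while no ξ has
    -- more than n β² of them.
    #connected≥ : 0 < β * β * n → ∀ η → β * β * x * n ≤ k * k * 4 * (∑[ ξ ∈ xs ] paths ξ η) →
                  x ≤ k * k * 8 * (∑[ ξ ∈ xs ] ⟦ connected η ξ ⟧)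
    #connected≥ ββn>0 η many = *-cancelʳ-≤ x _ (β * β * n) {{>-nonZero ββn>0}} (+-cancelˡ-≤ (x * (β * β * n)) _ _ (begin
      x * (β * β * n) + x * (β * β * n)                ≡⟨ e₁ x β n ⟩
      β * β * x * n * 2                                ≤⟨ *-monoˡ-≤ 2 many ⟩
      k * k * 4 * (∑[ ξ ∈ xs ] paths ξ η) * 2          ≡⟨ e₂ k _ ⟩
      k * k * 8 * (∑[ ξ ∈ xs ] paths ξ η)              ≡⟨ ∑-*ˡ xs (k * k * 8) _ ⟨
      (∑[ ξ ∈ xs ] k * k * 8 * paths ξ η)              ≤⟨ ∑-mono′ xs split ⟩
      (∑[ ξ ∈ xs ] (β * β * n + ⟦ connected η ξ ⟧ * (k * k * 8 * (n * (β * β)))))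
                                                       ≡⟨ trans (∑-+ xs _ _) (cong₂ _+_ (trans (∑-const xs _) (cong (_* (β * β * n)) length-xs)) (∑-*ʳ xs _ _)) ⟩
      x * (β * β * n) + (∑[ ξ ∈ xs ] ⟦ connected η ξ ⟧) * (k * k * 8 * (n * (β * β)))
                                                       ≡⟨ cong (x * (β * β * n) +_) (e₃ _ (k * k * 8) n β) ⟩
      x * (β * β * n) + k * k * 8 * (∑[ ξ ∈ xs ] ⟦ connected η ξ ⟧) * (β * β * n) ∎))
      where
      e₁ : ∀ x β n → x * (β * β * n) + x * (β * β * n) ≡ β * β * x * n * 2
      e₁ = solve-∀
      e₂ : ∀ k s → k * k * 4 * s * 2 ≡ k * k * 8 * s
      e₂ = solve-∀
      e₃ : ∀ s k n β → s * (k * (n * (β * β))) ≡ k * s * (β * β * n)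
      e₃ = solve-∀
      split : ∀ ξ → k * k * 8 * paths ξ η ≤ β * β * n + ⟦ connected η ξ ⟧ * (k * k * 8 * (n * (β * β)))
      split ξ with β * β * n ≤ᵇ k * k * 8 * paths ξ η in eq
      ... | true  = ≤-trans (*-monoʳ-≤ (k * k * 8) (paths≤ ξ η)) (≤-trans (≤-reflexive (sym (+-identityʳ _))) (m≤n+m _ (β * β * n)))
      ... | false = ≤-trans (≰ᵇ⇒≥ (β * β * n) (k * k * 8 * paths ξ η) eq) (m≤m+n (β * β * n) _)

    -- A path b′ – c – b″ represents η b − ξ b₀ as
    -- η (b − b′) − (c − η b′) + (c − ξ b″) + ξ (b″ − b₀).
    representations : F → F → F → ℕ
    representations η ξ y = ∑[ e ∈ U ] ∑[ e′ ∈ U ] ∑[ s ∈ U ]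
      (⟦ diff 1ᶠ B e ⟧ * ⟦ popular η s ⟧) * (⟦ diff 1ᶠ B e′ ⟧ * ⟦ popular ξ (s +ᶠ (y -ᶠ (η *ᶠ e +ᶠ ξ *ᶠ e′))) ⟧)

    -- For fixed e, e′ and s the last popular element is a shift of y, so the total is the product
    -- of the sizes of four sets.
    ∑representations : ∀ η ξ → ∑ U (representations η ξ) ≡
      # (diff 1ᶠ B) * # (popular η) * (# (diff 1ᶠ B) * # (popular ξ))
    ∑representations η ξ = begin-equality
      ∑ U (representations η ξ)
        ≡⟨ trans (∑-comm U U _) (∑-cong U λ e → trans (∑-comm U U _) (∑-cong U λ e′ → ∑-comm U U _)) ⟩
      (∑[ e ∈ U ] ∑[ e′ ∈ U ] ∑[ s ∈ U ] ∑[ y ∈ U ] (⟦ Δ e ⟧ * ⟦ popular η s ⟧) * (⟦ Δ e′ ⟧ * ⟦ popular ξ (s +ᶠ (y -ᶠ (η *ᶠ e +ᶠ ξ *ᶠ e′))) ⟧))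
        ≡⟨ (∑-cong U λ e → ∑-cong U λ e′ → ∑-cong U λ s → inner e e′ s) ⟩
      (∑[ e ∈ U ] ∑[ e′ ∈ U ] ∑[ s ∈ U ] (⟦ Δ e ⟧ * ⟦ popular η s ⟧) * (⟦ Δ e′ ⟧ * # (popular ξ)))
        ≡⟨ (∑-cong U λ e → trans (∑-comm U U _) (trans (sym (∑-* U U _ _)) (cong₂ _*_ (∑-*ˡ U ⟦ Δ e ⟧ _) (∑-*ʳ U _ _)))) ⟩
      (∑[ e ∈ U ] (⟦ Δ e ⟧ * # (popular η)) * (# Δ * # (popular ξ)))
        ≡⟨ trans (∑-*ʳ U _ _) (cong (_* (# Δ * # (popular ξ))) (∑-*ʳ U _ _)) ⟩
      # Δ * # (popular η) * (# Δ * # (popular ξ)) ∎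
      where
      Δ : F → Bool
      Δ = diff 1ᶠ B
      inner : ∀ e e′ s → (∑[ y ∈ U ] (⟦ Δ e ⟧ * ⟦ popular η s ⟧) * (⟦ Δ e′ ⟧ * ⟦ popular ξ (s +ᶠ (y -ᶠ (η *ᶠ e +ᶠ ξ *ᶠ e′))) ⟧)) ≡
                         (⟦ Δ e ⟧ * ⟦ popular η s ⟧) * (⟦ Δ e′ ⟧ * # (popular ξ))
      inner e e′ s = trans (∑-*ˡ U (⟦ Δ e ⟧ * ⟦ popular η s ⟧) _) (cong (⟦ Δ e ⟧ * ⟦ popular η s ⟧ *_) (trans (∑-*ˡ U ⟦ Δ e′ ⟧ _) (cong (⟦ Δ e′ ⟧ *_) (trans
        (∑-cong U λ y → cong (⟦_⟧ ∘ popular ξ) (solve 3 (λ s y z → s :+ (y :- z) := y :+ (s :- z)) refl s y (η *ᶠ e +ᶠ ξ *ᶠ e′)))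
        (∑-shift (s -ᶠ (η *ᶠ e +ᶠ ξ *ᶠ e′)) (⟦_⟧ ∘ popular ξ))))))

    -- For fixed b and b₀ the substitutions e = b - b′, e′ = b″ - b₀ and s = c - η b′ are
    -- invertible, so distinct paths give distinct representations.
    paths≤representations : ∀ η ξ {b b₀} → T (B b) → T (B b₀) →
                            paths ξ η ≤ representations η ξ (η *ᶠ b -ᶠ ξ *ᶠ b₀)
    paths≤representations η ξ {b} {b₀} b∈ b₀∈ = begin
      paths ξ η
        ≤⟨ ∑-as≤ _ ⟩
      (∑[ c ∈ U ] neighbours ξ c * neighbours η c)
        ≤⟨ (∑-mono′ U λ c → ≤-trans (≤-reflexive (*-comm (neighbours ξ c) _)) (*-mono-≤ (first c) (second c))) ⟩
      (∑[ c ∈ U ] (∑[ e ∈ U ] ⟦ Δ e ⟧ * ⟦ popular η (c -ᶠ η *ᶠ (b -ᶠ e)) ⟧) * (∑[ e′ ∈ U ] ⟦ Δ e′ ⟧ * ⟦ popular ξ (c -ᶠ ξ *ᶠ (e′ +ᶠ b₀)) ⟧))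
        ≡⟨ trans (∑-cong U λ c → ∑-* U U _ _) (trans (∑-comm U U _) (∑-cong U λ e → ∑-comm U U _)) ⟩
      (∑[ e ∈ U ] ∑[ e′ ∈ U ] ∑[ c ∈ U ] (⟦ Δ e ⟧ * ⟦ popular η (c -ᶠ η *ᶠ (b -ᶠ e)) ⟧) * (⟦ Δ e′ ⟧ * ⟦ popular ξ (c -ᶠ ξ *ᶠ (e′ +ᶠ b₀)) ⟧))
        ≡⟨ (∑-cong U λ e → ∑-cong U λ e′ → trans (sym (∑-shift (η *ᶠ (b -ᶠ e)) _)) (∑-cong U λ s →
             cong₂ (λ y z → (⟦ Δ e ⟧ * ⟦ popular η y ⟧) * (⟦ Δ e′ ⟧ * ⟦ popular ξ z ⟧))
               (solve 2 (λ s y → (s :+ y) :- y := s) refl s (η *ᶠ (b -ᶠ e)))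
               (solve 7 (λ s η b e ξ e′ b₀ → (s :+ η :* (b :- e)) :- ξ :* (e′ :+ b₀) := s :+ ((η :* b :- ξ :* b₀) :- (η :* e :+ ξ :* e′)))
                 refl s η b e ξ e′ b₀))) ⟩
      representations η ξ (η *ᶠ b -ᶠ ξ *ᶠ b₀) ∎
      where
      Δ : F → Bool
      Δ = diff 1ᶠ B
      Δ∋ : ∀ {b c} → T (B b) → T (B c) → T (Δ (b -ᶠ c))
      Δ∋ {b} {c} p p′ = subst (λ c′ → T (Δ (b -ᶠ c′))) (*ᶠ-identityˡ c) (image⁺ {λ b c → b -ᶠ 1ᶠ *ᶠ c} {B} {B} p p′)
      first : ∀ c → neighbours η c ≤ (∑[ e ∈ U ] ⟦ Δ e ⟧ * ⟦ popular η (c -ᶠ η *ᶠ (b -ᶠ e)) ⟧)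
      first c = begin
        neighbours η c
          ≤⟨ (∑-mono′ U λ b′ → *-mono-≤ (⟦⟧-mono (Δ∋ b∈)) (edge≤popular η c b′)) ⟩
        (∑[ b′ ∈ U ] ⟦ Δ (b -ᶠ b′) ⟧ * ⟦ popular η (c -ᶠ η *ᶠ b′) ⟧)
          ≡⟨ ∑-reflect b _ ⟨
        (∑[ e ∈ U ] ⟦ Δ (b -ᶠ (b -ᶠ e)) ⟧ * ⟦ popular η (c -ᶠ η *ᶠ (b -ᶠ e)) ⟧)
          ≡⟨ (∑-cong U λ e → cong (λ y → ⟦ Δ y ⟧ * ⟦ popular η (c -ᶠ η *ᶠ (b -ᶠ e)) ⟧) (solve 2 (λ b e → b :- (b :- e) := e) refl b e)) ⟩
        (∑[ e ∈ U ] ⟦ Δ e ⟧ * ⟦ popular η (c -ᶠ η *ᶠ (b -ᶠ e)) ⟧) ∎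
      second : ∀ c → neighbours ξ c ≤ (∑[ e′ ∈ U ] ⟦ Δ e′ ⟧ * ⟦ popular ξ (c -ᶠ ξ *ᶠ (e′ +ᶠ b₀)) ⟧)
      second c = begin
        neighbours ξ c
          ≤⟨ (∑-mono′ U λ b′ → *-mono-≤ (⟦⟧-mono (λ p → Δ∋ p b₀∈)) (edge≤popular ξ c b′)) ⟩
        (∑[ b′ ∈ U ] ⟦ Δ (b′ -ᶠ b₀) ⟧ * ⟦ popular ξ (c -ᶠ ξ *ᶠ b′) ⟧)
          ≡⟨ ∑-shift b₀ _ ⟨
        (∑[ e ∈ U ] ⟦ Δ ((e +ᶠ b₀) -ᶠ b₀) ⟧ * ⟦ popular ξ (c -ᶠ ξ *ᶠ (e +ᶠ b₀)) ⟧)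
          ≡⟨ (∑-cong U λ e → cong (λ y → ⟦ Δ y ⟧ * ⟦ popular ξ (c -ᶠ ξ *ᶠ (e +ᶠ b₀)) ⟧) (solve 2 (λ b e → (e :+ b) :- b := e) refl b₀ e)) ⟩
        (∑[ e ∈ U ] ⟦ Δ e ⟧ * ⟦ popular ξ (c -ᶠ ξ *ᶠ (e +ᶠ b₀)) ⟧) ∎

    module _ (n>0 : 0 < n) (β>0 : 0 < β) (n≤6kβ : n ≤ k * 6 * β) (#Δ≤ : # (diff 1ᶠ B) ≤ D₀ * n) where

      private
        instance
          _ = >-nonZero n>0
          _ = >-nonZero β>0
          _ = m*n≢0 β β
          _ = m*n≢0 (β * β) n

      -- Multiplication by η maps B - z B injectively into η B - ξ B. There every element has at
      -- least n β² / (8 k²) representations, out of at most (D₀ k n²)² in all; n ≤ 6 k β then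
      -- trades n³ for β³.
      #diff-dilate≤ : ∀ {η ξ z} → η ≢ 0ᶠ → η *ᶠ z ≡ ξ → T (connected η ξ) → # (diff z B) ≤ L * β
      #diff-dilate≤ {η} {ξ} {z} η≢0 ηz≡ξ conn = *-cancelʳ-≤ _ _ (β * β * n) (begin
        # (diff z B) * (β * β * n)
          ≤⟨ count*≤∑ U (diff z B) many ⟩
        (∑[ y ∈ U ] k * k * 8 * representations η ξ (η *ᶠ y))
          ≡⟨ trans (∑-*ˡ U (k * k * 8) _) (cong (k * k * 8 *_) (trans (∑-dilate η≢0 (representations η ξ)) (∑representations η ξ))) ⟩
        k * k * 8 * (# Δ * # (popular η) * (# Δ * # (popular ξ)))
          ≤⟨ *-monoʳ-≤ (k * k * 8) (*-mono-≤ (*-mono-≤ #Δ≤ (#popular≤ n>0 η)) (*-mono-≤ #Δ≤ (#popular≤ n>0 ξ))) ⟩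
        k * k * 8 * (D₀ * n * (k * n) * (D₀ * n * (k * n)))
          ≡⟨ e₁ (k * k * 8) D₀ k n ⟩
        k * k * 8 * (D₀ * k * (D₀ * k)) * (n * n * n) * n
          ≤⟨ *-monoˡ-≤ n (*-monoʳ-≤ (k * k * 8 * (D₀ * k * (D₀ * k))) (*-mono-≤ (*-mono-≤ n≤6kβ n≤6kβ) n≤6kβ)) ⟩
        k * k * 8 * (D₀ * k * (D₀ * k)) * (k * 6 * β * (k * 6 * β) * (k * 6 * β)) * n
          ≡⟨ e₂ (k * k * 8 * (D₀ * k * (D₀ * k))) (k * 6) β n ⟩
        k * k * 8 * (D₀ * k * (D₀ * k)) * (k * 6 * (k * 6) * (k * 6)) * β * (β * β * n)
          ≡⟨ cong (λ l → l * β * (β * β * n)) L≡ ⟨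
        L * β * (β * β * n) ∎)
        where
        Δ : F → Bool
        Δ = diff 1ᶠ B
        e₁ : ∀ c D k n → c * (D * n * (k * n) * (D * n * (k * n))) ≡ c * (D * k * (D * k)) * (n * n * n) * n
        e₁ = solve-∀
        e₂ : ∀ c l β n → c * (l * β * (l * β) * (l * β)) * n ≡ c * (l * l * l) * β * (β * β * n)
        e₂ = solve-∀
        many : ∀ y → T (diff z B y) → β * β * n ≤ k * k * 8 * representations η ξ (η *ᶠ y)
        many y y∈ with image⁻ {λ b c → b -ᶠ z *ᶠ c} {B} {B} y∈
        ... | b , b₀ , b∈ , b₀∈ , refl = ≤-trans (≤ᵇ⇒≤ _ _ conn) (*-monoʳ-≤ (k * k * 8)
          (≤-trans (paths≤representations η ξ b∈ b₀∈) (≤-reflexive (cong (representations η ξ)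
            (trans (cong (λ w → η *ᶠ b -ᶠ w *ᶠ b₀) (sym ηz≡ξ))
              (solve 4 (λ η b z b₀ → η :* b :- (η :* z) :* b₀ := η :* (b :- z :* b₀)) refl η b z b₀))))))

  record Dilates : Set where
    field
      B     : F → Bool
      η     : F
      Y     : F → Bool
      η∈X   : T (X η)
      B⊆a   : ∀ b → T (B b) → T (a b)
      n≤    : n ≤ k * 6 * # B
      Y⊆    : ∀ y → T (Y y) → T (X (η *ᶠ y))
      x≤    : x ≤ k * k * 8 * # Y
      #Δ≤   : # (diff 1ᶠ B) ≤ D₀ * n
      #dilates≤ : ∀ y → T (Y y) → # (diff y B) ≤ L * # B

  module _ (n>0 : 0 < n) (x>0 : 0 < x) (k>0 : 0 < k)
           (X≢0 : ∀ {ξ} → T (X ξ) → ξ ≢ 0ᶠ)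
           (energetic : ∀ {ξ} → T (X ξ) → n * n * n ≤ K * energy a ξ) where

    dilates : Dilates
    dilates = construct (denseSet n>0 x>0 k>0 X≢0 energetic)
      where
      fromCentre : ∀ B → (∀ b → T (B b) → T (a b)) → n ≤ k * 6 * # B → # (diff 1ᶠ B) ≤ D₀ * n → 0 < # B →
                   (∃ λ η → η List.∈ xs × # B * # B * x * n ≤ k * k * 4 * (∑[ ξ ∈ xs ] paths B ξ η)) → Dilates
      fromCentre B B⊆a n≤ #Δ≤ β>0 (η , η∈ , many) = record
        { B = B ; η = η ; Y = Y ; η∈X = η∈X ; B⊆a = B⊆a ; n≤ = n≤
        ; Y⊆ = λ y p → proj₁ (T-∧⁻ {X (η *ᶠ y)} p)
        ; x≤ = ≤-trans (#connected≥ B ββn>0 η many) (≤-reflexive (cong (k * k * 8 *_) (sym #Y≡)))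
        ; #Δ≤ = #Δ≤
        ; #dilates≤ = λ y p → #diff-dilate≤ B n>0 β>0 n≤ #Δ≤ (X≢0 η∈X) refl (proj₂ (T-∧⁻ {X (η *ᶠ y)} p))
        }
        where
        Y : F → Bool
        Y y = X (η *ᶠ y) ∧ connected B η (η *ᶠ y)
        η∈X : T (X η)
        η∈X = ∈-filterᵇ⁻ X U η∈
        ββn>0 : 0 < # B * # B * n
        ββn>0 = *-mono-< {0} {# B * # B} {0} {n} (*-mono-< {0} {# B} {0} {# B} β>0 β>0) n>0
        #Y≡ : # Y ≡ (∑[ ξ ∈ xs ] ⟦ connected B η ξ ⟧)
        #Y≡ = trans (∑-dilate (X≢0 η∈X) (λ ξ → ⟦ X ξ ∧ connected B η ξ ⟧))
          (trans (∑-cong U λ ξ → ⟦∧⟧ (X ξ) _) (sym (∑-filterᵇ X U _)))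
      construct : DenseSet (N>0 n>0 x>0 k>0 X≢0 energetic) k>0 (dense n>0 x>0 k>0 X≢0 energetic) → Dilates
      construct (B , B-good , n≤ , B-codegree) = fromCentre B (λ b p → proj₁ (B-good b p)) n≤
        (#differences≤ n>0 x>0 k>0 X≢0 energetic B B-codegree)
        (β>0 B n>0 x>0 (λ b p → proj₂ (B-good b p)) n≤)
        (centre B n>0 x>0 (λ b p → proj₂ (B-good b p)) n≤)

-- Sum-product sets

module Stabilizers {q : ℕ} (𝔽 : IndexField q) (B : Fin q → Bool) where

  open IndexField 𝔽
  open DifferenceSolver commutativeRing
  open FieldCounting 𝔽
  open IsCommutativeRing isCommutativeRing using () renaming (+-identityˡ to +ᶠ-identityˡ)

  bs : List F
  bs = filterᵇ B U

  length-bs : length bs ≡ # B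
  length-bs = length-filterᵇ B U

  average-pair : ∀ {m} (G : F → F → ℕ) → 0 < # B →
    # B * # B * m ≤ (∑[ c ∈ U ] ∑[ d ∈ U ] ⟦ B c ⟧ * (⟦ B d ⟧ * G c d)) →
    ∃ λ c → ∃ λ d → T (B c) × T (B d) × m ≤ G c d
  average-pair {m} G β>0 h =
    let (c , d) , cd∈ , le = ∑-average (cartesianProduct bs bs) nonempty total
        c∈ , d∈ = ∈-cartesianProduct⁻ bs bs cd∈
    in c , d , ∈-filterᵇ⁻ B U c∈ , ∈-filterᵇ⁻ B U d∈ , le
    where
    length≡ : length (cartesianProduct bs bs) ≡ # B * # B
    length≡ = trans (length-cartesianProduct bs bs) (cong₂ _*_ length-bs length-bs)
    nonempty : 0 < length (cartesianProduct bs bs)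
    nonempty = subst (0 <_) (sym length≡) (*-mono-< {0} {# B} {0} {# B} β>0 β>0)
    total : (∑[ _ ∈ cartesianProduct bs bs ] m) ≤ (∑[ cd ∈ cartesianProduct bs bs ] G (proj₁ cd) (proj₂ cd))
    total = begin
      (∑[ _ ∈ cartesianProduct bs bs ] m)                              ≡⟨ trans (∑-const (cartesianProduct bs bs) m) (cong (_* m) length≡) ⟩
      # B * # B * m                                                    ≤⟨ h ⟩
      (∑[ c ∈ U ] ∑[ d ∈ U ] ⟦ B c ⟧ * (⟦ B d ⟧ * G c d))              ≡⟨ (∑-cong U λ c → trans (∑-*ˡ U ⟦ B c ⟧ _) (cong (⟦ B c ⟧ *_) (sym (∑-filterᵇ B U (G c))))) ⟩
      (∑[ c ∈ U ] ⟦ B c ⟧ * (∑[ d ∈ bs ] G c d))                       ≡⟨ ∑-filterᵇ B U _ ⟨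
      (∑[ c ∈ bs ] ∑[ d ∈ bs ] G c d)                                  ≡⟨ ∑-product bs bs _ ⟨
      (∑[ cd ∈ cartesianProduct bs bs ] G (proj₁ cd) (proj₂ cd))       ∎

  plus : F → F → Bool
  plus x = image (λ b c → b +ᶠ x *ᶠ c) B B

  -- A popular sum z = c + x b has many representations z = a + x d; for each
  -- of them b₁ + x b₂ = z + (b₁ − x d) − (a − x b₂).
  ruzsa : 0 < # B → ∀ {x} → x ≢ 0ᶠ → # (plus x) * (# B * # B) ≤ # (diff x B) * (# (diff x B) * # (diff x B))
  ruzsa β>0 {x} x≢0 = finish (average-pair {# B * # B} (λ c b → #D * sums c b) β>0 total)
    where
    D : F → Bool
    D = diff x B
    #D : ℕ
    #D = # D
    sums : F → F → ℕ
    sums c b = ∑[ d ∈ U ] ⟦ B d ⟧ * ⟦ B (c +ᶠ x *ᶠ (b -ᶠ d)) ⟧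
    e₁ : ∀ p q r s → p * (q * (r * s)) ≡ p * (r * (q * s))
    e₁ = solve-∀
    e₂ : ∀ p q r s → p * (q * (r * s)) ≡ r * (p * (q * s))
    e₂ = solve-∀
    total : # B * # B * (# B * # B) ≤ (∑[ c ∈ U ] ∑[ b ∈ U ] ⟦ B c ⟧ * (⟦ B b ⟧ * (#D * sums c b)))
    total = begin
      # B * # B * (# B * # B)      ≤⟨ #⁴≤ B x ⟩
      #D * energy B x              ≡⟨ cong (#D *_) (∑-cong U λ c → begin-equality
        (∑[ d ∈ U ] ⟦ B c ⟧ * (⟦ B d ⟧ * (∑[ b ∈ U ] ⟦ B b ⟧ * ⟦ B (c +ᶠ x *ᶠ (b -ᶠ d)) ⟧)))
          ≡⟨ (∑-cong U λ d → trans (cong (⟦ B c ⟧ *_) (sym (∑-*ˡ U ⟦ B d ⟧ _))) (sym (∑-*ˡ U ⟦ B c ⟧ _))) ⟩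
        (∑[ d ∈ U ] ∑[ b ∈ U ] ⟦ B c ⟧ * (⟦ B d ⟧ * (⟦ B b ⟧ * ⟦ B (c +ᶠ x *ᶠ (b -ᶠ d)) ⟧)))
          ≡⟨ trans (∑-comm U U _) (∑-cong U λ b → ∑-cong U λ d → e₁ ⟦ B c ⟧ ⟦ B d ⟧ ⟦ B b ⟧ _) ⟩
        (∑[ b ∈ U ] ∑[ d ∈ U ] ⟦ B c ⟧ * (⟦ B b ⟧ * (⟦ B d ⟧ * ⟦ B (c +ᶠ x *ᶠ (b -ᶠ d)) ⟧)))
          ≡⟨ (∑-cong U λ b → trans (∑-*ˡ U ⟦ B c ⟧ _) (cong (⟦ B c ⟧ *_) (∑-*ˡ U ⟦ B b ⟧ _))) ⟩
        (∑[ b ∈ U ] ⟦ B c ⟧ * (⟦ B b ⟧ * sums c b)) ∎) ⟩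
      #D * (∑[ c ∈ U ] ∑[ b ∈ U ] ⟦ B c ⟧ * (⟦ B b ⟧ * sums c b))
        ≡⟨ trans (∑-cong U λ c → ∑-*ˡ U #D _) (∑-*ˡ U #D _) ⟨
      (∑[ c ∈ U ] ∑[ b ∈ U ] #D * (⟦ B c ⟧ * (⟦ B b ⟧ * sums c b)))
        ≡⟨ (∑-cong U λ c → ∑-cong U λ b → e₂ ⟦ B c ⟧ ⟦ B b ⟧ #D (sums c b)) ⟨
      (∑[ c ∈ U ] ∑[ b ∈ U ] ⟦ B c ⟧ * (⟦ B b ⟧ * (#D * sums c b))) ∎
    finish : (∃ λ c → ∃ λ b → T (B c) × T (B b) × # B * # B ≤ #D * sums c b) →
             # (plus x) * (# B * # B) ≤ #D * (#D * #D)
    finish (c , b , _ , _ , large) = begin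
      # (plus x) * (# B * # B)              ≤⟨ *-monoʳ-≤ (# (plus x)) large ⟩
      # (plus x) * (#D * sums c b)          ≡⟨ e₃ (# (plus x)) #D (sums c b) ⟩
      #D * (# (plus x) * sums c b)          ≤⟨ *-monoʳ-≤ #D (count*≤∑ U (plus x) many) ⟩
      #D * (∑[ s ∈ U ] ∑[ e ∈ U ] ⟦ D e ⟧ * ⟦ D (e +ᶠ (z -ᶠ s)) ⟧)
        ≡⟨ cong (#D *_) (trans (∑-comm U U _) (trans (∑-cong U λ e → trans (∑-*ˡ U ⟦ D e ⟧ _) (cong (⟦ D e ⟧ *_) (trans
             (∑-cong U λ s → cong (⟦_⟧ ∘ D) (solve 3 (λ e z s → e :+ (z :- s) := (e :+ z) :- s) refl e z s))
             (∑-reflect (e +ᶠ z) (⟦_⟧ ∘ D))))) (∑-*ʳ U #D _))) ⟩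
      #D * (#D * #D)                        ∎
      where
      z : F
      z = c +ᶠ x *ᶠ b
      e₃ : ∀ p d s → p * (d * s) ≡ d * (p * s)
      e₃ = solve-∀
      many : ∀ s → T (plus x s) → sums c b ≤ (∑[ e ∈ U ] ⟦ D e ⟧ * ⟦ D (e +ᶠ (z -ᶠ s)) ⟧)
      many s s∈ with image⁻ {λ b c → b +ᶠ x *ᶠ c} {B} {B} s∈
      ... | b₁ , b₂ , b₁∈ , b₂∈ , refl = begin
        sums c b
          ≤⟨ (∑-mono′ U λ d → *-mono-≤ (⟦⟧-mono (image⁺ {λ b c → b -ᶠ x *ᶠ c} {B} {B} b₁∈)) (⟦⟧-mono (λ p → image⁺ {λ b c → b -ᶠ x *ᶠ c} {B} {B} p b₂∈))) ⟩
        (∑[ d ∈ U ] ⟦ D (b₁ -ᶠ x *ᶠ d) ⟧ * ⟦ D ((c +ᶠ x *ᶠ (b -ᶠ d)) -ᶠ x *ᶠ b₂) ⟧)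
          ≡⟨ (∑-cong U λ d → cong (λ y → ⟦ D (b₁ -ᶠ x *ᶠ d) ⟧ * ⟦ D y ⟧)
               (solve 6 (λ c x b d b₁ b₂ → (c :+ x :* (b :- d)) :- x :* b₂ := (b₁ :- x :* d) :+ ((c :+ x :* b) :- (b₁ :+ x :* b₂))) refl c x b d b₁ b₂)) ⟩
        (∑[ d ∈ U ] ⟦ D (b₁ -ᶠ x *ᶠ d) ⟧ * ⟦ D ((b₁ -ᶠ x *ᶠ d) +ᶠ (z -ᶠ (b₁ +ᶠ x *ᶠ b₂))) ⟧)
          -- As x ≠ 0, the map d ↦ b₁ - x d is a bijection of the field.
          ≡⟨ trans (∑-dilate x≢0 (λ y → ⟦ D (b₁ -ᶠ y) ⟧ * ⟦ D ((b₁ -ᶠ y) +ᶠ (z -ᶠ (b₁ +ᶠ x *ᶠ b₂))) ⟧)) (∑-reflect b₁ (λ e → ⟦ D e ⟧ * ⟦ D (e +ᶠ (z -ᶠ (b₁ +ᶠ x *ᶠ b₂))) ⟧)) ⟩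
        (∑[ e ∈ U ] ⟦ D e ⟧ * ⟦ D (e +ᶠ (z -ᶠ (b₁ +ᶠ x *ᶠ b₂))) ⟧) ∎

  #plus≤ : 0 < # B → ∀ {x L} → x ≢ 0ᶠ → # (diff x B) ≤ L * # B → # (plus x) ≤ L * L * L * # B
  #plus≤ β>0 {x} {L} x≢0 h = *-cancelʳ-≤ _ _ (# B * # B) {{m*n≢0 (# B) (# B) {{>-nonZero β>0}} {{>-nonZero β>0}}}} (begin
    # (plus x) * (# B * # B)                          ≤⟨ ruzsa β>0 x≢0 ⟩
    # (diff x B) * (# (diff x B) * # (diff x B))      ≤⟨ *-mono-≤ h (*-mono-≤ h h) ⟩
    L * # B * (L * # B * (L * # B))                   ≡⟨ e L (# B) ⟩
    L * L * L * # B * (# B * # B)                     ∎)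
    where
    e : ∀ L b → L * b * (L * b * (L * b)) ≡ L * L * L * b * (b * b)
    e = solve-∀

  module _ (Y : F → Bool) (L : ℕ) (β>0 : 0 < # B) (Y>0 : 0 < # Y) (L>0 : 0 < L)
           (#diff≤ : ∀ y → T (Y y) → # (diff y B) ≤ L * # B) where

    private
      instance
        _ = >-nonZero β>0
        _ = >-nonZero Y>0
        _ = >-nonZero L>0
        _ = m*n≢0 L 2
        _ = m*n≢0 (# Y) (# Y)
        _ = m*n≢0 (# Y * # Y) (# B)

      #³≤ : ∀ y → T (Y y) → # B * # B * # B ≤ L * energy B y
      #³≤ y y∈ = *-cancelʳ-≤ _ _ (# B) (begin
        # B * # B * # B * # B          ≡⟨ *-assoc (# B * # B) (# B) (# B) ⟩
        # B * # B * (# B * # B)        ≤⟨ #⁴≤ B y ⟩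
        # (diff y B) * energy B y      ≤⟨ *-monoˡ-≤ (energy B y) (#diff≤ y y∈) ⟩
        L * # B * energy B y           ≡⟨ e L (# B) (energy B y) ⟩
        L * energy B y * # B           ∎)
        where
        e : ∀ L b e → L * b * e ≡ L * e * b
        e = solve-∀

    multiplicity : F → F → ℕ
    multiplicity c b = ∑[ y ∈ U ] ⟦ Y y ⟧ * ⟦ B (c +ᶠ y *ᶠ b) ⟧

    multiplicity≤ : ∀ c b → multiplicity c b ≤ # Y
    multiplicity≤ c b = ∑-mono′ U λ y → ≤-trans (*-monoʳ-≤ ⟦ Y y ⟧ (⟦⟧≤1 _)) (≤-reflexive (*-identityʳ _))

    incidences : F → F → ℕ
    incidences c d = ∑[ b ∈ U ] ⟦ B b ⟧ * multiplicity c (b -ᶠ d)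

    -- Each y ∈ Y has energy at least |B|³ / L because |B - y B| ≤ L |B|. The energy is a sum over c
    -- and d of the number of b with c + y (b - d) ∈ B, and averaging over c and d fixes one pair
    -- for the whole of Y.
    centre : ∃ λ c → ∃ λ d → T (B c) × T (B d) × # Y * # B ≤ L * incidences c d
    centre = average-pair (λ c d → L * incidences c d) β>0 (begin
      # B * # B * (# Y * # B)                        ≡⟨ e₁ (# B) (# Y) ⟩
      # Y * (# B * # B * # B)                        ≡⟨ ∑-*ʳ U (# B * # B * # B) _ ⟨
      (∑[ y ∈ U ] ⟦ Y y ⟧ * (# B * # B * # B))       ≤⟨ (∑-mono′ U λ y → ⟦⟧*-monoʳ (Y y) (#³≤ y)) ⟩
      (∑[ y ∈ U ] ⟦ Y y ⟧ * (L * energy B y))        ≡⟨ (∑-cong U λ y → expand y) ⟩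
      (∑[ y ∈ U ] ∑[ c ∈ U ] ∑[ d ∈ U ] ⟦ B c ⟧ * (⟦ B d ⟧ * (L * (⟦ Y y ⟧ * solutions y c d))))
        ≡⟨ trans (∑-comm U U _) (∑-cong U λ c → ∑-comm U U _) ⟩
      (∑[ c ∈ U ] ∑[ d ∈ U ] ∑[ y ∈ U ] ⟦ B c ⟧ * (⟦ B d ⟧ * (L * (⟦ Y y ⟧ * solutions y c d))))
        ≡⟨ (∑-cong U λ c → ∑-cong U λ d → trans (∑-*ˡ U ⟦ B c ⟧ _) (cong (⟦ B c ⟧ *_) (trans (∑-*ˡ U ⟦ B d ⟧ _)
             (cong (⟦ B d ⟧ *_) (trans (∑-*ˡ U L _) (cong (L *_) (collect c d))))))) ⟩
      (∑[ c ∈ U ] ∑[ d ∈ U ] ⟦ B c ⟧ * (⟦ B d ⟧ * (L * incidences c d))) ∎)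
      where
      solutions : F → F → F → ℕ
      solutions y c d = ∑[ b ∈ U ] ⟦ B b ⟧ * ⟦ B (c +ᶠ y *ᶠ (b -ᶠ d)) ⟧
      e₁ : ∀ b y → b * b * (y * b) ≡ y * (b * b * b)
      e₁ = solve-∀
      e₂ : ∀ y L c d s → y * (L * (c * (d * s))) ≡ c * (d * (L * (y * s)))
      e₂ = solve-∀
      e₃ : ∀ y b s → y * (b * s) ≡ b * (y * s)
      e₃ = solve-∀
      expand : ∀ y → ⟦ Y y ⟧ * (L * energy B y) ≡ (∑[ c ∈ U ] ∑[ d ∈ U ] ⟦ B c ⟧ * (⟦ B d ⟧ * (L * (⟦ Y y ⟧ * solutions y c d))))
      expand y = begin-equality
        ⟦ Y y ⟧ * (L * energy B y)
          ≡⟨ trans (cong (⟦ Y y ⟧ *_) (sym (trans (∑-cong U λ c → ∑-*ˡ U L _) (∑-*ˡ U L _))))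
               (sym (trans (∑-cong U λ c → ∑-*ˡ U ⟦ Y y ⟧ _) (∑-*ˡ U ⟦ Y y ⟧ _))) ⟩
        (∑[ c ∈ U ] ∑[ d ∈ U ] ⟦ Y y ⟧ * (L * (⟦ B c ⟧ * (⟦ B d ⟧ * solutions y c d))))
          ≡⟨ (∑-cong U λ c → ∑-cong U λ d → e₂ ⟦ Y y ⟧ L ⟦ B c ⟧ ⟦ B d ⟧ (solutions y c d)) ⟩
        (∑[ c ∈ U ] ∑[ d ∈ U ] ⟦ B c ⟧ * (⟦ B d ⟧ * (L * (⟦ Y y ⟧ * solutions y c d)))) ∎
      collect : ∀ c d → (∑[ y ∈ U ] ⟦ Y y ⟧ * solutions y c d) ≡ incidences c d
      collect c d = trans (∑-cong U λ y → sym (∑-*ˡ U ⟦ Y y ⟧ _)) (trans (∑-comm U U _)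
        (∑-cong U λ b → trans (∑-cong U λ y → e₃ ⟦ Y y ⟧ ⟦ B b ⟧ _) (∑-*ˡ U ⟦ B b ⟧ _)))

    module _ (c d : F) where

      rich : F → Bool
      rich b = B (b +ᶠ d) ∧ (# Y ≤ᵇ L * 2 * multiplicity c b)

      -- The elements that are not rich carry at most half of the incidences, and a rich one carries
      -- at most |Y|.
      #rich≥ : # Y * # B ≤ L * incidences c d → # B ≤ L * 2 * # rich
      #rich≥ h = *-cancelʳ-≤ _ _ (# Y) (+-cancelˡ-≤ (# B * # Y) _ _ (begin
        # B * # Y + # B * # Y                                                    ≡⟨ e₁ (# B) (# Y) ⟩
        # Y * # B * 2                                                            ≤⟨ *-monoˡ-≤ 2 h ⟩
        L * incidences c d * 2                                                   ≡⟨ e₂ L (incidences c d) ⟩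
        L * 2 * incidences c d                                                   ≡⟨ cong (L * 2 *_) (trans (sym (∑-shift d _))
          (∑-cong U λ b → cong (λ z → ⟦ B (b +ᶠ d) ⟧ * multiplicity c z) (solve 2 (λ b d → (b :+ d) :- d := b) refl b d))) ⟩
        L * 2 * (∑[ b ∈ U ] ⟦ B (b +ᶠ d) ⟧ * multiplicity c b)                   ≡⟨ ∑-*ˡ U (L * 2) _ ⟨
        (∑[ b ∈ U ] L * 2 * (⟦ B (b +ᶠ d) ⟧ * multiplicity c b))                 ≤⟨ ∑-mono′ U split ⟩
        (∑[ b ∈ U ] (⟦ B (b +ᶠ d) ⟧ * # Y + ⟦ rich b ⟧ * (L * 2 * # Y)))         ≡⟨ trans (∑-+ U _ _) (cong₂ _+_
          (trans (∑-*ʳ U (# Y) _) (cong (_* # Y) (∑-shift d (⟦_⟧ ∘ B)))) (∑-*ʳ U _ _)) ⟩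
        # B * # Y + # rich * (L * 2 * # Y)                                       ≡⟨ cong (# B * # Y +_) (e₃ (# rich) (L * 2) (# Y)) ⟩
        # B * # Y + L * 2 * # rich * # Y                                         ∎))
        where
        e₁ : ∀ b y → b * y + b * y ≡ y * b * 2
        e₁ = solve-∀
        e₂ : ∀ L s → L * s * 2 ≡ L * 2 * s
        e₂ = solve-∀
        e₃ : ∀ r l y → r * (l * y) ≡ l * r * y
        e₃ = solve-∀
        split : ∀ b → L * 2 * (⟦ B (b +ᶠ d) ⟧ * multiplicity c b) ≤ ⟦ B (b +ᶠ d) ⟧ * # Y + ⟦ rich b ⟧ * (L * 2 * # Y)
        split b with B (b +ᶠ d) | # Y ≤ᵇ L * 2 * multiplicity c b in eq
        ... | false | _     = ≤-trans (≤-reflexive (*-zeroʳ (L * 2))) z≤n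
        ... | true  | true  = ≤-trans (*-monoʳ-≤ (L * 2) (≤-trans (≤-reflexive (*-identityˡ _)) (multiplicity≤ c b)))
                                (≤-trans (≤-reflexive (sym (*-identityˡ _))) (m≤n+m _ (1 * # Y)))
        ... | true  | false = ≤-trans (≤-reflexive (cong (L * 2 *_) (*-identityˡ _)))
                                (≤-trans (≰ᵇ⇒≥ (# Y) (L * 2 * multiplicity c b) eq) (≤-trans (≤-reflexive (sym (*-identityˡ (# Y)))) (m≤m+n (1 * # Y) _)))

    -- For fixed x ≠ x′ the factor x − x′ is invertible, so that v is determined
    -- by (x − x′) v and the sum of pairWeight over v is |B − x B| |B − x′ B|.
    private
      distinct : F → F → Bool
      distinct x x′ = not (does (x ≟ᶠ x′))

      pairWeight : F → F → F → ℕ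
      pairWeight x x′ v = ∑[ p ∈ U ] ⟦ diff x B p ⟧ * ⟦ diff x′ B (p +ᶠ (x -ᶠ x′) *ᶠ v) ⟧

    weight : F → ℕ
    weight v = ∑[ x ∈ U ] ∑[ x′ ∈ U ] ⟦ Y x ⟧ * (⟦ Y x′ ⟧ * (⟦ distinct x x′ ⟧ * pairWeight x x′ v))

    ∑weight≤ : ∑ U weight ≤ # Y * # Y * (L * # B * (L * # B))
    ∑weight≤ = begin
      ∑ U weight
        ≡⟨ trans (∑-comm U U _) (∑-cong U λ x → ∑-comm U U _) ⟩
      (∑[ x ∈ U ] ∑[ x′ ∈ U ] ∑[ v ∈ U ] ⟦ Y x ⟧ * (⟦ Y x′ ⟧ * (⟦ distinct x x′ ⟧ * pairWeight x x′ v)))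
        ≡⟨ (∑-cong U λ x → ∑-cong U λ x′ → trans (∑-*ˡ U ⟦ Y x ⟧ _) (cong (⟦ Y x ⟧ *_) (trans (∑-*ˡ U ⟦ Y x′ ⟧ _) (cong (⟦ Y x′ ⟧ *_) (∑-*ˡ U ⟦ distinct x x′ ⟧ _))))) ⟩
      (∑[ x ∈ U ] ∑[ x′ ∈ U ] ⟦ Y x ⟧ * (⟦ Y x′ ⟧ * (⟦ distinct x x′ ⟧ * ∑ U (pairWeight x x′))))
        ≤⟨ (∑-mono′ U λ x → ∑-mono′ U λ x′ → ⟦⟧*-monoʳ (Y x) λ x∈ → ⟦⟧*-monoʳ (Y x′) λ x′∈ → bound x x′ x∈ x′∈) ⟩
      (∑[ x ∈ U ] ∑[ x′ ∈ U ] ⟦ Y x ⟧ * (⟦ Y x′ ⟧ * M))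
        ≡⟨ ∑-* U U _ _ ⟨
      # Y * (∑[ x′ ∈ U ] ⟦ Y x′ ⟧ * M)
        ≡⟨ trans (cong (# Y *_) (∑-*ʳ U M _)) (sym (*-assoc (# Y) (# Y) M)) ⟩
      # Y * # Y * M ∎
      where
      M : ℕ
      M = L * # B * (L * # B)
      bound : ∀ x x′ → T (Y x) → T (Y x′) → ⟦ distinct x x′ ⟧ * ∑ U (pairWeight x x′) ≤ M
      bound x x′ x∈ x′∈ with x ≟ᶠ x′
      ... | yes _   = z≤n
      ... | no x≢x′ = begin
        1 * ∑ U (pairWeight x x′)            ≡⟨ *-identityˡ _ ⟩
        ∑ U (pairWeight x x′)                ≡⟨ ∑-comm U U _ ⟩
        (∑[ p ∈ U ] ∑[ v ∈ U ] ⟦ diff x B p ⟧ * ⟦ diff x′ B (p +ᶠ (x -ᶠ x′) *ᶠ v) ⟧)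
          ≡⟨ (∑-cong U λ p → trans (∑-*ˡ U ⟦ diff x B p ⟧ _) (cong (⟦ diff x B p ⟧ *_) (trans
               (∑-dilate x-x′≢0 (λ w → ⟦ diff x′ B (p +ᶠ w) ⟧)) (trans
               (∑-cong U λ w → cong (λ z → ⟦ diff x′ B z ⟧) (solve 2 (λ p w → p :+ w := w :+ p) refl p w))
               (∑-shift p (⟦_⟧ ∘ diff x′ B)))))) ⟩
        (∑[ p ∈ U ] ⟦ diff x B p ⟧ * # (diff x′ B))
          ≡⟨ ∑-*ʳ U _ _ ⟩
        # (diff x B) * # (diff x′ B)         ≤⟨ *-mono-≤ (#diff≤ x x∈) (#diff≤ x′ x′∈) ⟩
        M                                    ∎
        where
        x-x′≢0 : x -ᶠ x′ ≢ 0ᶠ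
        x-x′≢0 h = x≢x′ (trans (solve 2 (λ x x′ → x := (x :- x′) :+ x′) refl x x′) (trans (cong (_+ᶠ x′) h) (+ᶠ-identityˡ x′)))

    module _ (c : F) {α b y : F} (α∈ : T (B α)) (y∈ : T (Y y)) where

      private
        member : F → Bool
        member x = Y x ∧ B (c +ᶠ x *ᶠ b)

        ν : ℕ
        ν = multiplicity c b

        #member : # member ≡ ν
        #member = ∑-cong U λ x → ⟦∧⟧ (Y x) _

        point : F → F
        point x = y *ᶠ (c +ᶠ x *ᶠ b)

        h : F → ℕ
        h z = ∑[ x ∈ U ] ⟦ member x ⟧ * ⟦ B (z +ᶠ point x) ⟧

        ∑h : ∑ U h ≡ ν * # B
        ∑h = trans (∑-comm U U _) (trans
          (∑-cong U λ x → trans (∑-*ˡ U ⟦ member x ⟧ _) (cong (⟦ member x ⟧ *_) (∑-shift (point x) (⟦_⟧ ∘ B))))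
          (trans (∑-*ʳ U (# B) _) (cong (_* # B) #member)))

        support : ∀ z → h z ≡ ⟦ diff y B z ⟧ * h z
        support z with diff y B z in eq
        ... | true  = sym (*-identityˡ _)
        ... | false = n≤0⇒n≡0 (≤-trans (∑-mono′ U none) (≤-reflexive (∑-zero U)))
          where
          none : ∀ x → ⟦ member x ⟧ * ⟦ B (z +ᶠ point x) ⟧ ≤ 0
          none x = ⟦⟧*-≤ (member x) (λ m∈ → absurd m∈)
            where
            absurd : T (member x) → ⟦ B (z +ᶠ point x) ⟧ ≤ 0
            absurd m∈ with B (z +ᶠ point x) in eqB
            ... | false = z≤n
            ... | true  = ⊥-elim (subst T (trans (cong (diff y B) (solve 2 (λ z w → (z :+ w) :- w := z) refl z (point x))) eq)
              (image⁺ {λ b c → b -ᶠ y *ᶠ c} {B} {B} (subst T (sym eqB) _) (proj₂ (T-∧⁻ {Y x} m∈))))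

        -- Each `point x` with x a member lies in y B, so `h` is supported on B - y B, a set of at
        -- most L |B| elements, and has total ν |B|.
        ν²≤ : ν * ν * # B ≤ L * (∑[ z ∈ U ] h z * h z)
        ν²≤ = *-cancelʳ-≤ _ _ (# B) (begin
          ν * ν * # B * # B                              ≡⟨ e₁ ν (# B) ⟩
          ν * # B * (ν * # B)                            ≡⟨ cong (λ s → s * s) (trans (sym ∑h) (∑-cong U support)) ⟩
          (∑[ z ∈ U ] ⟦ diff y B z ⟧ * h z) * (∑[ z ∈ U ] ⟦ diff y B z ⟧ * h z)
                                                         ≤⟨ cauchySchwarz U (⟦_⟧ ∘ diff y B) h ⟩
          (∑[ z ∈ U ] ⟦ diff y B z ⟧ * ⟦ diff y B z ⟧) * (∑[ z ∈ U ] h z * h z)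
                                                         ≡⟨ cong (_* (∑[ z ∈ U ] h z * h z)) (∑-cong U λ z → ⟦⟧*⟦⟧ (diff y B z)) ⟩
          # (diff y B) * (∑[ z ∈ U ] h z * h z)          ≤⟨ *-monoˡ-≤ _ (#diff≤ y y∈) ⟩
          L * # B * (∑[ z ∈ U ] h z * h z)               ≡⟨ e₂ L (# B) _ ⟩
          L * (∑[ z ∈ U ] h z * h z) * # B               ∎)
          where
          e₁ : ∀ n b → n * n * b * b ≡ n * b * (n * b)
          e₁ = solve-∀
          e₂ : ∀ L b s → L * b * s ≡ L * s * b
          e₂ = solve-∀

        common : F → F → ℕ
        common x x′ = ∑[ z ∈ U ] ⟦ B (z +ᶠ point x) ⟧ * ⟦ B (z +ᶠ point x′) ⟧

        common≤# : ∀ x x′ → common x x′ ≤ # B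
        common≤# x x′ = ≤-trans (∑-mono′ U λ z → ≤-trans (*-monoʳ-≤ ⟦ B (z +ᶠ point x) ⟧ (⟦⟧≤1 _)) (≤-reflexive (*-identityʳ _)))
          (≤-reflexive (∑-shift (point x) (⟦_⟧ ∘ B)))

        -- The points are crossed: x α is subtracted from z + point x′, and x′ α from z + point x.
        -- The results lie in B - x B and B - x′ B, and by commutativity they differ by (x - x′) (α
        -- + y b). So the whole sum α + y b is detected and not only y b.
        common≤pairWeight : ∀ x x′ → common x x′ ≤ pairWeight x x′ (α +ᶠ y *ᶠ b)
        common≤pairWeight x x′ = begin
          common x x′
            ≤⟨ (∑-mono′ U λ z → ≤-trans (≤-reflexive (*-comm ⟦ B (z +ᶠ point x) ⟧ _)) (*-mono-≤
                 (⟦⟧-mono (λ p → image⁺ {λ b c → b -ᶠ x *ᶠ c} {B} {B} p α∈))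
                 (⟦⟧-mono (λ p → image⁺ {λ b c → b -ᶠ x′ *ᶠ c} {B} {B} p α∈)))) ⟩
          (∑[ z ∈ U ] ⟦ diff x B ((z +ᶠ point x′) -ᶠ x *ᶠ α) ⟧ * ⟦ diff x′ B ((z +ᶠ point x) -ᶠ x′ *ᶠ α) ⟧)
            ≡⟨ (∑-cong U λ z → cong₂ (λ p r → ⟦ diff x B p ⟧ * ⟦ diff x′ B r ⟧)
                 (solve 4 (λ z w x α → (z :+ w) :- x :* α := z :+ (w :- x :* α)) refl z (point x′) x α)
                 (solve 7 (λ z y c x b x′ α → (z :+ y :* (c :+ x :* b)) :- x′ :* α :=
                    (z :+ (y :* (c :+ x′ :* b) :- x :* α)) :+ (x :- x′) :* (α :+ y :* b)) refl z y c x b x′ α)) ⟩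
          (∑[ z ∈ U ] ⟦ diff x B (z +ᶠ (point x′ -ᶠ x *ᶠ α)) ⟧ * ⟦ diff x′ B ((z +ᶠ (point x′ -ᶠ x *ᶠ α)) +ᶠ (x -ᶠ x′) *ᶠ (α +ᶠ y *ᶠ b)) ⟧)
            ≡⟨ ∑-shift (point x′ -ᶠ x *ᶠ α) (λ p → ⟦ diff x B p ⟧ * ⟦ diff x′ B (p +ᶠ (x -ᶠ x′) *ᶠ (α +ᶠ y *ᶠ b)) ⟧) ⟩
          pairWeight x x′ (α +ᶠ y *ᶠ b) ∎

        -- The diagonal x = x′, where x - x′ is not invertible, is split off. It gets the trivial
        -- bound |B| for each of the ν members.
        ∑h²≤ : (∑[ z ∈ U ] h z * h z) ≤ ν * # B + weight (α +ᶠ y *ᶠ b)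
        ∑h²≤ = begin
          (∑[ z ∈ U ] h z * h z)
            ≡⟨ trans (∑-cong U λ z → ∑-* U U _ _) (trans (∑-comm U U _) (∑-cong U λ x → ∑-comm U U _)) ⟩
          (∑[ x ∈ U ] ∑[ x′ ∈ U ] ∑[ z ∈ U ] ⟦ member x ⟧ * ⟦ B (z +ᶠ point x) ⟧ * (⟦ member x′ ⟧ * ⟦ B (z +ᶠ point x′) ⟧))
            ≡⟨ (∑-cong U λ x → ∑-cong U λ x′ → trans (∑-cong U λ z → e₁ ⟦ member x ⟧ _ ⟦ member x′ ⟧ _)
                 (trans (∑-*ˡ U ⟦ member x ⟧ _) (cong (⟦ member x ⟧ *_) (∑-*ˡ U ⟦ member x′ ⟧ _)))) ⟩
          (∑[ x ∈ U ] ∑[ x′ ∈ U ] ⟦ member x ⟧ * (⟦ member x′ ⟧ * common x x′))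
            ≤⟨ (∑-mono′ U λ x → ∑-mono′ U λ x′ → split x x′) ⟩
          (∑[ x ∈ U ] ∑[ x′ ∈ U ] (⟦ member x ⟧ * # B * ⟦ does (x ≟ᶠ x′) ⟧ + ⟦ Y x ⟧ * (⟦ Y x′ ⟧ * (⟦ distinct x x′ ⟧ * pairWeight x x′ v))))
            ≡⟨ trans (∑-cong U λ x → ∑-+ U _ _) (∑-+ U _ _) ⟩
          (∑[ x ∈ U ] ∑[ x′ ∈ U ] ⟦ member x ⟧ * # B * ⟦ does (x ≟ᶠ x′) ⟧) + weight v
            ≡⟨ cong (_+ weight v) (trans (∑-cong U λ x → trans (∑-*ˡ U (⟦ member x ⟧ * # B) _) (trans (cong (⟦ member x ⟧ * # B *_) (∑-point x)) (*-identityʳ _)))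
                 (trans (∑-*ʳ U (# B) _) (cong (_* # B) #member))) ⟩
          ν * # B + weight v ∎
          where
          v : F
          v = α +ᶠ y *ᶠ b
          e₁ : ∀ m p m′ p′ → m * p * (m′ * p′) ≡ m * (m′ * (p * p′))
          e₁ = solve-∀
          member⊆Y : ∀ x → T (member x) → T (Y x)
          member⊆Y x p = proj₁ (T-∧⁻ {Y x} p)
          split : ∀ x x′ → ⟦ member x ⟧ * (⟦ member x′ ⟧ * common x x′) ≤
            ⟦ member x ⟧ * # B * ⟦ does (x ≟ᶠ x′) ⟧ + ⟦ Y x ⟧ * (⟦ Y x′ ⟧ * (⟦ distinct x x′ ⟧ * pairWeight x x′ v))
          split x x′ with does (x ≟ᶠ x′)
          ... | true  = ≤-trans (*-monoʳ-≤ ⟦ member x ⟧ (≤-trans (⟦⟧*≤ (member x′) _) (common≤# x x′)))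
                          (≤-trans (≤-reflexive (sym (*-identityʳ _))) (m≤m+n (⟦ member x ⟧ * # B * 1) _))
          ... | false = ≤-trans (*-mono-≤ (⟦⟧-mono (member⊆Y x)) (*-mono-≤ (⟦⟧-mono (member⊆Y x′))
                            (≤-trans (common≤pairWeight x x′) (≤-reflexive (sym (*-identityˡ _))))))
                          (m≤n+m _ (⟦ member x ⟧ * # B * 0))

      -- From 4 L² ≤ |Y| ≤ 2 L ν follows 2 L ≤ ν. Hence the diagonal term L ν |B| is at most half of
      -- ν² |B| and is absorbed.
      weight≥ : # Y ≤ L * 2 * ν → L * L * 4 ≤ # Y → # Y * # Y * # B ≤ L * L * L * 8 * weight (α +ᶠ y *ᶠ b)
      weight≥ rich large = begin
        # Y * # Y * # B                      ≤⟨ *-monoˡ-≤ (# B) (*-mono-≤ rich rich) ⟩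
        L * 2 * ν * (L * 2 * ν) * # B        ≡⟨ e₁ L ν (# B) ⟩
        L * L * 4 * (ν * ν * # B)            ≤⟨ *-monoʳ-≤ (L * L * 4) ν²#B≤ ⟩
        L * L * 4 * (L * 2 * w)              ≡⟨ e₂ L w ⟩
        L * L * L * 8 * w                    ∎
        where
        w : ℕ
        w = weight (α +ᶠ y *ᶠ b)
        e₁ : ∀ L n b → L * 2 * n * (L * 2 * n) * b ≡ L * L * 4 * (n * n * b)
        e₁ = solve-∀
        e₂ : ∀ L w → L * L * 4 * (L * 2 * w) ≡ L * L * L * 8 * w
        e₂ = solve-∀
        e₃ : ∀ L → L * 2 * (L * 2) ≡ L * L * 4
        e₃ = solve-∀
        e₄ : ∀ n b → n * n * b + n * n * b ≡ n * n * b * 2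
        e₄ = solve-∀
        e₅ : ∀ L n b w → L * (n * b + w) * 2 ≡ L * 2 * n * b + L * 2 * w
        e₅ = solve-∀
        2L≤ν : L * 2 ≤ ν
        2L≤ν = *-cancelˡ-≤ (L * 2) (≤-trans (≤-reflexive (e₃ L)) (≤-trans large rich))
        ν²#B≤ : ν * ν * # B ≤ L * 2 * w
        ν²#B≤ = +-cancelˡ-≤ (ν * ν * # B) _ _ (begin
          ν * ν * # B + ν * ν * # B          ≡⟨ e₄ ν (# B) ⟩
          ν * ν * # B * 2                    ≤⟨ *-monoˡ-≤ 2 (≤-trans ν²≤ (*-monoʳ-≤ L ∑h²≤)) ⟩
          L * (ν * # B + w) * 2              ≡⟨ e₅ L ν (# B) w ⟩
          L * 2 * ν * # B + L * 2 * w        ≤⟨ +-monoˡ-≤ (L * 2 * w) (*-monoˡ-≤ (# B) (*-monoˡ-≤ ν 2L≤ν)) ⟩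
          ν * ν * # B + L * 2 * w            ∎)

    -- Since a + d ∈ B for a ∈ A₁, the shifted sum s + d has the form α + y b and so has weight at
    -- least |Y|² |B| / (8 L³). The total weight is at most |Y|² L² |B|², and |Y| cancels.
    #sumProduct≤ : ∀ c d → L * L * 4 ≤ # Y →
      # (image _+ᶠ_ (rich c d) (image _*ᶠ_ Y (rich c d))) ≤ L * L * L * L * L * 8 * # B
    #sumProduct≤ c d large = *-cancelʳ-≤ _ _ (# Y * # Y * # B) (begin
      # S * (# Y * # Y * # B)                              ≤⟨ count*≤∑ U S many ⟩
      (∑[ s ∈ U ] L * L * L * 8 * weight (s +ᶠ d))         ≡⟨ trans (∑-*ˡ U (L * L * L * 8) _) (cong (L * L * L * 8 *_) (∑-shift d weight)) ⟩
      L * L * L * 8 * ∑ U weight                           ≤⟨ *-monoʳ-≤ (L * L * L * 8) ∑weight≤ ⟩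
      L * L * L * 8 * (# Y * # Y * (L * # B * (L * # B)))  ≡⟨ e L (# Y) (# B) ⟩
      L * L * L * L * L * 8 * # B * (# Y * # Y * # B)      ∎)
      where
      S : F → Bool
      S = image _+ᶠ_ (rich c d) (image _*ᶠ_ Y (rich c d))
      e : ∀ L y b → L * L * L * 8 * (y * y * (L * b * (L * b))) ≡ L * L * L * L * L * 8 * b * (y * y * b)
      e = solve-∀
      many : ∀ s → T (S s) → # Y * # Y * # B ≤ L * L * L * 8 * weight (s +ᶠ d)
      many s s∈ with image⁻ {_+ᶠ_} {rich c d} {image _*ᶠ_ Y (rich c d)} s∈
      ... | a , p , a∈ , p∈ , refl with image⁻ {_*ᶠ_} {Y} {rich c d} p∈
      ...   | y , b , y∈ , b∈ , refl = ≤-trans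
        (weight≥ c {a +ᶠ d} {b} {y} (proj₁ (T-∧⁻ {B (a +ᶠ d)} a∈)) y∈ (≤ᵇ⇒≤ _ _ (proj₂ (T-∧⁻ {B (b +ᶠ d)} b∈))) large)
        (≤-reflexive (cong (λ v → L * L * L * 8 * weight v) (solve 3 (λ a d p → (a :+ d) :+ p := (a :+ p) :+ d) refl a d (y *ᶠ b))))

-- Bookkeeping of constants and the choice of A₁

^-distribʳ-* : ∀ e m n → (m * n) ^ e ≡ m ^ e * n ^ e
^-distribʳ-* zero    m n = refl
^-distribʳ-* (suc e) m n = trans (cong (m * n *_) (^-distribʳ-* e m n)) (interchange m n (m ^ e) (n ^ e))
  where
  interchange : ∀ a b c d → (a * b) * (c * d) ≡ (a * c) * (b * d)
  interchange = solve-∀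

-- The constants of the construction are kept as monomials c kᵉ, whose numerals
-- c are only evaluated at the end.
module Monomials (k : ℕ) where

  record Monomial (e c x : ℕ) : Set where
    constructor monomial
    field value : x ≡ k ^ e * c

  infixl 7 _⊗_
  infixr 6 _▹_

  var : Monomial 1 1 k
  var = monomial (sym (trans (*-identityʳ (k * 1)) (*-identityʳ k)))

  con : ∀ c → Monomial 0 c c
  con c = monomial (sym (*-identityˡ c))

  _⊗_ : ∀ {e e′ c c′ x x′} → Monomial e c x → Monomial e′ c′ x′ → Monomial (e + e′) (c * c′) (x * x′)
  _⊗_ {e} {e′} {c} {c′} (monomial refl) (monomial refl) = monomial (trans (interchange (k ^ e) c (k ^ e′) c′)
    (cong (_* (c * c′)) (sym (^-distribˡ-+-* k e e′))))
    where
    interchange : ∀ a b c d → (a * b) * (c * d) ≡ (a * c) * (b * d)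
    interchange = solve-∀

  _▹_ : ∀ {e c x y} → x ≡ y → Monomial e c y → Monomial e c x
  refl ▹ m = m

  positive : ∀ {e c x} → Monomial e c x → 0 < k → T (not (c ≡ᵇ 0)) → 0 < x
  positive {e} {c} (monomial refl) k>0 c≢0 = >-nonZero⁻¹ (k ^ e * c)
    {{m*n≢0 (k ^ e) c {{m^n≢0 k e {{>-nonZero k>0}}}} {{record { nonZero = c≢0 }}}}}

  -- As k is a multiple m κ, the power m^e joins the numeral c, and κ^e is rounded up to the
  -- exponent E that the theorem allows.
  evaluate : ∀ E {e c x κ m C} → Monomial e c x → k ≡ κ * m → 0 < κ → e ≤ E → m ^ e * c ≤ C → x ≤ C * κ ^ E
  evaluate E {e} {c} {x} {κ} {m} {C} (monomial refl) refl κ>0 e≤E h = begin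
    (κ * m) ^ e * c            ≡⟨ cong (_* c) (^-distribʳ-* e κ m) ⟩
    κ ^ e * m ^ e * c          ≡⟨ *-assoc (κ ^ e) (m ^ e) c ⟩
    κ ^ e * (m ^ e * c)        ≤⟨ *-mono-≤ (^-monoʳ-≤ κ {{>-nonZero κ>0}} e≤E) h ⟩
    κ ^ E * C                  ≡⟨ *-comm (κ ^ E) C ⟩
    C * κ ^ E                  ∎

module Combination {q : ℕ} (𝔽 : IndexField q) where

  open IndexField 𝔽
  open DifferenceSolver commutativeRing
  open FieldCounting 𝔽
  open IsCommutativeRing isCommutativeRing using () renaming (zeroˡ to *ᶠ-zeroˡ)

  #-mono : ∀ {S S′ : F → Bool} t → (∀ s → T (S s) → T (S′ (s +ᶠ t))) → # S ≤ # S′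
  #-mono {S} {S′} t h = ≤-trans (∑-mono′ U λ s → ⟦⟧-mono (h s)) (≤-reflexive (∑-shift t (⟦_⟧ ∘ S′)))

  module _ (a X : F → Bool) (K : ℕ) where

    open PopularDifferences 𝔽 a K using (n; k)
    open DenseDifferences 𝔽 a X K using (x; D₀; D₀≡; Ω; edge; edge⊆a)
    open CommonDilates 𝔽 a X K using (L; L≡; Dilates; dilates)
    open DependentChoice Ω U edge a (λ {ω} {b} → edge⊆a {ω} {b}) k using (t≡)
    open Monomials k

    D₀-monomial : Monomial 9 _ D₀
    D₀-monomial = D₀≡ ▹ var ⊗ con 6 ⊗ (t-monomial ⊗ t-monomial) ⊗ (var ⊗ var ⊗ (var ⊗ var))
      where
      t-monomial : Monomial 2 _ _
      t-monomial = t≡ ▹ var ⊗ var ⊗ con 8 ⊗ con 16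

    L-monomial : Monomial 25 _ L
    L-monomial = L≡ ▹ var ⊗ var ⊗ con 8 ⊗ (D₀-monomial ⊗ var ⊗ (D₀-monomial ⊗ var)) ⊗
      (var ⊗ con 6 ⊗ (var ⊗ con 6) ⊗ (var ⊗ con 6))

    -- Bounds relative to |B| become relative to |A₁| at the cost of a factor 2 L. The degrees in k
    -- are 26 for |A|, 150 for A₁ + Y A₁, 55 and 35 for A₁ + A₁ and A₁ - A₁, 100 and 50 for A₁ + y
    -- A₁ and A₁ - y A₁, below the 85, 226, 92 and 126 allowed.
    record Combined : Set where
      field
        d η   : F
        A₁ Y  : F → Bool
        d∈a   : T (a d)
        η∈X   : T (X η)
        A₁⊆   : ∀ b → T (A₁ b) → T (a (b +ᶠ d))
        Y⊆    : ∀ y → T (Y y) → T (X (η *ᶠ y))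
        n≤    : n ≤ k * 6 * (L * 2) * # A₁
        x≤    : x ≤ k * k * 8 * # Y
        A₁+YA₁≤ : # (image _+ᶠ_ A₁ (image _*ᶠ_ Y A₁)) ≤ L * L * L * L * L * 8 * (L * 2) * # A₁
        A₁+A₁≤ : # (image _+ᶠ_ A₁ A₁) ≤ D₀ * (k * 6) * (D₀ * (k * 6)) * (D₀ * (k * 6)) * (L * 2) * # A₁
        A₁-A₁≤ : # (image _-ᶠ_ A₁ A₁) ≤ D₀ * (k * 6) * (L * 2) * # A₁
        A₁+yA₁≤ : ∀ y → T (Y y) → # (image (λ a b → a +ᶠ y *ᶠ b) A₁ A₁) ≤ L * L * L * (L * 2) * # A₁
        A₁-yA₁≤ : ∀ y → T (Y y) → # (image (λ a b → a -ᶠ y *ᶠ b) A₁ A₁) ≤ L * (L * 2) * # A₁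

    module _ (n>0 : 0 < n) (x>0 : 0 < x) (k>0 : 0 < k)
             (X≢0 : ∀ {ξ} → T (X ξ) → ξ ≢ 0ᶠ)
             (energetic : ∀ {ξ} → T (X ξ) → n * n * n ≤ K * energy a ξ) where

      private
        module Fix (𝒟 : Dilates) where
          open Dilates 𝒟
          open Stabilizers 𝔽 B

          β>0 : 0 < # B
          β>0 = n≢0⇒n>0 (λ β≡0 → <⇒≱ n>0 (≤-trans n≤ (≤-reflexive (trans (cong (k * 6 *_) β≡0) (*-zeroʳ (k * 6))))))

          Y>0 : 0 < # Y
          Y>0 = n≢0⇒n>0 (λ Y≡0 → <⇒≱ x>0 (≤-trans x≤ (≤-reflexive (trans (cong (k * k * 8 *_) Y≡0) (*-zeroʳ (k * k * 8))))))

          L>0 : 0 < L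
          L>0 = positive L-monomial k>0 _

          -- A nonzero element of X exists, and it would vanish if 1 did.
          1≢0 : 1ᶠ ≢ 0ᶠ
          1≢0 1≡0 = X≢0 η∈X (trans (sym (*ᶠ-identityˡ η)) (trans (cong (_*ᶠ η) 1≡0) (*ᶠ-zeroˡ η)))

          y≢0 : ∀ {y} → T (Y y) → y ≢ 0ᶠ
          y≢0 {y} y∈ y≡0 = X≢0 (Y⊆ y y∈) (trans (cong (η *ᶠ_) y≡0) (*ᶠ-zeroʳ η))

          -- The doubling constant of B for differences, unrelated to the Λ of the theorem.
          Λ : ℕ
          Λ = D₀ * (k * 6)

          #Δ≤Λ : # (diff 1ᶠ B) ≤ Λ * # B
          #Δ≤Λ = begin
            # (diff 1ᶠ B)          ≤⟨ #Δ≤ ⟩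
            D₀ * n                 ≤⟨ *-monoʳ-≤ D₀ n≤ ⟩
            D₀ * (k * 6 * # B)     ≡⟨ *-assoc D₀ (k * 6) (# B) ⟨
            Λ * # B                ∎

          combine : (∃ λ c → ∃ λ d → T (B c) × T (B d) × # Y * # B ≤ L * incidences Y L β>0 Y>0 L>0 #dilates≤ c d) → Combined
          combine (c , d , _ , d∈ , many) = record
            { d = d ; η = η ; A₁ = A₁ ; Y = Y ; d∈a = B⊆a d d∈ ; η∈X = η∈X
            ; A₁⊆ = λ b b∈ → B⊆a (b +ᶠ d) (A₁⊆B b∈) ; Y⊆ = Y⊆
            ; n≤ = relative (k * 6) n≤
            ; x≤ = x≤
            ; A₁+YA₁≤ = relative (L * L * L * L * L * 8) sumProduct
            ; A₁+A₁≤ = relative (Λ * Λ * Λ) (≤-trans (#-mono (d +ᶠ d) (λ s s∈ → sums (image⁻ {_+ᶠ_} {A₁} {A₁} s∈))) (#plus≤ β>0 {1ᶠ} {Λ} 1≢0 #Δ≤Λ))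
            ; A₁-A₁≤ = relative Λ (≤-trans (#-mono (d -ᶠ d) (λ s s∈ → differences (image⁻ {_-ᶠ_} {A₁} {A₁} s∈))) #Δ≤Λ)
            ; A₁+yA₁≤ = λ y y∈ → relative (L * L * L) (plus-y y y∈)
            ; A₁-yA₁≤ = λ y y∈ → relative L (≤-trans (#-mono (d -ᶠ y *ᶠ d) (λ s s∈ → minus y (image⁻ {λ a b → a -ᶠ y *ᶠ b} {A₁} {A₁} s∈))) (#dilates≤ y y∈))
            }
            where
            A₁ : F → Bool
            A₁ = rich Y L β>0 Y>0 L>0 #dilates≤ c d
            A₁⊆B : ∀ {b} → T (A₁ b) → T (B (b +ᶠ d))
            A₁⊆B {b} p = proj₁ (T-∧⁻ {B (b +ᶠ d)} p)
            relative : ∀ {m} M → m ≤ M * # B → m ≤ M * (L * 2) * # A₁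
            relative {m} M h = begin
              m                        ≤⟨ h ⟩
              M * # B                  ≤⟨ *-monoʳ-≤ M (#rich≥ Y L β>0 Y>0 L>0 #dilates≤ c d many) ⟩
              M * (L * 2 * # A₁)       ≡⟨ *-assoc M (L * 2) (# A₁) ⟨
              M * (L * 2) * # A₁       ∎
            sums : ∀ {s} → (∃ λ a → ∃ λ b → T (A₁ a) × T (A₁ b) × a +ᶠ b ≡ s) → T (plus 1ᶠ (s +ᶠ (d +ᶠ d)))
            sums (a , b , a∈ , b∈ , refl) = subst (T ∘ plus 1ᶠ)
              (trans (cong (a +ᶠ d +ᶠ_) (*ᶠ-identityˡ (b +ᶠ d))) (solve 3 (λ a b d → (a :+ d) :+ (b :+ d) := (a :+ b) :+ (d :+ d)) refl a b d))
              (image⁺ {λ b c → b +ᶠ 1ᶠ *ᶠ c} {B} {B} (A₁⊆B a∈) (A₁⊆B b∈))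
            differences : ∀ {s} → (∃ λ a → ∃ λ b → T (A₁ a) × T (A₁ b) × a -ᶠ b ≡ s) → T (diff 1ᶠ B (s +ᶠ (d -ᶠ d)))
            differences (a , b , a∈ , b∈ , refl) = subst (T ∘ diff 1ᶠ B)
              (trans (cong (λ z → (a +ᶠ d) -ᶠ z) (*ᶠ-identityˡ (b +ᶠ d))) (solve 3 (λ a b d → (a :+ d) :- (b :+ d) := (a :- b) :+ (d :- d)) refl a b d))
              (image⁺ {λ b c → b -ᶠ 1ᶠ *ᶠ c} {B} {B} (A₁⊆B a∈) (A₁⊆B b∈))
            minus : ∀ y {s} → (∃ λ a → ∃ λ b → T (A₁ a) × T (A₁ b) × a -ᶠ y *ᶠ b ≡ s) → T (diff y B (s +ᶠ (d -ᶠ y *ᶠ d)))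
            minus y (a , b , a∈ , b∈ , refl) = subst (T ∘ diff y B)
              (solve 4 (λ a b d y → (a :+ d) :- y :* (b :+ d) := (a :- y :* b) :+ (d :- y :* d)) refl a b d y)
              (image⁺ {λ b c → b -ᶠ y *ᶠ c} {B} {B} (A₁⊆B a∈) (A₁⊆B b∈))
            sums-y : ∀ y {s} → (∃ λ a → ∃ λ b → T (A₁ a) × T (A₁ b) × a +ᶠ y *ᶠ b ≡ s) → T (plus y (s +ᶠ (d +ᶠ y *ᶠ d)))
            sums-y y (a , b , a∈ , b∈ , refl) = subst (T ∘ plus y)
              (solve 4 (λ a b d y → (a :+ d) :+ y :* (b :+ d) := (a :+ y :* b) :+ (d :+ y :* d)) refl a b d y)
              (image⁺ {λ b c → b +ᶠ y *ᶠ c} {B} {B} (A₁⊆B a∈) (A₁⊆B b∈))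
            A₁+yA₁ : F → F → Bool
            A₁+yA₁ y = image (λ a b → a +ᶠ y *ᶠ b) A₁ A₁
            plus-y : ∀ y → T (Y y) → # (A₁+yA₁ y) ≤ L * L * L * # B
            plus-y y y∈ = ≤-trans (#-mono (d +ᶠ y *ᶠ d) (λ s s∈ → sums-y y (image⁻ {λ a b → a +ᶠ y *ᶠ b} {A₁} {A₁} s∈))) (#plus≤ β>0 {y} {L} (y≢0 y∈) (#dilates≤ y y∈))
            sumProduct : # (image _+ᶠ_ A₁ (image _*ᶠ_ Y A₁)) ≤ L * L * L * L * L * 8 * # B
            sumProduct with ≤-total (L * L * 4) (# Y)
            ... | inj₁ large = #sumProduct≤ Y L β>0 Y>0 L>0 #dilates≤ c d large
            ... | inj₂ small = begin
              # (image _+ᶠ_ A₁ (image _*ᶠ_ Y A₁))                  ≤⟨ ∑-mono′ U cover ⟩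
              (∑[ s ∈ U ] ∑[ y ∈ U ] ⟦ Y y ⟧ * ⟦ A₁+yA₁ y s ⟧)     ≡⟨ trans (∑-comm U U _) (∑-cong U λ y → ∑-*ˡ U ⟦ Y y ⟧ _) ⟩
              (∑[ y ∈ U ] ⟦ Y y ⟧ * # (A₁+yA₁ y))                  ≤⟨ (∑-mono′ U λ y → ⟦⟧*-monoʳ (Y y) (plus-y y)) ⟩
              (∑[ y ∈ U ] ⟦ Y y ⟧ * (L * L * L * # B))             ≡⟨ ∑-*ʳ U _ _ ⟩
              -- 4 L² is relaxed to 8 L² so that both cases end with the same constant.
              # Y * (L * L * L * # B)                              ≤⟨ *-monoˡ-≤ (L * L * L * # B) (≤-trans small (*-monoʳ-≤ (L * L) (m≤m+n 4 4))) ⟩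
              L * L * 8 * (L * L * L * # B)                        ≡⟨ e L (# B) ⟩
              L * L * L * L * L * 8 * # B                          ∎
              where
              e : ∀ L b → L * L * 8 * (L * L * L * b) ≡ L * L * L * L * L * 8 * b
              e = solve-∀
              pick : ∀ {s} y → T (Y y) → T (A₁+yA₁ y s) → 1 ≤ (∑[ y ∈ U ] ⟦ Y y ⟧ * ⟦ A₁+yA₁ y s ⟧)
              pick {s} y y∈ s∈ = begin
                1                                                      ≡⟨ ∑-point y ⟨
                (∑[ z ∈ U ] ⟦ does (y ≟ᶠ z) ⟧)                         ≤⟨ ∑-mono′ U at ⟩
                (∑[ z ∈ U ] ⟦ Y z ⟧ * ⟦ A₁+yA₁ z s ⟧)                  ∎
                where
                at : ∀ z → ⟦ does (y ≟ᶠ z) ⟧ ≤ ⟦ Y z ⟧ * ⟦ A₁+yA₁ z s ⟧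
                at z with y ≟ᶠ z
                ... | yes refl = ≤-reflexive (sym (cong₂ _*_ (T⇒⟦⟧≡1 y∈) (T⇒⟦⟧≡1 s∈)))
                ... | no _     = z≤n
              cover : ∀ s → ⟦ image _+ᶠ_ A₁ (image _*ᶠ_ Y A₁) s ⟧ ≤ (∑[ y ∈ U ] ⟦ Y y ⟧ * ⟦ A₁+yA₁ y s ⟧)
              cover s = ≤-trans (≤-reflexive (sym (*-identityʳ _))) (⟦⟧*-≤ (image _+ᶠ_ A₁ (image _*ᶠ_ Y A₁) s) inside)
                where
                inside : T (image _+ᶠ_ A₁ (image _*ᶠ_ Y A₁) s) → 1 ≤ (∑[ y ∈ U ] ⟦ Y y ⟧ * ⟦ A₁+yA₁ y s ⟧)
                inside s∈ with image⁻ {_+ᶠ_} {A₁} {image _*ᶠ_ Y A₁} s∈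
                ... | a , p , a∈ , p∈ , refl with image⁻ {_*ᶠ_} {Y} {A₁} p∈
                ...   | y , b , y∈ , b∈ , refl = pick y y∈ (image⁺ {λ a b → a +ᶠ y *ᶠ b} {A₁} {A₁} a∈ b∈)

      combined : Combined
      combined = Fix.combine 𝒟 (Stabilizers.centre 𝔽 (Dilates.B 𝒟) (Dilates.Y 𝒟) L (Fix.β>0 𝒟) (Fix.Y>0 𝒟) (Fix.L>0 𝒟) (Dilates.#dilates≤ 𝒟))
        where
        𝒟 : Dilates
        𝒟 = dilates n>0 x>0 k>0 X≢0 energetic

-- Subsets and their indicators

open import Defs
open Reals
import Data.Rational.Base as ℚ
open RationalFacts using (ι)

does⁻ : ∀ {P : Set} (P? : Dec P) → T (does P?) → P
does⁻ (yes p) _ = p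

card≡∑ : ∀ {q} (S : Subset q) → card S ≡ (∑[ i ∈ allFin q ] ⟦ lookup S i ⟧)
card≡∑ S = trans (go S) (sym (∑-allFin (λ i → ⟦ lookup S i ⟧)))
  where
  go : ∀ {q} (S : Subset q) → card S ≡ sumᶠ (λ i → ⟦ lookup S i ⟧)
  go []          = refl
  go (true ∷ S)  = cong suc (go S)
  go (false ∷ S) = go S

∈⇒T : ∀ {q} {S : Subset q} {i} → i ∈ S → T (lookup S i)
∈⇒T {i = i} i∈ = subst T (sym ([]=⇒lookup i∈)) _

T⇒∈ : ∀ {q} {S : Subset q} {i} → T (lookup S i) → i ∈ S
T⇒∈ {S = S} {i} h with lookup S i in eq
... | true = lookup⇒[]= i S eq

∈-tabulate⁻ : ∀ {q} {s : Fin q → Bool} {i} → i ∈ tabulateᵛ s → T (s i)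
∈-tabulate⁻ {s = s} {i} h = subst T (lookup∘tabulate s i) (∈⇒T h)

∈-⋃⁺ : ∀ {q} {I : Set} (f : I → Fin q) {xs x} → x List.∈ xs → f x ∈ ⋃ (map (⁅_⁆ ∘ f) xs)
∈-⋃⁺ f {x ∷ xs} (here refl) = x∈p∪q⁺ (inj₁ (x∈⁅x⁆ (f x)))
∈-⋃⁺ f {x ∷ xs} (there x∈)  = x∈p∪q⁺ (inj₂ (∈-⋃⁺ f x∈))

∈-⋃⁻ : ∀ {q} {I : Set} (f : I → Fin q) xs {i} → i ∈ ⋃ (map (⁅_⁆ ∘ f) xs) → ∃ λ x → x List.∈ xs × i ≡ f x
∈-⋃⁻ f []       i∈ = contradiction i∈ ∉⊥
∈-⋃⁻ f (x ∷ xs) i∈ with x∈p∪q⁻ ⁅ f x ⁆ _ i∈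
... | inj₁ i∈x = x , here refl , x∈⁅y⁆⇒x≡y (f x) i∈x
... | inj₂ i∈  = let y , y∈ , eq = ∈-⋃⁻ f xs i∈ in y , there y∈ , eq

-- Transfer to subsets of the field

opaque
  -- The largest demand comes from A₁ + Y A₁: with k = 4 κ it is 4^150 times the numeral of 16 L⁶,
  -- which is below 2^568.
  C : ℕ
  C = 2 ^ 600

  ≤C : ∀ n → T (n ≤ᵇ 2 ^ 600) → n ≤ C
  ≤C n = ≤ᵇ⇒≤ n (2 ^ 600)

module FieldBridge {q : ℕ} (𝔽 : FiniteField q) where

  open FiniteField 𝔽
  open FieldSubsets 𝔽
  private module R = CommutativeRing commutativeRing
  open Inverse enumeration using (to-cong; strictlyInverseˡ; strictlyInverseʳ)
  private module ≈R = SetoidReasoning setoid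

  private
    element-index : ∀ x → element (index x) ≈ x
    element-index = strictlyInverseʳ

    index-element : ∀ i → index (element i) ≡ i
    index-element = strictlyInverseˡ

    index-cong : ∀ {x y} → x ≈ y → index x ≡ index y
    index-cong = to-cong

    element-injective : ∀ {i j} → element i ≈ element j → i ≡ j
    element-injective {i} {j} h = trans (sym (index-element i)) (trans (index-cong h) (index-element j))

    rawRing : RawRing 0ℓ 0ℓ
    rawRing = record
      { Carrier = Fin q
      ; _≈_ = _≡_
      ; _+_ = λ i j → index (element i +ᶠ element j)
      ; _*_ = λ i j → index (element i *ᶠ element j)
      ; -_  = λ i → index (R.- element i)
      ; 0#  = index 0#
      ; 1#  = index 1#
      }

    isRingMonomorphism : IsRingMonomorphism rawRing R.rawRing element
    isRingMonomorphism = record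
      { isRingHomomorphism = record
        { isSemiringHomomorphism = record
          { isNearSemiringHomomorphism = record
            { +-isMonoidHomomorphism = record
              { isMagmaHomomorphism = record
                { isRelHomomorphism = record { cong = λ { refl → R.refl } }
                ; homo = λ i j → element-index _
                }
              ; ε-homo = element-index 0#
              }
            ; *-homo = λ i j → element-index _
            }
          ; 1#-homo = element-index 1#
          }
        ; -‿homo = λ i → element-index _
        }
      ; injective = element-injective
      }

  indexField : IndexField q
  indexField = record
    { isCommutativeRing = RingMonomorphism.isCommutativeRing isRingMonomorphism R.isCommutativeRing
    ; inverse = λ i i≢0 →
        let y , xy≈1 = inverse (element i) (λ i≈0 → i≢0 (trans (sym (index-element i)) (index-cong i≈0)))
        in index y , index-cong (R.trans (R.*-congˡ (element-index y)) xy≈1)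
    }

  open IndexField indexField using () renaming (_+ᶠ_ to _+ⁱ_; _*ᶠ_ to _*ⁱ_; _-ᶠ_ to _-ⁱ_)
  open FieldCounting indexField hiding (energy)
  private module Index = FieldCounting indexField

  element-* : ∀ i j → element (i *ⁱ j) ≈ element i *ᶠ element j
  element-* i j = element-index _

  element-+ : ∀ i j → element (i +ⁱ j) ≈ element i +ᶠ element j
  element-+ i j = element-index _

  element-- : ∀ i j → element (i -ⁱ j) ≈ element i -ᶠ element j
  element-- i j = R.trans (element-index _) (R.+-congˡ (element-index _))

  card≡# : ∀ S → card S ≡ # (lookup S)
  card≡# S = trans (card≡∑ S) (cong (λ U → ∑[ i ∈ U ] ⟦ lookup S i ⟧) (sym U≡allFin))

  card-tabulate : ∀ s → card (tabulateᵛ s) ≡ # s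
  card-tabulate s = trans (card≡# (tabulateᵛ s)) (∑-cong U λ i → cong ⟦_⟧ (lookup∘tabulate s i))

  card≤# : ∀ S s → (∀ {i} → i ∈ S → T (s i)) → card S ≤ # s
  card≤# S s h = ≤-trans (≤-reflexive (card≡# S)) (∑-mono′ U λ i → ⟦⟧-mono (h ∘ T⇒∈))

  cube : ∀ S → card S ^ 3 ≡ # (lookup S) * # (lookup S) * # (lookup S)
  cube S = trans (cong (_^ 3) (card≡# S)) (e (# (lookup S)))
    where
    e : ∀ n → n * (n * (n * 1)) ≡ n * n * n
    e = solve-∀

  ∈-elements⁺ : ∀ {S i} → i ∈ S → element i List.∈ elements S
  ∈-elements⁺ {S} i∈ = ∈-map⁺ element (∈-filter⁺ (_∈? S) (∈-allFin _) i∈)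

  ∈-elements⁻ : ∀ {S x} → x List.∈ elements S → ∃ λ i → i ∈ S × x ≡ element i
  ∈-elements⁻ {S} x∈ = let i , i∈ , eq = ∈-map⁻ element x∈ in i , proj₂ (∈-filter⁻ (_∈? S) {xs = allFin q} i∈) , eq

  ∑-elements : ∀ S f → ∑ (elements S) f ≡ (∑[ i ∈ U ] ⟦ lookup S i ⟧ * f (element i))
  ∑-elements S f = trans (∑-map element (filter (_∈? S) (allFin q)) f) (trans
    (∑-filter (_∈? S) (allFin q) (f ∘ element)) (trans
    (∑-cong (allFin q) λ i → cong (λ b → ⟦ b ⟧ * f (element i)) (does-∈? i))
    (cong (λ U → ∑[ i ∈ U ] ⟦ lookup S i ⟧ * f (element i)) (sym U≡allFin))))
    where
    does-∈? : ∀ i → does (i ∈? S) ≡ lookup S i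
    does-∈? i with i ∈? S
    ... | yes i∈ = sym ([]=⇒lookup i∈)
    ... | no i∉ with lookup S i in eq
    ...   | true  = contradiction (lookup⇒[]= i S eq) i∉
    ...   | false = refl

  sum-map : ∀ {I : Set} (f : I → ℕ) xs → sum (map f xs) ≡ ∑ xs f
  sum-map f []       = refl
  sum-map f (x ∷ xs) = cong (f x +_) (sum-map f xs)

  energySum≡ : ∀ X A → energySum X A ≡ (∑[ i ∈ U ] ⟦ lookup X i ⟧ * energy A (element i))
  energySum≡ X A = trans (sum-map (energy A) (elements X)) (∑-elements X (energy A))

  -- In a solution a₁ equals a₂ + ξ (a₃ - a₄), so summing over a₁ leaves an indicator of A. This
  -- direction carries the hypothesis, a lower bound for the energy, over to the indices.
  energy≤ : ∀ A i → energy A (element i) ≤ Index.energy (lookup A) i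
  energy≤ A x = ≤-trans (≤-reflexive expand) bound
    where
    as : List Carrier
    as = elements A
    a : Fin q → Bool
    a = lookup A
    solution : Carrier → Carrier → Carrier → Carrier → Bool
    solution a₁ a₂ a₃ a₄ = does ((a₁ -ᶠ a₂) ≈? (element x *ᶠ (a₃ -ᶠ a₄)))
    expand : energy A (element x) ≡ (∑[ a₁ ∈ as ] ∑[ a₂ ∈ as ] ∑[ a₃ ∈ as ] ∑[ a₄ ∈ as ] ⟦ solution a₁ a₂ a₃ a₄ ⟧)
    expand = trans (length-filter (λ (a₁ , a₂ , a₃ , a₄) → (a₁ -ᶠ a₂) ≈? (element x *ᶠ (a₃ -ᶠ a₄))) (cartesianProduct as (cartesianProduct as (cartesianProduct as as))))
      (trans (∑-product as (cartesianProduct as (cartesianProduct as as)) _) (∑-cong as λ a₁ →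
        trans (∑-product as (cartesianProduct as as) _) (∑-cong as λ a₂ → ∑-product as as _)))
    unique : ∀ i j k l → T (a i) → T (solution (element i) (element j) (element k) (element l)) →
             i ≡ j +ⁱ x *ⁱ (k -ⁱ l)
    unique i j k l _ h = element-injective (≈R.begin
      element i                                                     ≈R.≈⟨ R.trans (R.+-congˡ (R.-‿inverseˡ (element j))) (R.+-identityʳ (element i)) ⟨
      element i +ᶠ ((R.- element j) +ᶠ element j)                   ≈R.≈⟨ R.+-assoc _ _ _ ⟨
      (element i -ᶠ element j) +ᶠ element j                         ≈R.≈⟨ R.+-comm _ _ ⟩
      element j +ᶠ (element i -ᶠ element j)                         ≈R.≈⟨ R.+-congˡ (does⁻ (_ ≈? _) h) ⟩
      element j +ᶠ element x *ᶠ (element k -ᶠ element l)            ≈R.≈⟨ R.+-congˡ (R.trans (element-* _ _) (R.*-congˡ (element-- k l))) ⟨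
      element j +ᶠ element (x *ⁱ (k -ⁱ l))                          ≈R.≈⟨ element-+ _ _ ⟨
      element (j +ⁱ x *ⁱ (k -ⁱ l))                                  ≈R.∎)
    count : ∀ j k l → (∑[ i ∈ U ] ⟦ a i ⟧ * ⟦ solution (element i) (element j) (element k) (element l) ⟧) ≤ ⟦ a (j +ⁱ x *ⁱ (k -ⁱ l)) ⟧
    count j k l = ≤-trans (∑-mono′ U λ i → at i)
      (≤-reflexive (trans (∑-*ˡ U ⟦ a t ⟧ _) (trans (cong (⟦ a t ⟧ *_) (∑-point t)) (*-identityʳ _))))
      where
      t : Fin q
      t = j +ⁱ x *ⁱ (k -ⁱ l)
      at : ∀ i → ⟦ a i ⟧ * ⟦ solution (element i) (element j) (element k) (element l) ⟧ ≤ ⟦ a t ⟧ * ⟦ does (t ≟ᶠ i) ⟧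
      at i = ⟦⟧*-≤ (a i) λ i∈ → ≤-trans (≤-reflexive (sym (*-identityʳ _)))
        (⟦⟧*-≤ (solution (element i) (element j) (element k) (element l)) λ h → one i∈ (unique i j k l i∈ h))
        where
        one : T (a i) → i ≡ t → 1 ≤ ⟦ a t ⟧ * ⟦ does (t ≟ᶠ i) ⟧
        one i∈ refl with t ≟ᶠ t
        ... | yes _  = ≤-reflexive (sym (trans (*-identityʳ ⟦ a t ⟧) (T⇒⟦⟧≡1 i∈)))
        ... | no t≢t = contradiction refl t≢t
    term : Fin q → Fin q → Fin q → Fin q → ℕ
    term i j k l = ⟦ solution (element i) (element j) (element k) (element l) ⟧
    pull : ∀ i j k l → ⟦ a i ⟧ * (⟦ a j ⟧ * (⟦ a k ⟧ * (⟦ a l ⟧ * term i j k l))) ≡ ⟦ a j ⟧ * (⟦ a l ⟧ * (⟦ a k ⟧ * (⟦ a i ⟧ * term i j k l)))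
    pull i j k l = go ⟦ a i ⟧ ⟦ a j ⟧ ⟦ a k ⟧ ⟦ a l ⟧ (term i j k l)
      where
      go : ∀ i j k l t → i * (j * (k * (l * t))) ≡ j * (l * (k * (i * t)))
      go = solve-∀
    inside : ∀ (f : Fin q → ℕ) (b : ℕ) → b * ∑ U f ≡ (∑[ i ∈ U ] b * f i)
    inside f b = sym (∑-*ˡ U b f)
    bound : (∑[ a₁ ∈ as ] ∑[ a₂ ∈ as ] ∑[ a₃ ∈ as ] ∑[ a₄ ∈ as ] ⟦ solution a₁ a₂ a₃ a₄ ⟧) ≤ Index.energy a x
    bound = begin
      (∑[ a₁ ∈ as ] ∑[ a₂ ∈ as ] ∑[ a₃ ∈ as ] ∑[ a₄ ∈ as ] ⟦ solution a₁ a₂ a₃ a₄ ⟧)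
        ≡⟨ trans (∑-elements A _) (∑-cong U λ i → cong (⟦ a i ⟧ *_) (trans (∑-elements A _) (∑-cong U λ j → cong (⟦ a j ⟧ *_)
               (trans (∑-elements A _) (∑-cong U λ k → cong (⟦ a k ⟧ *_) (∑-elements A _)))))) ⟩
      (∑[ i ∈ U ] ⟦ a i ⟧ * (∑[ j ∈ U ] ⟦ a j ⟧ * (∑[ k ∈ U ] ⟦ a k ⟧ * (∑[ l ∈ U ] ⟦ a l ⟧ * term i j k l))))
        ≡⟨ (∑-cong U λ i → trans (inside _ ⟦ a i ⟧) (∑-cong U λ j → trans (cong (⟦ a i ⟧ *_) (trans (inside _ ⟦ a j ⟧) (∑-cong U λ k →
               trans (cong (⟦ a j ⟧ *_) (inside _ ⟦ a k ⟧)) (inside _ ⟦ a j ⟧)))) (trans (inside _ ⟦ a i ⟧) (∑-cong U λ k → trans (inside _ ⟦ a i ⟧)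
               (∑-cong U λ l → pull i j k l))))) ⟩
      (∑[ i ∈ U ] ∑[ j ∈ U ] ∑[ k ∈ U ] ∑[ l ∈ U ] ⟦ a j ⟧ * (⟦ a l ⟧ * (⟦ a k ⟧ * (⟦ a i ⟧ * term i j k l))))
        -- The order a₂, a₄, a₃, a₁ follows the nesting of `Index.energy` and puts the variable to
        -- be eliminated innermost.
        ≡⟨ trans (∑-comm U U _) (∑-cong U λ j → trans (∑-comm U U _) (trans (∑-cong U λ k → ∑-comm U U _) (∑-comm U U _))) ⟩
      (∑[ j ∈ U ] ∑[ l ∈ U ] ∑[ k ∈ U ] ∑[ i ∈ U ] ⟦ a j ⟧ * (⟦ a l ⟧ * (⟦ a k ⟧ * (⟦ a i ⟧ * term i j k l))))
        ≡⟨ (∑-cong U λ j → ∑-cong U λ l → trans (∑-cong U λ k → trans (∑-*ˡ U ⟦ a j ⟧ _) (cong (⟦ a j ⟧ *_) (trans (∑-*ˡ U ⟦ a l ⟧ _)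
               (cong (⟦ a l ⟧ *_) (∑-*ˡ U ⟦ a k ⟧ _))))) (trans (∑-*ˡ U ⟦ a j ⟧ _) (cong (⟦ a j ⟧ *_) (∑-*ˡ U ⟦ a l ⟧ _)))) ⟩
      (∑[ j ∈ U ] ∑[ l ∈ U ] ⟦ a j ⟧ * (⟦ a l ⟧ * (∑[ k ∈ U ] ⟦ a k ⟧ * (∑[ i ∈ U ] ⟦ a i ⟧ * term i j k l))))
        ≤⟨ (∑-mono′ U λ j → ∑-mono′ U λ l → *-monoʳ-≤ ⟦ a j ⟧ (*-monoʳ-≤ ⟦ a l ⟧ (∑-mono′ U λ k → *-monoʳ-≤ ⟦ a k ⟧ (count j k l)))) ⟩
      Index.energy a x ∎

  ⊕⁻ : ∀ S S′ {i} → i ∈ S ⊕ S′ → ∃ λ j → ∃ λ k → j ∈ S × k ∈ S′ × j +ⁱ k ≡ i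
  ⊕⁻ S S′ i∈ with ∈-⋃⁻ index (cartesianProductWith _+ᶠ_ (elements S) (elements S′)) i∈
  ... | z , z∈ , refl with ∈-cartesianProductWith⁻ _+ᶠ_ (elements S) (elements S′) z∈
  ...   | x , y , x∈ , y∈ , refl with ∈-elements⁻ {S} x∈ | ∈-elements⁻ {S′} y∈
  ...     | j , j∈ , refl | k , k∈ , refl = j , k , j∈ , k∈ , refl

  ⊖⁻ : ∀ S S′ {i} → i ∈ S ⊖ S′ → ∃ λ j → ∃ λ k → j ∈ S × k ∈ S′ × j -ⁱ k ≡ i
  ⊖⁻ S S′ i∈ with ∈-⋃⁻ index (cartesianProductWith _-ᶠ_ (elements S) (elements S′)) i∈
  ... | z , z∈ , refl with ∈-cartesianProductWith⁻ _-ᶠ_ (elements S) (elements S′) z∈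
  ...   | x , y , x∈ , y∈ , refl with ∈-elements⁻ {S} x∈ | ∈-elements⁻ {S′} y∈
  ...     | j , j∈ , refl | k , k∈ , refl = j , k , j∈ , k∈ , index-cong (R.+-congˡ (element-index _))

  ⊛⁻ : ∀ S S′ {i} → i ∈ S ⊛ S′ → ∃ λ j → ∃ λ k → j ∈ S × k ∈ S′ × j *ⁱ k ≡ i
  ⊛⁻ S S′ i∈ with ∈-⋃⁻ index (cartesianProductWith _*ᶠ_ (elements S) (elements S′)) i∈
  ... | z , z∈ , refl with ∈-cartesianProductWith⁻ _*ᶠ_ (elements S) (elements S′) z∈
  ...   | x , y , x∈ , y∈ , refl with ∈-elements⁻ {S} x∈ | ∈-elements⁻ {S′} y∈
  ...     | j , j∈ , refl | k , k∈ , refl = j , k , j∈ , k∈ , refl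

  •⁻ : ∀ x S {i} → i ∈ x • S → ∃ λ k → k ∈ S × index x *ⁱ k ≡ i
  •⁻ x S i∈ with ∈-⋃⁻ index (map (x *ᶠ_) (elements S)) i∈
  ... | z , z∈ , refl with ∈-map⁻ (x *ᶠ_) z∈
  ...   | y , y∈ , refl with ∈-elements⁻ {S} y∈
  ...     | k , k∈ , refl = k , k∈ , index-cong (R.*-congʳ (element-index x))

  •⁺ : ∀ x S {i} → i ∈ S → index (x *ᶠ element i) ∈ x • S
  •⁺ x S i∈ = ∈-⋃⁺ index (∈-map⁺ (x *ᶠ_) (∈-elements⁺ i∈))

  ∈-translate : ∀ A i j → i +ⁱ j ∈ A → i ∈ translate A (element j)
  ∈-translate A i j i+j∈ = subst (_∈ translate A (element j)) (trans (index-cong (≈R.begin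
    element (i +ⁱ j) -ᶠ element j                ≈R.≈⟨ R.+-congʳ (element-+ i j) ⟩
    (element i +ᶠ element j) -ᶠ element j        ≈R.≈⟨ R.+-assoc _ _ _ ⟩
    element i +ᶠ (element j -ᶠ element j)        ≈R.≈⟨ R.+-congˡ (R.-‿inverseʳ (element j)) ⟩
    element i +ᶠ 0#                              ≈R.≈⟨ R.+-identityʳ (element i) ⟩
    element i                                    ≈R.∎)) (index-element i))
    (∈-⋃⁺ index (∈-map⁺ (_-ᶠ element j) (∈-elements⁺ i+j∈)))

  ⁻¹ᶠ-inverseˡ : ∀ x → ¬ x ≈ 0# → (x ⁻¹ᶠ) *ᶠ x ≈ 1#
  ⁻¹ᶠ-inverseˡ x x≉0 with x ≈? 0#
  ... | yes x≈0 = contradiction x≈0 x≉0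
  ... | no x≉0  = R.trans (R.*-comm _ _) (proj₂ (inverse x x≉0))

  ∈-quotient : ∀ X i j → ¬ element i ≈ 0# → i *ⁱ j ∈ X → j ∈ (element i ⁻¹ᶠ) • X
  ∈-quotient X i j i≉0 ij∈ = subst (_∈ (element i ⁻¹ᶠ) • X) (trans (index-cong (≈R.begin
    (element i ⁻¹ᶠ) *ᶠ element (i *ⁱ j)                ≈R.≈⟨ R.*-congˡ (element-* i j) ⟩
    (element i ⁻¹ᶠ) *ᶠ (element i *ᶠ element j)        ≈R.≈⟨ R.*-assoc _ _ _ ⟨
    ((element i ⁻¹ᶠ) *ᶠ element i) *ᶠ element j        ≈R.≈⟨ R.*-congʳ (⁻¹ᶠ-inverseˡ (element i) i≉0) ⟩
    1# *ᶠ element j                                    ≈R.≈⟨ R.*-identityˡ (element j) ⟩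
    element j                                          ≈R.∎)) (index-element j))
    (•⁺ (element i ⁻¹ᶠ) X ij∈)

  -- The conclusion with naturals in place of Λ and K; lower bounds are multiplied out so that no
  -- reciprocals occur.
  Structured : (C κ e : ℕ) (A X : Subset q) → Set
  Structured C κ e A X =
    ∃ λ ā → ∃ λ x₀ → ∃ λ A₁ → ∃ λ X′ →
      ā ∈ᶠ A × x₀ ∈ᶠ X × A₁ ⊆ translate A ā × X′ ⊆ (x₀ ⁻¹ᶠ) • X ×
      (card A ≤ C * κ ^ 85 * card A₁ × card X ≤ C * κ ^ e * card X′) ×
      card (A₁ ⊕ X′ ⊛ A₁) ≤ C * κ ^ 226 * card A₁ ×
      (card (A₁ ⊕ A₁) ≤ C * κ ^ 92 * card A₁ × card (A₁ ⊖ A₁) ≤ C * κ ^ 92 * card A₁) ×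
      (∀ x′ → x′ ∈ᶠ X′ →
        card (A₁ ⊕ x′ • A₁) ≤ C * κ ^ 126 * card A₁ ×
        card (A₁ ⊖ x′ • A₁) ≤ C * κ ^ 126 * card A₁)

  #>0 : ∀ {S : Fin q → Bool} {i} → T (S i) → 0 < # S
  #>0 {S} {i} i∈ = ≤-trans (≤-reflexive (sym (∑-point i))) (∑-mono′ U at)
    where
    at : ∀ j → ⟦ does (i ≟ᶠ j) ⟧ ≤ ⟦ S j ⟧
    at j with i ≟ᶠ j
    ... | yes refl = ≤-reflexive (sym (T⇒⟦⟧≡1 i∈))
    ... | no _     = z≤n

  energy≤³ : ∀ a x → Index.energy a x ≤ # a * # a * # a
  energy≤³ a x = begin
    Index.energy a x
      ≤⟨ (∑-mono′ U λ c → ∑-mono′ U λ d → *-monoʳ-≤ ⟦ a c ⟧ (*-monoʳ-≤ ⟦ a d ⟧ (∑-mono′ U λ b →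
             ≤-trans (*-monoʳ-≤ ⟦ a b ⟧ (⟦⟧≤1 _)) (≤-reflexive (*-identityʳ _))))) ⟩
    (∑[ c ∈ U ] ∑[ d ∈ U ] ⟦ a c ⟧ * (⟦ a d ⟧ * # a))
      ≡⟨ trans (sym (∑-* U U _ _)) (trans (cong (# a *_) (∑-*ʳ U (# a) _)) (sym (*-assoc (# a) (# a) (# a)))) ⟩
    # a * # a * # a ∎

  module _ (A X : Subset q) (κ : ℕ) (κ>0 : 0 < κ) (A-nonempty : Nonempty A) (X-nonempty : Nonempty X) (0∉X : ¬ 0# ∈ᶠ X) where

    private
      a : Fin q → Bool
      a = lookup A
      -- The factor 2 pays for keeping only those ξ whose energy is at least half of the assumed
      -- average; the popularity threshold doubles once more, so that k = 4 κ.
      K n : ℕ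
      K = κ * 2
      n = # a

      n>0 : 0 < n
      n>0 = #>0 (∈⇒T (proj₂ A-nonempty))

      κ2>0 : 0 < K
      κ2>0 = *-mono-< {0} {κ} {0} {2} κ>0 (s≤s z≤n)

      k>0 : 0 < K * 2
      k>0 = *-mono-< {0} {K} {0} {2} κ2>0 (s≤s z≤n)

      k≡ : K * 2 ≡ κ * 4
      k≡ = *-assoc κ 2 2

    open Monomials (K * 2)

    module _ (X₁ : Fin q → Bool) (X₁⊆X : ∀ {ξ} → T (X₁ ξ) → ξ ∈ X) where

      open Combination indexField using (Combined; combined; L-monomial; D₀-monomial)

      -- X₁ is the part of X on which each single energy is large. The two cases of the theorem
      -- differ only in how much of X it contains, so the bound for |X| is an argument.
      structured : ∀ {e} (𝒞 : Combined a X₁ K) → # (lookup X) ≤ C * κ ^ e * # (Combined.Y 𝒞) → Structured C κ e A X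
      structured {e} 𝒞 #X≤ =
        element d , element η , tabulateᵛ A₁ , tabulateᵛ Y ,
        subst (_∈ A) (sym (index-element d)) (T⇒∈ d∈a) ,
        subst (_∈ X) (sym (index-element η)) (X₁⊆X η∈X) ,
        (λ {i} i∈ → ∈-translate A i d (T⇒∈ (A₁⊆ i (∈-tabulate⁻ i∈)))) ,
        (λ {j} j∈ → ∈-quotient X η j η≉0 (X₁⊆X (Y⊆ j (∈-tabulate⁻ j∈)))) ,
        ( bound 85 (var ⊗ con 6 ⊗ (L′ ⊗ con 2)) (≤ᵇ⇒≤ _ _ _) (≤C _ _) (≤-trans (≤-reflexive (card≡# A)) n≤)
        , subst₂ (λ x y → x ≤ C * κ ^ e * y) (sym (card≡# X)) (sym (card-tabulate Y)) #X≤ ) ,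
        bound 226 (L′ ⊗ L′ ⊗ L′ ⊗ L′ ⊗ L′ ⊗ con 8 ⊗ (L′ ⊗ con 2)) (≤ᵇ⇒≤ _ _ _) (≤C _ _)
          (≤-trans (card≤# _ (image _+ⁱ_ A₁ (image _*ⁱ_ Y A₁)) sumProduct) A₁+YA₁≤) ,
        ( bound 92 (D′ ⊗ D′ ⊗ D′ ⊗ (L′ ⊗ con 2)) (≤ᵇ⇒≤ _ _ _) (≤C _ _)
            (≤-trans (card≤# _ (image _+ⁱ_ A₁ A₁) sums) A₁+A₁≤)
        , bound 92 (D′ ⊗ (L′ ⊗ con 2)) (≤ᵇ⇒≤ _ _ _) (≤C _ _)
            (≤-trans (card≤# _ (image _-ⁱ_ A₁ A₁) differences) A₁-A₁≤) ) ,
        λ x′ x′∈ →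
          bound 126 (L′ ⊗ L′ ⊗ L′ ⊗ (L′ ⊗ con 2)) (≤ᵇ⇒≤ _ _ _) (≤C _ _)
            (≤-trans (card≤# _ (image (λ a b → a +ⁱ index x′ *ⁱ b) A₁ A₁) (sums′ x′)) (A₁+yA₁≤ (index x′) (∈-tabulate⁻ x′∈))) ,
          bound 126 (L′ ⊗ (L′ ⊗ con 2)) (≤ᵇ⇒≤ _ _ _) (≤C _ _)
            (≤-trans (card≤# _ (image (λ a b → a -ⁱ index x′ *ⁱ b) A₁ A₁) (differences′ x′)) (A₁-yA₁≤ (index x′) (∈-tabulate⁻ x′∈)))
        where
        open Combined 𝒞
        L′ = L-monomial a X₁ K
        D′ = D₀-monomial a X₁ K ⊗ (var ⊗ con 6)
        η≉0 : ¬ element η ≈ 0#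
        η≉0 η≈0 = 0∉X (subst (_∈ X) (trans (sym (index-element η)) (index-cong η≈0)) (X₁⊆X η∈X))
        bound : ∀ E {e c x m} → Monomial e c x → e ≤ E → 4 ^ e * c ≤ C → m ≤ x * # A₁ → m ≤ C * κ ^ E * card (tabulateᵛ A₁)
        bound E {x = x} {m} p e≤E small h = subst (λ y → m ≤ C * κ ^ E * y) (sym (card-tabulate A₁))
          (≤-trans h (*-monoˡ-≤ (# A₁) (evaluate E p k≡ κ>0 e≤E small)))
        sumProduct : ∀ {i} → i ∈ tabulateᵛ A₁ ⊕ tabulateᵛ Y ⊛ tabulateᵛ A₁ → T (image _+ⁱ_ A₁ (image _*ⁱ_ Y A₁) i)
        sumProduct i∈ with ⊕⁻ (tabulateᵛ A₁) (tabulateᵛ Y ⊛ tabulateᵛ A₁) i∈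
        ... | j , k , j∈ , k∈ , refl with ⊛⁻ (tabulateᵛ Y) (tabulateᵛ A₁) k∈
        ...   | y , b , y∈ , b∈ , refl = image⁺ {_+ⁱ_} {A₁} {image _*ⁱ_ Y A₁} (∈-tabulate⁻ j∈) (image⁺ {_*ⁱ_} {Y} {A₁} (∈-tabulate⁻ y∈) (∈-tabulate⁻ b∈))
        sums : ∀ {i} → i ∈ tabulateᵛ A₁ ⊕ tabulateᵛ A₁ → T (image _+ⁱ_ A₁ A₁ i)
        sums i∈ with ⊕⁻ (tabulateᵛ A₁) (tabulateᵛ A₁) i∈
        ... | j , k , j∈ , k∈ , refl = image⁺ {_+ⁱ_} {A₁} {A₁} (∈-tabulate⁻ j∈) (∈-tabulate⁻ k∈)
        differences : ∀ {i} → i ∈ tabulateᵛ A₁ ⊖ tabulateᵛ A₁ → T (image _-ⁱ_ A₁ A₁ i)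
        differences i∈ with ⊖⁻ (tabulateᵛ A₁) (tabulateᵛ A₁) i∈
        ... | j , k , j∈ , k∈ , refl = image⁺ {_-ⁱ_} {A₁} {A₁} (∈-tabulate⁻ j∈) (∈-tabulate⁻ k∈)
        sums′ : ∀ x′ {i} → i ∈ tabulateᵛ A₁ ⊕ x′ • tabulateᵛ A₁ → T (image (λ a b → a +ⁱ index x′ *ⁱ b) A₁ A₁ i)
        sums′ x′ i∈ with ⊕⁻ (tabulateᵛ A₁) (x′ • tabulateᵛ A₁) i∈
        ... | j , k , j∈ , k∈ , refl with •⁻ x′ (tabulateᵛ A₁) k∈
        ...   | b , b∈ , refl = image⁺ {λ a b → a +ⁱ index x′ *ⁱ b} {A₁} {A₁} (∈-tabulate⁻ j∈) (∈-tabulate⁻ b∈)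
        differences′ : ∀ x′ {i} → i ∈ tabulateᵛ A₁ ⊖ x′ • tabulateᵛ A₁ → T (image (λ a b → a -ⁱ index x′ *ⁱ b) A₁ A₁ i)
        differences′ x′ i∈ with ⊖⁻ (tabulateᵛ A₁) (x′ • tabulateᵛ A₁) i∈
        ... | j , k , j∈ , k∈ , refl with •⁻ x′ (tabulateᵛ A₁) k∈
        ...   | b , b∈ , refl = image⁺ {λ a b → a -ⁱ index x′ *ⁱ b} {A₁} {A₁} (∈-tabulate⁻ j∈) (∈-tabulate⁻ b∈)

      combination : 0 < # X₁ → (∀ {ξ} → T (X₁ ξ) → n * n * n ≤ K * energy A (element ξ)) → Combined a X₁ K
      combination x₁>0 energetic = combined a X₁ K n>0 x₁>0 k>0
        (λ {ξ} ξ∈ ξ≡0 → 0∉X (subst (_∈ X) ξ≡0 (X₁⊆X ξ∈)))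
        (λ {ξ} ξ∈ → ≤-trans (energetic ξ∈) (*-monoʳ-≤ K (energy≤ A ξ)))

    structured-pointwise : (∀ ξ → ξ ∈ᶠ X → card A ^ 3 ≤ κ * energy A ξ) → Structured C κ 4 A X
    structured-pointwise energetic = structured (lookup X) T⇒∈ {4} 𝒞 (≤-trans (Combination.Combined.x≤ 𝒞)
      (*-monoˡ-≤ _ (evaluate 4 (var ⊗ var ⊗ con 8) k≡ κ>0 (≤ᵇ⇒≤ 2 4 _) (≤C _ _))))
      where
      e : ∀ κ s → κ * s * 2 ≡ κ * 2 * s
      e = solve-∀
      𝒞 = combination (lookup X) T⇒∈ (#>0 (∈⇒T (proj₂ X-nonempty))) (λ {ξ} ξ∈ →
        ≤-trans (≤-reflexive (sym (cube A))) (≤-trans (energetic (element ξ) (subst (_∈ X) (sym (index-element ξ)) (T⇒∈ ξ∈)))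
        (≤-trans (m≤m*n (κ * energy A (element ξ)) 2) (≤-reflexive (e κ _)))))

    -- The elements of X outside X₁ carry at most half of the assumed energy sum, and each element
    -- of X₁ has energy at most |A|³. Hence |X| ≤ K |X₁|, and the loss k² of the pointwise case
    -- becomes k³.
    structured-average : card A ^ 3 * card X ≤ κ * energySum X A → Structured C κ 5 A X
    structured-average energetic = structured X₁ X₁⊆X {5} 𝒞 (begin
      # (lookup X)                             ≤⟨ #X≤ ⟩
      K * # X₁                                 ≤⟨ *-mono-≤ (m≤m*n K 2) (Combination.Combined.x≤ 𝒞) ⟩
      k * (k * k * 8 * # Y)                    ≡⟨ *-assoc k (k * k * 8) (# Y) ⟨
      k * (k * k * 8) * # Y                    ≤⟨ *-monoˡ-≤ (# Y) (evaluate 5 (var ⊗ (var ⊗ var ⊗ con 8)) k≡ κ>0 (≤ᵇ⇒≤ 3 5 _) (≤C _ _)) ⟩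
      C * κ ^ 5 * # Y                          ∎)
      where
      k : ℕ
      k = K * 2
      E : Fin q → ℕ
      E ξ = energy A (element ξ)
      X₁ : Fin q → Bool
      X₁ ξ = lookup X ξ ∧ (n * n * n ≤ᵇ K * E ξ)
      X₁⊆X : ∀ {ξ} → T (X₁ ξ) → ξ ∈ X
      X₁⊆X {ξ} p = T⇒∈ (proj₁ (T-∧⁻ {lookup X ξ} p))
      split : ∀ ξ → K * (⟦ lookup X ξ ⟧ * E ξ) ≤ ⟦ lookup X ξ ⟧ * (n * n * n) + ⟦ X₁ ξ ⟧ * (K * (n * n * n))
      split ξ with lookup X ξ | n * n * n ≤ᵇ K * E ξ in eq
      ... | false | _     = ≤-trans (≤-reflexive (*-zeroʳ K)) z≤n
      ... | true  | true  = ≤-trans (*-monoʳ-≤ K (≤-trans (≤-reflexive (*-identityˡ (E ξ))) (≤-trans (energy≤ A ξ) (energy≤³ a ξ))))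
                              (≤-trans (≤-reflexive (sym (*-identityˡ _))) (m≤n+m _ (1 * (n * n * n))))
      ... | true  | false = ≤-trans (≤-reflexive (cong (K *_) (*-identityˡ (E ξ))))
                              (≤-trans (≰ᵇ⇒≥ (n * n * n) (K * E ξ) eq) (≤-trans (≤-reflexive (sym (*-identityˡ _))) (m≤m+n (1 * (n * n * n)) _)))
      n³≢0 : NonZero (n * n * n)
      n³≢0 = m*n≢0 (n * n) n {{m*n≢0 n n {{>-nonZero n>0}} {{>-nonZero n>0}}}} {{>-nonZero n>0}}
      x : ℕ
      x = # (lookup X)
      #X≤ : x ≤ K * # X₁
      #X≤ = *-cancelʳ-≤ x _ (n * n * n) {{n³≢0}} (+-cancelˡ-≤ (x * (n * n * n)) _ _ (begin
        x * (n * n * n) + x * (n * n * n)            ≡⟨ e₁ x (n * n * n) ⟩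
        n * n * n * x * 2                            ≡⟨ cong₂ (λ c y → c * y * 2) (sym (cube A)) (sym (card≡# X)) ⟩
        card A ^ 3 * card X * 2                      ≤⟨ *-monoˡ-≤ 2 energetic ⟩
        κ * energySum X A * 2                        ≡⟨ cong (λ s → κ * s * 2) (energySum≡ X A) ⟩
        κ * (∑[ ξ ∈ U ] ⟦ lookup X ξ ⟧ * E ξ) * 2    ≡⟨ e₂ κ _ ⟩
        K * (∑[ ξ ∈ U ] ⟦ lookup X ξ ⟧ * E ξ)        ≡⟨ ∑-*ˡ U K _ ⟨
        (∑[ ξ ∈ U ] K * (⟦ lookup X ξ ⟧ * E ξ))      ≤⟨ ∑-mono′ U split ⟩
        (∑[ ξ ∈ U ] (⟦ lookup X ξ ⟧ * (n * n * n) + ⟦ X₁ ξ ⟧ * (K * (n * n * n))))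
                                                     ≡⟨ trans (∑-+ U _ _) (cong₂ _+_ (∑-*ʳ U (n * n * n) _) (∑-*ʳ U (K * (n * n * n)) _)) ⟩
        x * (n * n * n) + # X₁ * (K * (n * n * n))   ≡⟨ cong (x * (n * n * n) +_) (e₃ (# X₁) K (n * n * n)) ⟩
        x * (n * n * n) + K * # X₁ * (n * n * n)     ∎))
        where
        e₁ : ∀ x c → x * c + x * c ≡ c * x * 2
        e₁ = solve-∀
        e₂ : ∀ κ s → κ * s * 2 ≡ κ * 2 * s
        e₂ = solve-∀
        e₃ : ∀ x k c → x * (k * c) ≡ k * x * c
        e₃ = solve-∀
      x₁>0 : 0 < # X₁
      x₁>0 = n≢0⇒n>0 (λ x₁≡0 → <⇒≱ (#>0 (∈⇒T (proj₂ X-nonempty))) (≤-trans #X≤ (≤-reflexive (trans (cong (K *_) x₁≡0) (*-zeroʳ K)))))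
      𝒞 = combination X₁ X₁⊆X x₁>0 (λ {ξ} p → ≤ᵇ⇒≤ _ _ (proj₂ (T-∧⁻ {lookup X ξ} p)))
      Y : Fin q → Bool
      Y = Combination.Combined.Y 𝒞

  -- Return to the real parameters

  element∈ : ∀ X {i} → i ∈ X → element i ∈ᶠ X
  element∈ X {i} i∈ = subst (_∈ X) (sym (index-element i)) i∈

  card>0 : ∀ {S : Subset q} → Nonempty S → 0 < card S
  card>0 {S} (i , i∈) = subst (0 <_) (sym (card≡# S)) (#>0 (∈⇒T i∈))

  energy≤cube : ∀ A i → energy A (element i) ≤ card A ^ 3
  energy≤cube A i = ≤-trans (energy≤ A i) (≤-trans (energy≤³ (lookup A) i) (≤-reflexive (sym (cube A))))

  energySum≤ : ∀ A X → energySum X A ≤ card A ^ 3 * card X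
  energySum≤ A X = begin
    energySum X A                                          ≡⟨ energySum≡ X A ⟩
    (∑[ i ∈ U ] ⟦ lookup X i ⟧ * energy A (element i))     ≤⟨ (∑-mono′ U λ i → *-monoʳ-≤ ⟦ lookup X i ⟧ (energy≤cube A i)) ⟩
    (∑[ i ∈ U ] ⟦ lookup X i ⟧ * card A ^ 3)               ≡⟨ ∑-*ʳ U (card A ^ 3) _ ⟩
    # (lookup X) * card A ^ 3                              ≡⟨ trans (*-comm _ (card A ^ 3)) (cong (card A ^ 3 *_) (sym (card≡# X))) ⟩
    card A ^ 3 * card X                                    ∎

  module _ (Λ K : ℝ⁺) (C≤Λ : Eventually (λ n → ι (C * 7 ^ 226) ℚ.≤ approx (real Λ) n))
           (A X : Subset q) (A-nonempty : Nonempty A) (X-nonempty : Nonempty X) (0∉X : ¬ 0# ∈ᶠ X) where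

    private
      toReal : ∀ κ e → e ≤ 226 → Rounding K κ → Structured C κ e A X → StructuredSubsets Λ K e A X
      toReal κ e e≤226 K≈κ (ā , x₀ , A₁ , X′ , ā∈ , x₀∈ , A₁⊆ , X′⊆ , (A≤ , X≤) , sumProduct , (sums , differences) , dilates) =
        ā , x₀ , A₁ , X′ , ā∈ , x₀∈ , A₁⊆ , X′⊆ ,
        (lower′ 85 (≤ᵇ⇒≤ _ _ _) A≤ , lower′ e e≤226 X≤) , upper′ 226 ≤-refl sumProduct ,
        (upper′ 92 (≤ᵇ⇒≤ _ _ _) sums , upper′ 92 (≤ᵇ⇒≤ _ _ _) differences) ,
        λ x′ x′∈ → upper′ 126 (≤ᵇ⇒≤ _ _ _) (proj₁ (dilates x′ x′∈)) , upper′ 126 (≤ᵇ⇒≤ _ _ _) (proj₂ (dilates x′ x′∈))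
        where
        upper′ : ∀ e {m N} → e ≤ 226 → m ≤ C * κ ^ e * N → fromℕ m ≤ℝ (Λ *⁺ K ^⁺ e) · N
        upper′ e {m} {N} = upper Λ K {κ} {C} K≈κ C≤Λ {e} {m} {N}
        lower′ : ∀ e {m N} → e ≤ 226 → N ≤ C * κ ^ e * m → (Λ ⁻¹ *⁺ (K ^⁺ e) ⁻¹) · N ≤ℝ fromℕ m
        lower′ e {m} {N} = lower Λ K {κ} {C} K≈κ C≤Λ {e} {m} {N}

      A³>0 : 0 < card A ^ 3
      A³>0 = m^n>0 (card A) {{>-nonZero (card>0 A-nonempty)}} 3

    structuredSubsets-average : K ⁻¹ · card A ^ 3 * card X ≤ℝ fromℕ (energySum X A) → StructuredSubsets Λ K 5 A X
    structuredSubsets-average energetic = finish (rounding K (½≤K K N>0 (energySum≤ A X) energetic))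
      where
      N>0 : 0 < card A ^ 3 * card X
      N>0 = *-mono-< {0} {card A ^ 3} {0} {card X} A³>0 (card>0 X-nonempty)
      finish : (∃ λ κ → 0 < κ × Rounding K κ) → StructuredSubsets Λ K 5 A X
      finish (κ , κ>0 , K≈κ) = toReal κ 5 (≤ᵇ⇒≤ _ _ _) K≈κ
        (structured-average A X κ κ>0 A-nonempty X-nonempty 0∉X (≤ℝ⇒≤ K κ>0 K≈κ energetic))

    structuredSubsets-pointwise : (∀ ξ → ξ ∈ᶠ X → K ⁻¹ · card A ^ 3 ≤ℝ fromℕ (energy A ξ)) → StructuredSubsets Λ K 4 A X
    structuredSubsets-pointwise energetic = finish (rounding K (½≤K K A³>0 (energy≤cube A (proj₁ X-nonempty))
        (energetic (element (proj₁ X-nonempty)) (element∈ X (proj₂ X-nonempty)))))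
      where
      finish : (∃ λ κ → 0 < κ × Rounding K κ) → StructuredSubsets Λ K 4 A X
      finish (κ , κ>0 , K≈κ) = toReal κ 4 (≤ᵇ⇒≤ _ _ _) K≈κ
        (structured-pointwise A X κ κ>0 A-nonempty X-nonempty 0∉X (λ ξ ξ∈X → ≤ℝ⇒≤ K κ>0 K≈κ (energetic ξ ξ∈X)))

proposition4 :
  ∃ λ (C : ℝ⁺) → ∃ λ (k : ℝ⁺) →
  (q : ℕ) (q-primePower : IsPrimePower q) (𝔽 : FiniteField q) →
  let open FiniteField 𝔽
      open FieldSubsets 𝔽
      Λ = C *⁺ logℕ q (primePower>1 q-primePower) ^ℝ real k
  in
  (A X : Subset q) → Nonempty A → Nonempty X → ¬ 0# ∈ᶠ A → ¬ 0# ∈ᶠ X →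
  (K : ℝ⁺) →
  (K ⁻¹ · card A ^ 3 * card X ≤ℝ fromℕ (energySum X A) →
    StructuredSubsets Λ K 5 A X)
  ×
  ((∀ (ξ : Carrier) → ξ ∈ᶠ X → K ⁻¹ · card A ^ 3 ≤ℝ fromℕ (energy A ξ)) →
    StructuredSubsets Λ K 4 A X)
proposition4 = constant (M * 2) M>0 , ⅙⁺ , λ q q-primePower 𝔽 A X A-nonempty X-nonempty _ 0∉X K →
  let Λ = constant (M * 2) M>0 *⁺ logℕ q (primePower>1 q-primePower) ^ℝ real ⅙⁺
      M≤Λ = Λ-large M M>0 q (primePower>1 q-primePower)
      open FieldBridge 𝔽
  in structuredSubsets-average Λ K M≤Λ A X A-nonempty X-nonempty 0∉X ,
     structuredSubsets-pointwise Λ K M≤Λ A X A-nonempty X-nonempty 0∉X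
  where
  M : ℕ
  M = C * 7 ^ 226
  M>0 : 0 < M * 2
  M>0 = *-mono-< {0} {M} {0} {2} (*-mono-< {0} {C} {0} {7 ^ 226} (≤C 1 _) (m^n>0 7 226)) (s≤s z≤n)
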